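{- Let $m$ and $n$ be positive integers with $n$ composite. The following statements are equivalent: (a) $n$ is a Carmichael number of order $m$; (b) the function $x\mapsto x^n$ defines a ring endomorphism of every finite étale $\mathbb{Z}/n\mathbb{Z}$-algebra that can be generated as a $\mathbb{Z}/n\mathbb{Z}$-module by $m$ elements; (c) the following two conditions hold: (i) $n$ is squarefree; (ii) for every prime divisor $p$ of $n$ and for every integer $r$ with $1\le r\le m$, there is an integer $i\ge 0$ such that $n\equiv p^i \pmod{p^r-1}$.
   Context: Rings are assumed to have identity elements and ring homomorphisms send identity to identity; an endomorphism of a ring is a ring homomorphism from it to itself. For a positive integer $m$, a Carmichael number of order $m$ is a positive composite integer $n$ such that the map $x\mapsto x^n$ is a ring endomorphism of every $\mathbb{Z}/n\mathbb{Z}$-algebra that can be generated as a $\mathbb{Z}/n\mathbb{Z}$-module by $m$ elements. Finite étale algebras: if $R$ is a local ring, an $R$-algebra $S$ is finite étale if it is free of finite rank as an $R$-module and for some (equivalently every) $R$-basis $e_1,\dots,e_k$ of $S$ the determinant of the matrix $[\mathrm{Tr}_{S/R}(e_ie_j)]$ is a unit of $R$. If $R=R_1\times\cdots\times R_t$ with each $R_i$ local (e.g. $R$ finite), an $R$-algebra $S$ is finite étale if $S=S_1\times\cdots\times S_t$ with each $S_i$ a finite étale $R_i$-algebra (the zero ring is allowed). -}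

module Defs where

open import Level using (Level; _⊔_; suc)
open import Data.Nat as ℕ using (ℕ; zero; _≤_; _∸_)
open import Data.Nat.Primality using (Prime; Composite)
open import Data.Nat.Divisibility as ℕD using ()
open import Data.Integer as ℤ using (ℤ)
open import Data.Integer.Divisibility as ℤD using ()
open import Data.Fin using (Fin; punchIn) renaming (zero to fzero; suc to fsuc)
open import Data.Fin.Properties using ()
open import Data.Product using (Σ; ∃; ∃-syntax; _×_; _,_)
open import Relation.Binary.PropositionalEquality using (_≡_; _≢_)
open import Relation.Nullary using (¬_)
open import Algebra.Bundles using (CommutativeRing)
import Algebra.Definitions.RawSemiring as RS
open import Algebra.Bundles using (Semiring)

∑ℤ : ∀ {k} → (Fin k → ℤ) → ℤ
∑ℤ {zero}   f = ℤ.0ℤ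
∑ℤ {ℕ.suc k} f = f fzero ℤ.+ ∑ℤ (λ i → f (fsuc i))

∏ℕ : ∀ {k} → (Fin k → ℕ) → ℕ
∏ℕ {zero}   f = 1
∏ℕ {ℕ.suc k} f = f fzero ℕ.* ∏ℕ (λ i → f (fsuc i))

sign : ℕ → ℤ
sign zero          = ℤ.1ℤ
sign (ℕ.suc zero)  = ℤ.-1ℤ
sign (ℕ.suc (ℕ.suc j)) = sign j

det : ∀ {k} → (Fin k → Fin k → ℤ) → ℤ
det {zero}   M = ℤ.1ℤ
det {ℕ.suc k} M =
  ∑ℤ (λ j → sign (Data.Fin.toℕ j) ℤ.* (M fzero j ℤ.* det (λ r c → M (fsuc r) (punchIn j c))))

IsUnitMod : ℕ → ℤ → Set
IsUnitMod q a = ∃[ u ] (ℤ.+ q) ℤD.∣ (a ℤ.* u ℤ.- ℤ.1ℤ)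

-- Commutative ℤ/nℤ-algebras.
-- A (commutative) ℤ/nℤ-algebra is a commutative ring A together with a
-- ring homomorphism ℤ/nℤ → A; such a homomorphism exists (and is then
-- unique, namely k mod n ↦ k·1) exactly when n·1 = 0 in A.  The module
-- structure is then k · x = x + ⋯ + x (k times), written k × x.

module _ {c ℓ : Level} (A : CommutativeRing c ℓ) where
  open CommutativeRing A
  open RS (Semiring.rawSemiring semiring) using (_^_) renaming (_×_ to _·_)

  private
    ∑A : ∀ {k} → (Fin k → Carrier) → Carrier
    ∑A {zero}    f = 0#
    ∑A {ℕ.suc k} f = f fzero + ∑A (λ i → f (fsuc i))

  IsAlgebraOver : ℕ → Set ℓ
  IsAlgebraOver n = (n · 1#) ≈ 0#

  GeneratedByAsModule : ℕ → Set (c ⊔ ℓ)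
  GeneratedByAsModule m =
    Σ (Fin m → Carrier) λ g → ∀ (a : Carrier) → Σ (Fin m → ℕ) λ coef → a ≈ ∑A {m} (λ i → coef i · g i)

  PowerIsEndomorphism : ℕ → Set (c ⊔ ℓ)
  PowerIsEndomorphism n =
    (∀ x y → ((x + y) ^ n) ≈ ((x ^ n) + (y ^ n))) ×
    (∀ x y → ((x * y) ^ n) ≈ ((x ^ n) * (y ^ n))) ×
    ((1# ^ n) ≈ 1#)

  -- A is a finite étale ℤ/qℤ-algebra, for the local ring ℤ/qℤ
  -- (q a prime power): A is free of finite rank k over ℤ/qℤ with basis
  -- e₁,…,e_k, and det [Tr(eᵢeⱼ)] is a unit of ℤ/qℤ.  The trace is computed
  -- from the coordinate map `coord` w.r.t. the basis (coordinates are
  -- unique mod q by linear independence, so Tr is well defined mod q).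
  IsFiniteEtaleLocal : ℕ → Set (c ⊔ ℓ)
  IsFiniteEtaleLocal q =
    IsAlgebraOver q ×
    ∃[ k ] Σ (Fin k → Carrier) λ e → Σ (Carrier → Fin k → ℕ) λ coord →
      (∀ a → a ≈ ∑A (λ i → coord a i · e i)) ×
      (∀ (λs : Fin k → ℕ) → ∑A (λ i → λs i · e i) ≈ 0# → ∀ i → q ℕD.∣ λs i) ×
      let Tr : Carrier → ℤ
          Tr x = ∑ℤ (λ i → ℤ.+ coord (x * e i) i)
      in IsUnitMod q (det (λ i j → Tr (e i * e j)))

IsPrimePower : ℕ → Set
IsPrimePower q = ∃[ p ] ∃[ r ] Prime p × 1 ≤ r × q ≡ p ℕ.^ r

-- ℤ/nℤ ≅ ∏ᵢ ℤ/qᵢℤ with the qᵢ pairwise coprime prime powers: this is the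
-- decomposition of ℤ/nℤ into local rings.
IsLocalDecomposition : ℕ → ∀ {t} → (Fin t → ℕ) → Set
IsLocalDecomposition n {t} q =
  (∀ i → IsPrimePower (q i)) ×
  (∀ i j → i ≢ j → ∀ d → d ℕD.∣ q i → d ℕD.∣ q j → d ≡ 1) ×
  ∏ℕ q ≡ n

IsoToProduct : ∀ {c ℓ} (A : CommutativeRing c ℓ) {t} (S : Fin t → CommutativeRing c ℓ) → Set (c ⊔ ℓ)
IsoToProduct A {t} S =
  Σ ((a : A.Carrier) → (i : Fin t) → CommutativeRing.Carrier (S i)) λ f →
  Σ (((i : Fin t) → CommutativeRing.Carrier (S i)) → A.Carrier) λ g →
    (∀ {a b} → a A.≈ b → ∀ i → CommutativeRing._≈_ (S i) (f a i) (f b i)) ×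
    (∀ {u v} → (∀ i → CommutativeRing._≈_ (S i) (u i) (v i)) → g u A.≈ g v) ×
    (∀ a b i → CommutativeRing._≈_ (S i) (f (a A.+ b) i) (CommutativeRing._+_ (S i) (f a i) (f b i))) ×
    (∀ a b i → CommutativeRing._≈_ (S i) (f (a A.* b) i) (CommutativeRing._*_ (S i) (f a i) (f b i))) ×
    (∀ i → CommutativeRing._≈_ (S i) (f A.1# i) (CommutativeRing.1# (S i))) ×
    (∀ a → g (f a) A.≈ a) ×
    (∀ u i → CommutativeRing._≈_ (S i) (f (g u) i) (u i))
  where module A = CommutativeRing A

-- A is a finite étale ℤ/nℤ-algebra: ℤ/nℤ = ∏ Rᵢ with Rᵢ = ℤ/qᵢℤ local, and
-- A ≅ ∏ Sᵢ with each Sᵢ a finite étale Rᵢ-algebra (zero ring allowed).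
IsFiniteEtale : ∀ {c ℓ} → ℕ → CommutativeRing c ℓ → Set (suc (c ⊔ ℓ))
IsFiniteEtale {c} {ℓ} n A =
  IsAlgebraOver A n ×
  ∃[ t ] Σ (Fin t → ℕ) λ q → IsLocalDecomposition n q ×
    Σ (Fin t → CommutativeRing c ℓ) λ S →
      (∀ i → IsFiniteEtaleLocal (S i) (q i)) × IsoToProduct A S

IsCarmichaelOfOrder : (c ℓ : Level) → ℕ → ℕ → Set (suc (c ⊔ ℓ))
IsCarmichaelOfOrder c ℓ m n =
  Composite n ×
  ((A : CommutativeRing c ℓ) → IsAlgebraOver A n → GeneratedByAsModule A m →
     PowerIsEndomorphism A n)

EtaleCondition : (c ℓ : Level) → ℕ → ℕ → Set (suc (c ⊔ ℓ))
EtaleCondition c ℓ m n =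
  (A : CommutativeRing c ℓ) → IsFiniteEtale n A → GeneratedByAsModule A m →
    PowerIsEndomorphism A n

SquareFree : ℕ → Set
SquareFree n = ∀ p → Prime p → ¬ (p ℕ.* p ℕD.∣ n)

KorseltCondition : ℕ → ℕ → Set
KorseltCondition m n =
  SquareFree n ×
  (∀ p → Prime p → p ℕD.∣ n → ∀ r → 1 ≤ r → r ≤ m →
     ∃[ i ] (ℤ.+ (p ℕ.^ r ∸ 1)) ℤD.∣ (ℤ.+ n ℤ.- ℤ.+ (p ℕ.^ i)))

{-# OPTIONS --safe #-}
module Submission where

open import Defs
open import Level using (Level; _⊔_) renaming (suc to lsuc)
open import Data.Nat using (ℕ; _≤_)
open import Data.Nat as ℕ using (zero; suc; NonZero; z≤n; s≤s; _!)
import Data.Nat.Properties as ℕ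
open import Data.Nat.DivMod as ℕ using (_%_; _/_; m%n<n; m<n⇒m%n≡m; m≡m%n+[m/n]*n; m/n*n≡m)
open import Data.Nat.Divisibility as ℕD
  using (_∣_; _∣?_; divides; ∣m+n∣m⇒∣n; n∣m*n; m∣m*n; ∣n∣m%n⇒∣m; ∣-refl; ∣-trans; *-pres-∣; ∣m∣n⇒∣m+n; _∣0; n∣m⇒m%n≡0)
open import Data.Nat.Primality
open import Data.Nat.Primality.Factorisation using (factorise)
open import Data.Nat.Combinatorics using (_C_; nCn≡1; nCk≡n!/k![n-k]!; k![n∸k]!∣n!)
open import Data.Nat.Coprimality using (Coprime; coprime-Bézout; coprime-divisor)
open import Data.Nat.GCD as GCD using (module Bézout; gcd; gcd[m,n]∣m; gcd[m,n]∣n)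
open import Data.Nat.Induction using (<-rec)
open import Data.Nat.ListAction using (product)
open import Data.Integer as ℤ using (ℤ)
import Data.Integer.Properties as ℤ
import Data.Integer.Divisibility as ℤD
open import Data.Integer.Divisibility.Signed as ℤS using (∣ᵤ⇒∣; ∣⇒∣ᵤ)
open import Data.Fin using (Fin; toℕ; fromℕ; fromℕ<; inject₁; inject≤; punchIn; funToFin; finToFun; combine)
  renaming (zero to fzero; suc to fsuc)
open import Data.Fin.Properties
  using (toℕ-fromℕ; toℕ-fromℕ<; toℕ-inject₁; toℕ-injective; toℕ<n; suc-injective; inject≤-injective; finToFun-funToFin; funToFin-finToFin;
         any?; all?; pigeonhole; ¬∀⟶∃¬; punchInᵢ≢i)
  renaming (_≟_ to _≟F_)
open import Data.Fin.Permutation using (Permutation; permutation; _⟨$⟩ʳ_)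
open import Data.List using (List; []; _∷_; length; replicate)
open import Data.List.Properties using (length-replicate)
open import Data.List.Relation.Unary.All using (All; []; _∷_)
open import Data.Maybe using (Maybe; just; nothing)
open import Data.Product using (Σ; ∃-syntax; _×_; _,_; proj₁; proj₂)
open import Data.Sum using (_⊎_; inj₁; inj₂; [_,_]′)
open import Data.Empty using (⊥; ⊥-elim)
open import Data.Unit using (⊤; tt)
import Data.Vec.Functional as Vector
open import Function using (_∘_)
open import Function.Bundles using (_⇔_; mk⇔)
open import Relation.Nullary using (¬_; yes; no; Dec; ¬?; _×-dec_)
open import Relation.Nullary.Decidable using (decidable-stable; map′)
open import Relation.Binary.Definitions using (tri<; tri≈; tri>)
open import Relation.Binary.PropositionalEquality as ≡ using (_≡_; _≢_)
import Relation.Binary.Reasoning.Setoid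
open import Algebra.Bundles using (CommutativeRing; Ring)
import Algebra.Construct.Terminal as Terminal
import Algebra.Properties.AbelianGroup
import Algebra.Properties.CommutativeMonoid.Sum as CSum
import Algebra.Properties.CommutativeSemigroup
import Algebra.Properties.CommutativeSemiring.Binomial as Binomial
import Algebra.Properties.CommutativeSemiring.Exp
import Algebra.Properties.Monoid.Sum as MSum
import Algebra.Properties.Ring
import Algebra.Properties.Semiring.Exp
import Algebra.Properties.Semiring.Mult
import Algebra.Properties.Semiring.Sum
import Algebra.Solver.Ring as RingSolver
import Algebra.Solver.Ring.AlmostCommutativeRing as ACR

-- (c) ⇒ (a). By squarefreeness it suffices to work modulo a prime p ∣ n.  If p were less than m, p
-- would divide q ^ r - 1 for another prime q ∣ n and some r ≤ m, contradicting n ≡ qⁱ (mod q ^ r - 1);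
-- so p ≥ m.  An 𝔽ₚ-algebra A generated by m elements is a product of local ones, and a local one with
-- residue field of degree r ≤ m has nilpotents of index ≤ m ≤ p, so that x ^ n is a power of Frobenius.
-- Equality in A need not be decidable, but being zero modulo p is decidable for coefficient vectors: an
-- element with a nonzero coefficient vector can be divided out, and this lowers the number of generators.
-- Hence all case distinctions are made on coefficients and the arguments run by induction on m.
--
-- (b) ⇒ (c). In ℤ/pᵛ with v ≥ 2 the nilpotent p would satisfy pⁿ = p, so n is squarefree.  For p odd, a
-- field quotient K of the group ring 𝔽ₚ[C_N], N = p ^ r - 1, in which the generator ω keeps order N, is
-- 𝔽_{p^r}.  Write T(x) = ∑_{j<r} x ^ (p ^ j).  As p is odd, K has a T-orthogonal basis eᵢ, and expanding
-- a map φ linear over 𝔽ₚ in it gives φ(x) = ∑ⱼ cⱼ x ^ (p ^ j).  By independence of characters, φ = id shows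
-- that T is the trace, so the Gram matrix is diagonal with unit entries and K is étale; and φ(x) = x ^ n
-- shows ω ^ n = ω ^ (p ^ j) for some j, that is n ≡ p ^ j (mod N).  Finally p = 2 does not divide n, because
-- n ≡ qⁱ (mod q - 1) for the odd prime divisors q of n.

-- The exponent `i` in (c)(ii) depends on `r`, so no single power of Frobenius describes `x ^ n` on
-- all algebras with m generators; this is why the argument has to reach local algebras, where only
-- one residue degree occurs. There `x ^ (p ^ r) - x` is merely nilpotent. Since p ∣ n, the value
-- `x ^ n` depends only on `x ^ p`, and raising to the power p ≥ m removes the nilpotent part.
--
-- In the converse, the group ring replaces a search for irreducible polynomials. The choice N = p ^
-- r - 1 makes `x ^ (p ^ r) ≈ x` hold in the whole group ring, so counting roots bounds the degree
-- of every field quotient by r. The danger is that a quotient lowers the order of `ω`. It is met by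
-- the element `z`, a product of the `1 - ω ^ (N / l)` over the primes l ∣ N: `z` is nonzero, and it
-- becomes a unit modulo any maximal ideal containing its annihilator. Oddness of p enters through
-- polarization, which needs 2 to be invertible.

-- Primes, factorials and binomial coefficients

prime>0 : ∀ {p} → Prime p → 1 ≤ p
prime>0 {suc _} _  = s≤s z≤n
prime>0 {zero}  pr = ⊥-elim (¬prime[0] pr)

prime>1 : ∀ {p} → Prime p → 2 ≤ p
prime>1 {zero}        pr = ⊥-elim (¬prime[0] pr)
prime>1 {suc zero}    pr = ⊥-elim (¬prime[1] pr)
prime>1 {suc (suc _)} _  = s≤s (s≤s z≤n)

prime∤1 : ∀ {p} → Prime p → ¬ p ∣ 1
prime∤1 pr p∣1 = ¬prime[1] (≡.subst Prime (ℕD.∣1⇒≡1 p∣1) pr)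

prime∣prime : ∀ {p q} → Prime p → Prime q → p ∣ q → p ≡ q
prime∣prime pp pq p∣q with prime⇒irreducible pq p∣q
... | inj₁ p≡1 = ⊥-elim (¬prime[1] (≡.subst Prime p≡1 pp))
... | inj₂ p≡q = p≡q

prime∣^ : ∀ {p} → Prime p → ∀ m k → p ∣ m ℕ.^ k → p ∣ m
prime∣^ pr m zero    p∣1 = ⊥-elim (prime∤1 pr p∣1)
prime∣^ pr m (suc k) p∣  with euclidsLemma m (m ℕ.^ k) pr p∣
... | inj₁ p∣m = p∣m
... | inj₂ p∣mk = prime∣^ pr m k p∣mk

prime⇒coprime-∤ : ∀ {p k} → Prime p → ¬ p ∣ k → Coprime p k
prime⇒coprime-∤ pr p∤k {d} (d∣p , d∣k) with prime⇒irreducible pr d∣p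
... | inj₁ d≡1 = d≡1
... | inj₂ ≡.refl = ⊥-elim (p∤k d∣k)

<⇒∤ : ∀ {p k} → 1 ≤ k → k ℕ.< p → ¬ p ∣ k
<⇒∤ {p} {suc k} _ k<p p∣k = ℕ.<⇒≱ k<p (ℕD.∣⇒≤ p∣k)

prime∤! : ∀ {p} → Prime p → ∀ k → k ℕ.< p → ¬ p ∣ k !
prime∤! pr zero    _   p∣ = prime∤1 pr p∣
prime∤! pr (suc k) k<p p∣ with euclidsLemma (suc k) (k !) pr p∣
... | inj₁ p∣k = <⇒∤ (s≤s z≤n) k<p p∣k
... | inj₂ p∣k! = prime∤! pr k (ℕ.<-trans (ℕ.n<1+n k) k<p) p∣k!

-- In `(p C k) · k! · (p - k)! = p!` the prime divides the right side but neither factorial on the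
-- left, both having arguments below p.
prime∣C : ∀ {p} → Prime p → ∀ k → 1 ≤ k → k ℕ.< p → p ∣ p C k
prime∣C {p} pr k 1≤k k<p with euclidsLemma (p C k) (k ! ℕ.* (p ℕ.∸ k) !) pr
  (≡.subst (p ∣_) (≡.sym C*≡!) (p∣p! (prime>0 pr)))
  where
  instance _ = k ℕ.!* (p ℕ.∸ k) !≢0
  C*≡! : (p C k) ℕ.* (k ! ℕ.* (p ℕ.∸ k) !) ≡ p !
  C*≡! = ≡.trans (≡.cong (ℕ._* (k ! ℕ.* (p ℕ.∸ k) !)) (nCk≡n!/k![n-k]! (ℕ.<⇒≤ k<p))) (m/n*n≡m (k![n∸k]!∣n! (ℕ.<⇒≤ k<p)))
  p∣p! : ∀ {q} → 1 ≤ q → q ∣ q !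
  p∣p! {suc q} _ = m∣m*n (q !)
... | inj₁ p∣C = p∣C
... | inj₂ p∣! with euclidsLemma (k !) ((p ℕ.∸ k) !) pr p∣!
...   | inj₁ p∣k! = ⊥-elim (prime∤! pr k k<p p∣k!)
...   | inj₂ p∣pk! = ⊥-elim (prime∤! pr (p ℕ.∸ k) (ℕ.∸-monoʳ-< 1≤k (ℕ.<⇒≤ k<p)) p∣pk!)

-- Commutative rings

module CommRing {c ℓ} (A : CommutativeRing c ℓ) where
  open CommutativeRing A public
  open Algebra.Properties.Semiring.Exp semiring public
  open Algebra.Properties.CommutativeSemiring.Exp commutativeSemiring public using (^-distrib-*)
  open Algebra.Properties.Semiring.Mult semiring public
    renaming (_×_ to _·_; ×-congʳ to ·-congʳ; ×-assoc-* to ·-assoc-*; ×1-homo-* to ·1-homo-*; ×-homo-+ to ·-homo-+)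
    using ()
  open Algebra.Properties.Semiring.Sum semiring public using (sum; sum-cong-≋; ∑-distrib-+; ∑-comm; *-distribˡ-sum; *-distribʳ-sum; sum-replicate-zero)
  open Algebra.Properties.Ring ring public using (-‿distribˡ-*; -‿distribʳ-*)
  open Algebra.Properties.AbelianGroup +-abelianGroup public
    using (⁻¹-∙-comm) renaming (ε⁻¹≈ε to -0≈0; ⁻¹-involutive to -‿involutive; x∙y⁻¹≈ε⇒x≈y to x-y≈0⇒x≈y; x≈y⇒x∙y⁻¹≈ε to x≈y⇒x-y≈0)
  module ≈-Reasoning = Relation.Binary.Reasoning.Setoid setoid
  open ≈-Reasoning

  ι : ℕ → Carrier
  ι k = k · 1#

  ι-+ : ∀ m n → ι (m ℕ.+ n) ≈ ι m + ι n
  ι-+ = ·-homo-+ 1#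

  ι-* : ∀ m n → ι (m ℕ.* n) ≈ ι m * ι n
  ι-* = ·1-homo-*

  -- The homomorphism from ℤ serves twice: as coefficient map of the ring solver, and to compare
  -- integer traces and determinants with elements of a field.
  ιℤ : ℤ → Carrier
  ιℤ (ℤ.+ n)      = ι n
  ιℤ (ℤ.-[1+ n ]) = - ι (suc n)

  ιℤ-neg : ∀ i → ιℤ (ℤ.- i) ≈ - ιℤ i
  ιℤ-neg (ℤ.+ zero)    = sym -0≈0
  ιℤ-neg (ℤ.+ suc n)   = refl
  ιℤ-neg (ℤ.-[1+ n ]) = sym (-‿involutive _)

  private
    cancel1 : ∀ a b → (1# + a) + - (1# + b) ≈ a + - b
    cancel1 a b = begin
      (1# + a) + - (1# + b)     ≈⟨ +-cong (+-comm 1# a) (sym (⁻¹-∙-comm 1# b)) ⟩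
      (a + 1#) + (- 1# + - b)   ≈⟨ +-assoc a 1# _ ⟩
      a + (1# + (- 1# + - b))   ≈⟨ +-congˡ (sym (+-assoc 1# (- 1#) (- b))) ⟩
      a + ((1# + - 1#) + - b)   ≈⟨ +-congˡ (+-congʳ (-‿inverseʳ 1#)) ⟩
      a + (0# + - b)            ≈⟨ +-congˡ (+-identityˡ (- b)) ⟩
      a + - b ∎

  ιℤ-⊖ : ∀ m n → ιℤ (m ℤ.⊖ n) ≈ ι m + - ι n
  ιℤ-⊖ m zero = sym (trans (+-congˡ -0≈0) (+-identityʳ _))
  ιℤ-⊖ zero (suc n) = sym (+-identityˡ _)
  ιℤ-⊖ (suc m) (suc n) = begin
    ιℤ (suc m ℤ.⊖ suc n) ≈⟨ reflexive (≡.cong ιℤ (ℤ.[1+m]⊖[1+n]≡m⊖n m n)) ⟩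
    ιℤ (m ℤ.⊖ n)         ≈⟨ ιℤ-⊖ m n ⟩
    ι m + - ι n          ≈⟨ sym (cancel1 _ _) ⟩
    ι (suc m) + - ι (suc n) ∎

  ιℤ-+ : ∀ i j → ιℤ (i ℤ.+ j) ≈ ιℤ i + ιℤ j
  ιℤ-+ (ℤ.+ m)      (ℤ.+ n)      = ι-+ m n
  ιℤ-+ (ℤ.+ m)      (ℤ.-[1+ n ]) = ιℤ-⊖ m (suc n)
  ιℤ-+ (ℤ.-[1+ m ]) (ℤ.+ n)      = trans (ιℤ-⊖ n (suc m)) (+-comm _ _)
  ιℤ-+ (ℤ.-[1+ m ]) (ℤ.-[1+ n ]) = trans (-‿cong (trans (reflexive (≡.cong ι (≡.cong suc (≡.sym (ℕ.+-suc m n))))) (ι-+ (suc m) (suc n)))) (sym (⁻¹-∙-comm _ _))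

  ιℤ-* : ∀ i j → ιℤ (i ℤ.* j) ≈ ιℤ i * ιℤ j
  ιℤ-* (ℤ.+ m) (ℤ.+ n) = trans (reflexive (≡.cong ιℤ (≡.sym (ℤ.pos-* m n)))) (ι-* m n)
  ιℤ-* (ℤ.+ m) (ℤ.-[1+ n ]) = begin
    ιℤ (ℤ.+ m ℤ.* ℤ.- (ℤ.+ suc n)) ≈⟨ reflexive (≡.cong ιℤ (≡.sym (ℤ.neg-distribʳ-* (ℤ.+ m) (ℤ.+ suc n)))) ⟩
    ιℤ (ℤ.- (ℤ.+ m ℤ.* ℤ.+ suc n)) ≈⟨ ιℤ-neg (ℤ.+ m ℤ.* ℤ.+ suc n) ⟩
    - ιℤ (ℤ.+ m ℤ.* ℤ.+ suc n) ≈⟨ -‿cong (ιℤ-* (ℤ.+ m) (ℤ.+ suc n)) ⟩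
    - (ι m * ι (suc n)) ≈⟨ -‿distribʳ-* _ _ ⟩
    ι m * - ι (suc n) ∎
  ιℤ-* (ℤ.-[1+ m ]) (ℤ.+ n) = begin
    ιℤ (ℤ.- (ℤ.+ suc m) ℤ.* ℤ.+ n) ≈⟨ reflexive (≡.cong ιℤ (≡.sym (ℤ.neg-distribˡ-* (ℤ.+ suc m) (ℤ.+ n)))) ⟩
    ιℤ (ℤ.- (ℤ.+ suc m ℤ.* ℤ.+ n)) ≈⟨ ιℤ-neg (ℤ.+ suc m ℤ.* ℤ.+ n) ⟩
    - ιℤ (ℤ.+ suc m ℤ.* ℤ.+ n) ≈⟨ -‿cong (ιℤ-* (ℤ.+ suc m) (ℤ.+ n)) ⟩
    - (ι (suc m) * ι n) ≈⟨ -‿distribˡ-* _ _ ⟩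
    - ι (suc m) * ι n ∎
  ιℤ-* (ℤ.-[1+ m ]) (ℤ.-[1+ n ]) = begin
    ι (suc m ℕ.* suc n) ≈⟨ ι-* (suc m) (suc n) ⟩
    ι (suc m) * ι (suc n) ≈⟨ sym (-‿involutive _) ⟩
    - - (ι (suc m) * ι (suc n)) ≈⟨ -‿cong (-‿distribˡ-* _ _) ⟩
    - (- ι (suc m) * ι (suc n)) ≈⟨ -‿distribʳ-* _ _ ⟩
    - ι (suc m) * - ι (suc n) ∎

  private
    acr : ACR.AlmostCommutativeRing c ℓ
    acr = ACR.fromCommutativeRing A

    ℤ⟶A : ℤ.+-*-rawRing ACR.-Raw-AlmostCommutative⟶ acr
    ℤ⟶A = record { ⟦_⟧ = ιℤ ; +-homo = ιℤ-+ ; *-homo = ιℤ-* ; -‿homo = ιℤ-neg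
                 ; 0-homo = refl ; 1-homo = +-identityʳ 1# }

    ≟coeff : ∀ i j → Maybe (ιℤ i ≈ ιℤ j)
    ≟coeff i j with i ℤ.≟ j
    ... | yes i≡j = just (reflexive (≡.cong ιℤ i≡j))
    ... | no  _   = nothing

  -- Here `con ℤ.1ℤ` denotes `1# + 0#`, not `1#`; for this reason many calls pass `1#` as a further
  -- variable and simplify it by hand.
  module Solver = RingSolver ℤ.+-*-rawRing acr ℤ⟶A ≟coeff
  open Solver public using (solve; _:+_; _:*_; _:-_; :-_; _:=_; con)

  private
    lin-spec : Σ (∀ m → (Fin m → Carrier) → (Fin m → ℕ) → Carrier) λ F →
                ∀ m → GeneratedByAsModule A m ≡
                  (Σ (Fin m → Carrier) λ g → ∀ a → Σ (Fin m → ℕ) λ coef → a ≈ F m g coef)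
    -- Unification with the unfolded `GeneratedByAsModule` solves `_` and so recovers the private
    -- summation.
    lin-spec = _ , λ m → ≡.refl

  -- The ∑ᵢ cᵢ·gᵢ of GeneratedByAsModule, whose summation is private to Defs.
  lin : ∀ {m} → (Fin m → Carrier) → (Fin m → ℕ) → Carrier
  lin = proj₁ lin-spec _

  lin≈sum : ∀ {m} (g : Fin m → Carrier) d → lin g d ≈ sum (λ i → ι (d i) * g i)
  lin≈sum {zero}  g d = refl
  lin≈sum {suc m} g d = +-cong (sym (trans (·-assoc-* (d fzero) 1# (g fzero)) (·-congʳ (d fzero) (*-identityˡ _)))) (lin≈sum (λ i → g (fsuc i)) (λ i → d (fsuc i)))

-- Quotient rings

record IsIdeal {c ℓ} (A : CommutativeRing c ℓ) (I : CommutativeRing.Carrier A → Set ℓ) : Set (c ⊔ ℓ) where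
  open CommutativeRing A
  field
    resp : ∀ {x y} → x ≈ y → I x → I y
    0∈   : I 0#
    +∈   : ∀ {x y} → I x → I y → I (x + y)
    *∈   : ∀ x {y} → I y → I (x * y)

module Quotient {c ℓ} (A : CommutativeRing c ℓ) {I : CommutativeRing.Carrier A → Set ℓ} (isIdeal : IsIdeal A I) where
  open CommRing A
  open IsIdeal isIdeal

  infix 4 _~_
  _~_ : Carrier → Carrier → Set ℓ
  x ~ y = I (x - y)

  ≈⇒~ : ∀ {x y} → x ≈ y → x ~ y
  ≈⇒~ x≈y = resp (sym (x≈y⇒x-y≈0 x≈y)) 0∈

  A/I : CommutativeRing c ℓ
  A/I = record
    { Carrier = Carrier ; _≈_ = _~_ ; _+_ = _+_ ; _*_ = _*_ ; -_ = -_ ; 0# = 0# ; 1# = 1#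
    ; isCommutativeRing = record
      { isRing = record
        { +-isAbelianGroup = record
          { isGroup = record
            { isMonoid = record
              { isSemigroup = record
                { isMagma = record
                  { isEquivalence = record
                    { refl  = ≈⇒~ refl
                    ; sym   = λ {x} {y} x~y → resp (solve 2 (λ x y → con (ℤ.- ℤ.1ℤ) :* (x :- y) := y :- x) refl x y) (*∈ _ x~y)
                    ; trans = λ {x} {y} {z} x~y y~z → resp (solve 3 (λ x y z → (x :- y) :+ (y :- z) := x :- z) refl x y z) (+∈ x~y y~z) }
                  ; ∙-cong = λ {x} {y} {u} {v} x~y u~v → resp (solve 4 (λ x y u v → (x :- y) :+ (u :- v) := (x :+ u) :- (y :+ v)) refl x y u v) (+∈ x~y u~v) }
                ; assoc = λ x y z → ≈⇒~ (+-assoc x y z) }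
              ; identity = (λ x → ≈⇒~ (+-identityˡ x)) , (λ x → ≈⇒~ (+-identityʳ x)) }
            ; inverse = (λ x → ≈⇒~ (-‿inverseˡ x)) , (λ x → ≈⇒~ (-‿inverseʳ x))
            ; ⁻¹-cong = λ {x} {y} x~y → resp (solve 2 (λ x y → con (ℤ.- ℤ.1ℤ) :* (x :- y) := (:- x) :- (:- y)) refl x y) (*∈ _ x~y) }
          ; comm = λ x y → ≈⇒~ (+-comm x y) }
        ; *-cong = λ {x} {y} {u} {v} x~y u~v → resp (solve 4 (λ x y u v → u :* (x :- y) :+ y :* (u :- v) := x :* u :- y :* v) refl x y u v) (+∈ (*∈ u x~y) (*∈ y u~v))
        ; *-assoc = λ x y z → ≈⇒~ (*-assoc x y z)
        ; *-identity = (λ x → ≈⇒~ (*-identityˡ x)) , (λ x → ≈⇒~ (*-identityʳ x))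
        ; distrib = (λ x y z → ≈⇒~ (distribˡ x y z)) , (λ x y z → ≈⇒~ (distribʳ x y z)) }
      ; *-comm = λ x y → ≈⇒~ (*-comm x y) } }


  private module Q = CommRing A/I

  -- Powers in `A/I` run the same recursion on the same carrier, so they agree up to `≡`, and
  -- statements pass between the two rings by `≡.subst`.
  ^≡ : ∀ x n → x Q.^ n ≡ x ^ n
  ^≡ x zero    = ≡.refl
  ^≡ x (suc n) = ≡.cong (x *_) (^≡ x n)

  ·≡ : ∀ n x → n Q.· x ≡ n · x
  ·≡ zero    x = ≡.refl
  ·≡ (suc n) x = ≡.cong (x +_) (·≡ n x)

  lin≡ : ∀ {m} (g : Fin m → Carrier) d → Q.lin g d ≡ lin g d
  lin≡ {zero}  g d = ≡.refl
  lin≡ {suc m} g d = ≡.cong₂ _+_ (·≡ (d fzero) (g fzero)) (lin≡ (λ i → g (fsuc i)) (λ i → d (fsuc i)))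

  ι≈⇒Qι≈ : ∀ {n x} → ι n ≈ x → Q.ι n Q.≈ x
  ι≈⇒Qι≈ {n} e = ≡.subst (_~ _) (≡.sym (·≡ n 1#)) (≈⇒~ e)

  ∈⇒~0 : ∀ {x} → I x → x ~ 0#
  ∈⇒~0 {x} = resp (sym (solve 1 (λ x → x :- con (ℤ.0ℤ) := x) refl x))


  ~0⇒∈ : ∀ {x} → x ~ 0# → I x
  ~0⇒∈ {x} = resp (solve 1 (λ x → x :- con (ℤ.0ℤ) := x) refl x)


  generated : ∀ {m} → GeneratedByAsModule A m → GeneratedByAsModule A/I m
  generated (g , G) = g , λ a → proj₁ (G a) , ≡.subst (a ~_) (≡.sym (lin≡ g (proj₁ (G a)))) (≈⇒~ (proj₂ (G a)))

-- Characteristic p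

module CharP {c ℓ} (A : CommutativeRing c ℓ) {p : ℕ} (pr : Prime p)
  (p≈0 : CommutativeRing._≈_ A (CommRing.ι A p) (CommutativeRing.0# A)) where
  open CommRing A
  open ≈-Reasoning

  private instance p≢0 : NonZero p
  p≢0 = prime⇒nonZero pr

  ι-∣ : ∀ {k} → p ∣ k → ι k ≈ 0#
  ι-∣ (divides q ≡.refl) = trans (ι-* q p) (trans (*-congˡ p≈0) (zeroʳ _))

  ι-% : ∀ k → ι k ≈ ι (k % p)
  ι-% k = begin
    ι k                             ≈⟨ reflexive (≡.cong ι (m≡m%n+[m/n]*n k p)) ⟩
    ι (k % p ℕ.+ (k ℕ./ p) ℕ.* p)   ≈⟨ ι-+ (k % p) _ ⟩
    ι (k % p) + ι ((k ℕ./ p) ℕ.* p) ≈⟨ +-congˡ (ι-∣ (divides (k ℕ./ p) ≡.refl)) ⟩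
    ι (k % p) + 0#                  ≈⟨ +-identityʳ _ ⟩
    ι (k % p) ∎

  -- Module coefficients are natural numbers, so `ℕ.pred p` stands in for -1 wherever a coefficient
  -- is to be subtracted.
  ι-pred : ι (ℕ.pred p) ≈ - 1#
  ι-pred = x-y≈0⇒x≈y _ _ (begin
    ι (ℕ.pred p) - - 1#  ≈⟨ +-congˡ (-‿cong (-‿cong (+-identityʳ 1#))) ⟨
    ι (ℕ.pred p) - - ι 1  ≈⟨ solve 1 (λ x → x :- :- con ℤ.1ℤ := con ℤ.1ℤ :+ x) refl (ι (ℕ.pred p)) ⟩
    ιℤ ℤ.1ℤ + ι (ℕ.pred p) ≈⟨ +-congʳ (+-identityʳ 1#) ⟩
    ι (suc (ℕ.pred p))   ≈⟨ reflexive (≡.cong ι (ℕ.suc-pred p)) ⟩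
    ι p                  ≈⟨ p≈0 ⟩
    0# ∎)

  ι-inverse : ∀ {k} → ¬ p ∣ k → ∃[ u ] ι u * ι k ≈ 1#
  ι-inverse {k} p∤k with coprime-Bézout (prime⇒coprime-∤ pr p∤k)
  ... | Bézout.+- x y 1+yk≡xp = ℕ.pred p ℕ.* y , (begin
      ι (ℕ.pred p ℕ.* y) * ι k     ≈⟨ *-congʳ (ι-* (ℕ.pred p) y) ⟩
      ι (ℕ.pred p) * ι y * ι k     ≈⟨ *-congʳ (*-congʳ ι-pred) ⟩
      - 1# * ι y * ι k             ≈⟨ solve 3 (λ o a b → (:- o) :* a :* b := o :* o :- o :* (o :+ a :* b) ) refl 1# (ι y) (ι k) ⟩
      1# * 1# - 1# * (1# + ι y * ι k) ≈⟨ +-cong (*-identityˡ _) (-‿cong (trans (*-identityˡ _) (+-congˡ (sym (ι-* y k))))) ⟩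
      1# - ι (1 ℕ.+ y ℕ.* k)       ≈⟨ +-congˡ (-‿cong (reflexive (≡.cong ι 1+yk≡xp))) ⟩
      1# - ι (x ℕ.* p)             ≈⟨ +-congˡ (-‿cong (ι-∣ (divides x ≡.refl))) ⟩
      1# - 0#                      ≈⟨ trans (+-congˡ -0≈0) (+-identityʳ _) ⟩
      1# ∎)
  ... | Bézout.-+ x y 1+xp≡yk = y , (begin
      ι y * ι k          ≈⟨ ι-* y k ⟨
      ι (y ℕ.* k)        ≈⟨ reflexive (≡.cong ι 1+xp≡yk) ⟨
      1# + ι (x ℕ.* p)   ≈⟨ +-congˡ (ι-∣ (divides x ≡.refl)) ⟩
      1# + 0#            ≈⟨ +-identityʳ _ ⟩
      1# ∎)

  frobenius-+ : ∀ x y → (x + y) ^ p ≈ x ^ p + y ^ p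
  frobenius-+ x y = go p ≡.refl
    where
    module B = Binomial commutativeSemiring
    -- Matching on a copy of p exposes a successor, so that the first and last binomial terms can be
    -- split off.
    go : ∀ p′ → p ≡ p′ → (x + y) ^ p′ ≈ x ^ p′ + y ^ p′
    go zero    e = ≡.subst (λ k → (x + y) ^ k ≈ x ^ k + y ^ k) e (⊥-elim (¬prime[0] (≡.subst Prime e pr)))
    go (suc q) e = begin
      (x + y) ^ suc q ≈⟨ B.theorem (suc q) x y ⟩
      t fzero + sum (t ∘ fsuc) ≈⟨ +-cong first (trans (MSum.sum-init-last +-monoid (t ∘ fsuc)) (+-cong middle final)) ⟩
      y ^ suc q + (0# + x ^ suc q) ≈⟨ +-congˡ (+-identityˡ _) ⟩
      y ^ suc q + x ^ suc q ≈⟨ +-comm _ _ ⟩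
      x ^ suc q + y ^ suc q ∎
      where
      t : Fin (suc (suc q)) → Carrier
      t = B.binomialTerm x y (suc q)
      first : t fzero ≈ y ^ suc q
      first = trans (+-identityʳ _) (*-identityˡ _)
      zero-term : ∀ n a → p ∣ n → n · a ≈ 0#
      zero-term n a p∣n = begin
        n · a          ≈⟨ ·-congʳ n (*-identityˡ a) ⟨
        n · (1# * a)   ≈⟨ ·-assoc-* n 1# a ⟨
        ι n * a        ≈⟨ *-congʳ (ι-∣ p∣n) ⟩
        0# * a         ≈⟨ zeroˡ a ⟩
        0# ∎
      middle : sum (λ (j : Fin q) → t (fsuc (inject₁ j))) ≈ 0#
      middle = trans (sum-cong-≋ {q} λ j → zero-term _ _
          (≡.subst (_∣ suc q C suc (toℕ (inject₁ j))) (≡.sym e)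
            (prime∣C (≡.subst Prime e pr) (suc (toℕ (inject₁ j))) (ℕ.s≤s ℕ.z≤n)
              (ℕ.s≤s (≡.subst (ℕ._< q) (≡.sym (toℕ-inject₁ j)) (toℕ<n j))))))
        (sum-replicate-zero q)
      final : t (fsuc (fromℕ q)) ≈ x ^ suc q
      final rewrite toℕ-fromℕ q | nCn≡1 (suc q) | ℕ.n∸n≡0 q = trans (+-identityʳ _) (*-identityʳ _)

  ^p^suc : ∀ x j → (x ^ (p ℕ.^ j)) ^ p ≈ x ^ (p ℕ.^ suc j)
  ^p^suc x j = trans (^-assocʳ x (p ℕ.^ j) p) (^-congʳ x (ℕ.*-comm (p ℕ.^ j) p))

  frobenius^-+ : ∀ j x y → (x + y) ^ (p ℕ.^ j) ≈ x ^ (p ℕ.^ j) + y ^ (p ℕ.^ j)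
  frobenius^-+ zero x y = distribʳ 1# x y
  frobenius^-+ (suc j) x y = begin
    (x + y) ^ (p ℕ.^ suc j)                     ≈⟨ ^p^suc (x + y) j ⟨
    ((x + y) ^ (p ℕ.^ j)) ^ p                   ≈⟨ ^-congˡ p (frobenius^-+ j x y) ⟩
    (x ^ (p ℕ.^ j) + y ^ (p ℕ.^ j)) ^ p         ≈⟨ frobenius-+ _ _ ⟩
    (x ^ (p ℕ.^ j)) ^ p + (y ^ (p ℕ.^ j)) ^ p   ≈⟨ +-cong (^p^suc x j) (^p^suc y j) ⟩
    x ^ (p ℕ.^ suc j) + y ^ (p ℕ.^ suc j) ∎

  lin-∣ : ∀ {m} (g : Fin m → Carrier) d → (∀ i → p ∣ d i) → lin g d ≈ 0#
  lin-∣ {m} g d p∣d = begin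
    lin g d                     ≈⟨ lin≈sum g d ⟩
    sum (λ i → ι (d i) * g i)   ≈⟨ sum-cong-≋ {m} (λ i → trans (*-congʳ (ι-∣ (p∣d i))) (zeroˡ _)) ⟩
    sum {m} (λ _ → 0#)          ≈⟨ sum-replicate-zero m ⟩
    0# ∎

  all∣⊎some∤ : ∀ {m} (d : Fin m → ℕ) → (∀ i → p ∣ d i) ⊎ (∃[ i ] ¬ p ∣ d i)
  all∣⊎some∤ d with any? (λ i → ¬? (p ∣? d i))
  ... | yes w = inj₂ w
  ... | no ¬w = inj₁ λ i → decidable-stable (p ∣? d i) λ p∤di → ¬w (i , p∤di)

  -- Every element is lin g of a residue vector, and residue vectors are numbered by Fin (p ^ m).
  module Enum {m} (gen : GeneratedByAsModule A m) where
    private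
      g = proj₁ gen

    digits : Fin (p ℕ.^ m) → Fin m → ℕ
    digits c i = toℕ (finToFun c i)

    elt : Fin (p ℕ.^ m) → Carrier
    elt c = lin g (digits c)

    encode : (Fin m → ℕ) → Fin (p ℕ.^ m)
    encode d = funToFin (λ i → fromℕ< (m%n<n (d i) p))

    digits-encode : ∀ d i → digits (encode d) i ≡ d i % p
    digits-encode d i = ≡.trans (≡.cong toℕ (finToFun-funToFin _ i)) (toℕ-fromℕ< _)

    elt-encode : ∀ d → elt (encode d) ≈ lin g d
    elt-encode d = begin
      elt (encode d) ≈⟨ lin≈sum g (digits (encode d)) ⟩
      sum (λ i → ι (digits (encode d) i) * g i) ≈⟨ sum-cong-≋ {m} (λ i → *-congʳ (trans (reflexive (≡.cong ι (digits-encode d i))) (sym (ι-% (d i))))) ⟩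
      sum (λ i → ι (d i) * g i) ≈⟨ lin≈sum g d ⟨
      lin g d ∎

    idx : Carrier → Fin (p ℕ.^ m)
    idx a = encode (proj₁ (proj₂ gen a))

    elt-idx : ∀ a → elt (idx a) ≈ a
    elt-idx a = trans (elt-encode _) (sym (proj₂ (proj₂ gen a)))

  -- A relation ∑ dⱼ gⱼ ∈ I with dᵢ invertible makes the generator gᵢ redundant modulo I.
  drop-generator : ∀ {I : Carrier → Set ℓ} (isIdeal : IsIdeal A I) {m} (gen : GeneratedByAsModule A (suc m)) →
         ∀ d i → ¬ p ∣ d i → I (lin (proj₁ gen) d) → GeneratedByAsModule (Quotient.A/I A isIdeal) m
  drop-generator isIdeal {m} (g , gen) d i p∤di lin∈I = g′ , λ a → c′ a , ≡.subst (a ~_) (≡.sym (lin≡ g′ (c′ a))) (IsIdeal.resp isIdeal (sym (eq a)) (IsIdeal.*∈ isIdeal _ lin∈I))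
    where
    open Quotient A isIdeal
    g′ : Fin m → Carrier
    g′ = g ∘ punchIn i
    u : ℕ
    u = proj₁ (ι-inverse p∤di)
    c₀ : Carrier → Fin (suc m) → ℕ
    c₀ a = proj₁ (gen a)
    c′ : Carrier → Fin m → ℕ
    -- Subtracting `c₀ a i · u` times the relation clears the coefficient at `i`, because `u`
    -- inverts `d i`.
    c′ a j = c₀ a (punchIn i j) ℕ.+ (ℕ.pred p ℕ.* (c₀ a i ℕ.* u)) ℕ.* d (punchIn i j)
    S T : Carrier → Carrier
    S a = sum (λ j → ι (c₀ a (punchIn i j)) * g′ j)
    T _ = sum (λ j → ι (d (punchIn i j)) * g′ j)
    lin-remove : ∀ e → lin g e ≈ ι (e i) * g i + sum (λ j → ι (e (punchIn i j)) * g′ j)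
    lin-remove e = trans (lin≈sum g e) (CSum.sum-remove +-commutativeMonoid {i = i} (λ j → ι (e j) * g j))
    lin-c′ : ∀ a → lin g′ (c′ a) ≈ S a + - (ι (c₀ a i) * ι u) * T a
    lin-c′ a = begin
      lin g′ (c′ a) ≈⟨ lin≈sum g′ (c′ a) ⟩
      sum (λ j → ι (c′ a j) * g′ j) ≈⟨ sum-cong-≋ {m} (λ j → trans (*-congʳ (trans (ι-+ (c₀ a (punchIn i j)) ((ℕ.pred p ℕ.* (c₀ a i ℕ.* u)) ℕ.* d (punchIn i j))) (+-congˡ (trans (ι-* (ℕ.pred p ℕ.* (c₀ a i ℕ.* u)) (d (punchIn i j))) (*-congʳ (trans (ι-* (ℕ.pred p) (c₀ a i ℕ.* u)) (*-cong ι-pred (ι-* (c₀ a i) u)))))))) (trans (distribʳ _ _ _) (+-congˡ (trans (*-assoc _ _ _) (*-congʳ (trans (sym (-‿distribˡ-* _ _)) (-‿cong (*-identityˡ _)))))))) ⟩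
      sum (λ j → ι (c₀ a (punchIn i j)) * g′ j + - (ι (c₀ a i) * ι u) * (ι (d (punchIn i j)) * g′ j)) ≈⟨ ∑-distrib-+ {m} (λ j → ι (c₀ a (punchIn i j)) * g′ j) (λ j → - (ι (c₀ a i) * ι u) * (ι (d (punchIn i j)) * g′ j)) ⟩
      S a + sum (λ j → - (ι (c₀ a i) * ι u) * (ι (d (punchIn i j)) * g′ j)) ≈⟨ +-congˡ (*-distribˡ-sum {m} _ _) ⟨
      S a + - (ι (c₀ a i) * ι u) * T a ∎
    eq : ∀ a → a - lin g′ (c′ a) ≈ (ι (c₀ a i) * ι u) * lin g d
    eq a = begin
      a - lin g′ (c′ a) ≈⟨ +-cong (trans (proj₂ (gen a)) (lin-remove (c₀ a))) (-‿cong (lin-c′ a)) ⟩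
      (ι (c₀ a i) * g i + S a) - (S a + - (ι (c₀ a i) * ι u) * T a) ≈⟨ +-congʳ (+-congʳ (trans (*-congʳ (trans (sym (*-identityʳ _)) (*-congˡ (sym (proj₂ (ι-inverse p∤di)))))) refl)) ⟩
      (ι (c₀ a i) * (ι u * ι (d i)) * g i + S a) - (S a + - (ι (c₀ a i) * ι u) * T a) ≈⟨ solve 6 (λ c u d g s t → (c :* (u :* d) :* g :+ s) :- (s :+ (:- (c :* u)) :* t) := (c :* u) :* (d :* g :+ t)) refl (ι (c₀ a i)) (ι u) (ι (d i)) (g i) (S a) (T a) ⟩
      (ι (c₀ a i) * ι u) * (ι (d i) * g i + T a) ≈⟨ *-congˡ (lin-remove d) ⟨
      (ι (c₀ a i) * ι u) * lin g d ∎

-- Nilpotent elements and residue fields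

∣∧<⇒≡0 : ∀ {p k} → k ℕ.< p → p ∣ k → k ≡ 0
∣∧<⇒≡0 {k = zero}  _   _   = ≡.refl
∣∧<⇒≡0 {k = suc k} k<p p∣k = ⊥-elim (<⇒∤ (s≤s z≤n) k<p p∣k)

-- Modulo p the sum is `a - b`, written without subtraction; the difference of two residues is
-- smaller than p in absolute value.
difference-∣ : ∀ {p a b} → a ℕ.< p → b ℕ.< p → p ∣ a ℕ.+ ℕ.pred p ℕ.* b → a ≡ b
difference-∣ {suc q} {a} {b} a<p b<p p∣ with ℕ.≤-total a b
... | inj₁ a≤b = ≡.sym (ℕ.≤-antisym (ℕ.m∸n≡0⇒m≤n (∣∧<⇒≡0 (ℕ.≤-<-trans (ℕ.m∸n≤m b a) b<p) p∣b∸a)) a≤b)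
  where
  p∣b∸a : suc q ∣ b ℕ.∸ a
  p∣b∸a = ∣m+n∣m⇒∣n (≡.subst (suc q ∣_) eq (m∣m*n b)) p∣
    where
    eq : b ℕ.+ q ℕ.* b ≡ (a ℕ.+ q ℕ.* b) ℕ.+ (b ℕ.∸ a)
    eq = ≡.trans (≡.cong (ℕ._+ q ℕ.* b) (≡.sym (ℕ.m+[n∸m]≡n a≤b)))
      (≡.trans (ℕ.+-assoc a _ _) (≡.trans (≡.cong (a ℕ.+_) (ℕ.+-comm (b ℕ.∸ a) _)) (≡.sym (ℕ.+-assoc a _ _))))
... | inj₂ b≤a = ℕ.≤-antisym (ℕ.m∸n≡0⇒m≤n (∣∧<⇒≡0 (ℕ.≤-<-trans (ℕ.m∸n≤m a b) a<p) p∣a∸b)) b≤a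
  where
  p∣a∸b : suc q ∣ a ℕ.∸ b
  p∣a∸b = ∣m+n∣m⇒∣n (≡.subst (suc q ∣_) eq p∣) (m∣m*n b)
    where
    eq : a ℕ.+ q ℕ.* b ≡ suc q ℕ.* b ℕ.+ (a ℕ.∸ b)
    eq = ≡.trans (≡.cong (ℕ._+ q ℕ.* b) (≡.sym (ℕ.m+[n∸m]≡n b≤a)))
      (≡.trans (ℕ.+-assoc b _ _) (≡.trans (≡.cong (b ℕ.+_) (ℕ.+-comm (a ℕ.∸ b) _)) (≡.sym (ℕ.+-assoc b _ _))))

module RingLemmas {c ℓ} (A : CommutativeRing c ℓ) where
  open CommRing A
  open ≈-Reasoning

  Nil Unit : Carrier → Set _
  Nil x  = ∃[ k ] x ^ k ≈ 0#
  Unit x = ∃[ y ] x * y ≈ 1#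

  trivial : 1# ≈ 0# → ∀ x y → x ≈ y
  trivial 1≈0 x y = begin
    x      ≈⟨ *-identityˡ x ⟨
    1# * x ≈⟨ *-congʳ 1≈0 ⟩
    0# * x ≈⟨ zeroˡ x ⟩
    0#     ≈⟨ zeroˡ y ⟨
    0# * y ≈⟨ *-congʳ 1≈0 ⟨
    1# * y ≈⟨ *-identityˡ y ⟩
    y      ∎

  0^ : ∀ {k} → 1 ℕ.≤ k → 0# ^ k ≈ 0#
  0^ {suc k} _ = zeroˡ _

  1^ : ∀ k → 1# ^ k ≈ 1#
  1^ zero    = refl
  1^ (suc k) = trans (*-identityˡ _) (1^ k)

  unit∧≈0⇒1≈0 : ∀ {x} → Unit x → x ≈ 0# → 1# ≈ 0#
  unit∧≈0⇒1≈0 (y , xy≈1) x≈0 = trans (sym xy≈1) (trans (*-congʳ x≈0) (zeroˡ y))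

  unit-* : ∀ {x y} → Unit x → Unit y → Unit (x * y)
  unit-* {x} {y} (x′ , xx′) (y′ , yy′) = x′ * y′ , (begin
    (x * y) * (x′ * y′) ≈⟨ solve 4 (λ x y x′ y′ → (x :* y) :* (x′ :* y′) := (x :* x′) :* (y :* y′)) refl x y x′ y′ ⟩
    (x * x′) * (y * y′) ≈⟨ *-cong xx′ yy′ ⟩
    1# * 1#             ≈⟨ *-identityˡ 1# ⟩
    1# ∎)

  unit-cancel : ∀ {x y} → Unit x → y * x ≈ x → y ≈ 1#
  unit-cancel {x} {y} (x′ , xx′) yx≈x = begin
    y            ≈⟨ *-identityʳ y ⟨
    y * 1#       ≈⟨ *-congˡ xx′ ⟨
    y * (x * x′) ≈⟨ *-assoc y x x′ ⟨
    (y * x) * x′ ≈⟨ *-congʳ yx≈x ⟩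
    x * x′       ≈⟨ xx′ ⟩
    1# ∎

  nil-≤ : ∀ {x j k} → j ℕ.≤ k → x ^ j ≈ 0# → x ^ k ≈ 0#
  nil-≤ {x} {j} {k} j≤k x^j≈0 = begin
    x ^ k                     ≈⟨ ^-congʳ x (ℕ.m+[n∸m]≡n j≤k) ⟨
    x ^ (j ℕ.+ (k ℕ.∸ j))     ≈⟨ ^-homo-* x j (k ℕ.∸ j) ⟩
    x ^ j * x ^ (k ℕ.∸ j)     ≈⟨ *-congʳ x^j≈0 ⟩
    0# * x ^ (k ℕ.∸ j)        ≈⟨ zeroˡ _ ⟩
    0# ∎

  nil-* : ∀ y {x} → Nil x → Nil (y * x)
  nil-* y {x} (k , x^k≈0) = k , trans (^-distrib-* y x k) (trans (*-congˡ x^k≈0) (zeroʳ _))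

  nil-≈ : ∀ {x y} → x ≈ y → Nil x → Nil y
  nil-≈ x≈y (k , e) = k , trans (^-congˡ k (sym x≈y)) e

  nil-^ : ∀ {x} k → Nil (x ^ k) → Nil x
  nil-^ {x} k (j , e) = k ℕ.* j , trans (sym (^-assocʳ x k j)) e

  nil-power-diff : ∀ {x q} → 1 ℕ.≤ q → Nil x → Nil (x ^ q - x)
  nil-power-diff {x} {suc q} _ nx = nil-≈ (trans (solve 3 (λ x y o → (y :- o) :* x := x :* y :- o :* x) refl x (x ^ q) 1#) (+-congˡ (-‿cong (*-identityˡ x))))
    (nil-* (x ^ q - 1#) nx)

  nil-1 : Nil 1# → 1# ≈ 0#
  nil-1 (k , e) = trans (sym (1^ k)) e

  -- A one-element Nakayama lemma: iterating the equation gives `x ≈ w ^ k * x` for every k.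
  absorb-nil : ∀ {x w} → Nil w → x ≈ w * x → x ≈ 0#
  absorb-nil {x} {w} (k , w^k≈0) x≈wx = trans (iterate k) (trans (*-congʳ w^k≈0) (zeroˡ x))
    where
    iterate : ∀ k → x ≈ w ^ k * x
    iterate zero    = sym (*-identityˡ x)
    iterate (suc k) = begin
      x               ≈⟨ x≈wx ⟩
      w * x           ≈⟨ *-congˡ (iterate k) ⟩
      w * (w ^ k * x) ≈⟨ *-assoc w (w ^ k) x ⟨
      w ^ suc k * x ∎

  ^-periodic : ∀ {v N} → v ^ suc N ≈ v → ∀ a t → 1 ℕ.≤ a → v ^ (a ℕ.+ t ℕ.* N) ≈ v ^ a
  ^-periodic {v} {N} e a zero    1≤a = ^-congʳ v (ℕ.+-identityʳ a)
  ^-periodic {v} {N} e (suc a) (suc t) _ = begin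
    v ^ (suc a ℕ.+ (N ℕ.+ t ℕ.* N))  ≈⟨ ^-congʳ v (≡.cong suc (≡.trans (≡.sym (ℕ.+-assoc a N _)) (≡.trans (≡.cong (ℕ._+ t ℕ.* N) (ℕ.+-comm a N)) (ℕ.+-assoc N a _)))) ⟩
    v ^ (suc N ℕ.+ (a ℕ.+ t ℕ.* N))  ≈⟨ ^-homo-* v (suc N) (a ℕ.+ t ℕ.* N) ⟩
    v ^ suc N * v ^ (a ℕ.+ t ℕ.* N)  ≈⟨ *-congʳ e ⟩
    v ^ (suc a ℕ.+ t ℕ.* N)          ≈⟨ ^-periodic e (suc a) t (s≤s z≤n) ⟩
    v ^ suc a ∎

  ^-cong-mod : ∀ {v N} → v ^ suc N ≈ v → ∀ a b → 1 ℕ.≤ a → 1 ℕ.≤ b →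
               (ℤ.+ N) ℤD.∣ (ℤ.+ a ℤ.- ℤ.+ b) → v ^ a ≈ v ^ b
  ^-cong-mod {v} {N} e a b 1≤a 1≤b N∣ with ℕ.≤-total a b
  ... | inj₁ a≤b with ≡.subst (N ∣_) (≡.trans (≡.cong ℤ.∣_∣ (ℤ.[+m]-[+n]≡m⊖n a b)) (ℤ.∣⊖∣-≤ a≤b)) N∣
  ...   | divides t b∸a≡tN = sym (trans (^-congʳ v (≡.trans (≡.sym (ℕ.m+[n∸m]≡n a≤b)) (≡.cong (a ℕ.+_) b∸a≡tN))) (^-periodic e a t 1≤a))
  ^-cong-mod {v} {N} e a b 1≤a 1≤b N∣ | inj₂ b≤a with ≡.subst (N ∣_) (≡.trans (≡.cong ℤ.∣_∣ (≡.trans (ℤ.[+m]-[+n]≡m⊖n a b) (ℤ.⊖-≥ b≤a))) ≡.refl) N∣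
  ...   | divides t a∸b≡tN = trans (^-congʳ v (≡.trans (≡.sym (ℕ.m+[n∸m]≡n b≤a)) (≡.cong (b ℕ.+_) a∸b≡tN))) (^-periodic e b t 1≤b)

  -- Multiples of z; the cofactor is given by its coefficients so that the predicate stays in level ℓ.
  module Principal {m} (gen : GeneratedByAsModule A m) (z : Carrier) where
    ⟨z⟩ : Carrier → Set ℓ
    ⟨z⟩ x = Σ (Fin m → ℕ) λ d → x ≈ lin (proj₁ gen) d * z

    ∈-intro : ∀ {x} y → x ≈ y * z → ⟨z⟩ x
    ∈-intro y x≈yz = proj₁ (proj₂ gen y) , trans x≈yz (*-congʳ (proj₂ (proj₂ gen y)))

    isIdeal : IsIdeal A ⟨z⟩
    isIdeal = record
      { resp = λ x≈y (d , e) → d , trans (sym x≈y) e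
      ; 0∈ = ∈-intro 0# (sym (zeroˡ z))
      ; +∈ = λ { (_ , e) (_ , e′) → ∈-intro _ (trans (+-cong e e′) (sym (distribʳ z _ _))) }
      ; *∈ = λ { x (_ , e) → ∈-intro _ (trans (*-congˡ e) (sym (*-assoc x _ z))) } }

    z∈ : ⟨z⟩ z
    z∈ = ∈-intro 1# (sym (*-identityˡ z))

    ∈⇒nil : Nil z → ∀ {x} → ⟨z⟩ x → Nil x
    ∈⇒nil nz (_ , e) = nil-≈ (sym e) (nil-* _ nz)

module _ {p : ℕ} (pr : Prime p) where

  -- Descent on the exponent. Suppose `ν ^ suc k ≈ 0#` with k > m. If `ν ^ k` has zero coefficients,
  -- the exponent drops to k. Otherwise dividing out `ν ^ k` removes a generator, and induction
  -- gives `ν ^ m ≈ y * ν ^ k`; as k > m, this makes `ν ^ m` a nilpotent multiple of itself, hence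
  -- 0.
  nilpotent-bound : ∀ {c ℓ} m (A : CommutativeRing c ℓ) → let open CommRing A in ι p ≈ 0# →
                    GeneratedByAsModule A m → ∀ ν k → ν ^ k ≈ 0# → ν ^ m ≈ 0#
  nilpotent-bound zero A p≈0 gen ν k e = proj₂ (proj₂ gen _)
  nilpotent-bound {c} {ℓ} (suc m) A p≈0 gen ν = down
    where
    open CommRing A
    open RingLemmas A
    open CharP A pr p≈0
    open ≈-Reasoning
    down : ∀ k → ν ^ k ≈ 0# → ν ^ suc m ≈ 0#
    down zero e = nil-≤ {ν} {0} {suc m} z≤n e
    down (suc k) e with suc k ℕ.≤? suc m
    ... | yes k≤m = nil-≤ {ν} {suc k} {suc m} k≤m e
    ... | no  k≰m with all∣⊎some∤ (proj₁ (proj₂ gen (ν ^ k)))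
    ...   | inj₁ all∣ = down k (trans (proj₂ (proj₂ gen (ν ^ k))) (lin-∣ (proj₁ gen) (proj₁ (proj₂ gen (ν ^ k))) all∣))
    ...   | inj₂ (i , p∤) = nil-≤ {ν} {m} {suc m} (ℕ.n≤1+n m) (absorb-nil (nil-* (y * ν ^ t) (suc k , e)) ν^m≈)
      where
      open Principal gen (ν ^ k)
      open Quotient A isIdeal
      module Q = CommRing A/I
      IH : ν Q.^ m ~ 0#
      IH = nilpotent-bound m A/I (ι≈⇒Qι≈ {p} p≈0)
        (drop-generator isIdeal gen (proj₁ (proj₂ gen (ν ^ k))) i p∤ (IsIdeal.resp isIdeal (proj₂ (proj₂ gen (ν ^ k))) z∈))
        ν k (≡.subst (_~ 0#) (≡.sym (Quotient.^≡ A isIdeal ν k)) (∈⇒~0 z∈))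
      ∈ : ⟨z⟩ (ν ^ m)
      ∈ = ~0⇒∈ (≡.subst (_~ 0#) (^≡ ν m) IH)
      y = lin (proj₁ gen) (proj₁ ∈)
      t = k ℕ.∸ suc m
      ν^m≈ : ν ^ m ≈ ((y * ν ^ t) * ν) * ν ^ m
      ν^m≈ = begin
        ν ^ m                     ≈⟨ proj₂ ∈ ⟩
        y * ν ^ k                 ≈⟨ *-congˡ (^-congʳ ν (≡.trans (≡.sym (ℕ.m+[n∸m]≡n (ℕ.≤-pred (ℕ.≰⇒> k≰m)))) (ℕ.+-comm (suc m) t))) ⟩
        y * ν ^ (t ℕ.+ suc m)     ≈⟨ *-congˡ (^-homo-* ν t (suc m)) ⟩
        y * (ν ^ t * (ν * ν ^ m)) ≈⟨ solve 4 (λ y a b c → y :* (a :* (b :* c)) := ((y :* a) :* b) :* c) refl y (ν ^ t) ν (ν ^ m) ⟩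
        ((y * ν ^ t) * ν) * ν ^ m ∎

-- Units raised to the cardinality of the ring

funToFin-cong : ∀ {m n} {f g : Fin m → Fin n} → (∀ i → f i ≡ g i) → funToFin f ≡ funToFin g
funToFin-cong {zero}  f≗g = ≡.refl
funToFin-cong {suc m} f≗g = ≡.cong₂ combine (f≗g fzero) (funToFin-cong (f≗g ∘ fsuc))

module Product {c ℓ} (A : CommutativeRing c ℓ) where
  open CommRing A
  open RingLemmas A
  open ≈-Reasoning
  open CSum *-commutativeMonoid using () renaming (sum to ∏; sum-cong-≋ to ∏-cong; ∑-distrib-+ to ∏-distrib-*; sum-permute to ∏-permute; sum-remove to ∏-remove; sum-replicate to ∏-replicate) public

  ∏-unit : ∀ {n} (f : Fin n → Carrier) → (∀ i → Unit (f i)) → Unit (∏ f)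
  ∏-unit {zero}  f u = 1# , *-identityˡ 1#
  ∏-unit {suc n} f u = unit-* (u fzero) (∏-unit (f ∘ fsuc) (u ∘ fsuc))

  -- The extra factor `a` makes up for the index with value 1, so the exponent is n and no
  -- predecessor appears.
  ∏-almost-constant : ∀ {n} (h : Fin n → Carrier) i a → h i ≈ 1# → (∀ j → j ≢ i → h j ≈ a) → a * ∏ h ≈ a ^ n
  ∏-almost-constant {suc n} h i a hi≈1 hj≈a = *-congˡ (begin
    ∏ h                              ≈⟨ ∏-remove {i = i} h ⟩
    h i * ∏ (λ j → h (punchIn i j))  ≈⟨ *-cong hi≈1 (∏-cong {n} (λ j → hj≈a _ (punchInᵢ≢i i j))) ⟩
    1# * ∏ (λ (j : Fin n) → a)       ≈⟨ *-identityˡ _ ⟩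
    ∏ (λ (j : Fin n) → a)            ≈⟨ ∏-replicate n ⟩
    a ^ n ∎)

module _ {c ℓ} (A : CommutativeRing c ℓ) {p : ℕ} (pr : Prime p)
  (p≈0 : CommutativeRing._≈_ A (CommRing.ι A p) (CommutativeRing.0# A))
  {m} (gen : GeneratedByAsModule A m) where
  open CommRing A
  open RingLemmas A
  open CharP A pr p≈0
  open Enum gen
  open Product A
  open ≈-Reasoning

  private
    instance p≢0 : NonZero p
    p≢0 = prime⇒nonZero pr

    M = p ℕ.^ m

    digits-injective : ∀ c c′ → (∀ i → digits c i ≡ digits c′ i) → c ≡ c′
    digits-injective c c′ e = ≡.trans (≡.sym (funToFin-finToFin {m} {p} c))
      (≡.trans (funToFin-cong (λ i → toℕ-injective (e i))) (funToFin-finToFin {m} {p} c′))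

  module _ (units : ∀ c i → ¬ p ∣ digits c i → Unit (elt c)) where

    private
      -- This lets `elt` be treated as injective without deciding equality in A: the difference of
      -- two distinct digit vectors has a coefficient prime to p, so `units` makes its value a unit,
      -- and a collision makes that value 0.
      collision⇒1≈0 : ∀ c c′ → c ≢ c′ → elt c ≈ elt c′ → 1# ≈ 0#
      collision⇒1≈0 c c′ c≢c′ e with all∣⊎some∤ (λ i → digits c i ℕ.+ ℕ.pred p ℕ.* digits c′ i)
      ... | inj₁ all∣ = ⊥-elim (c≢c′ (digits-injective c c′ λ i → difference-∣ (toℕ<n (finToFun c i)) (toℕ<n (finToFun c′ i)) (all∣ i)))
      ... | inj₂ (i , p∤) = unit∧≈0⇒1≈0 (units (encode d) i (λ p∣ → p∤ (∣-%⁻ (≡.subst (p ∣_) (digits-encode d i) p∣)))) (begin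
        elt (encode d) ≈⟨ elt-encode d ⟩
        lin g d ≈⟨ lin≈sum g d ⟩
        sum (λ i → ι (d i) * g i) ≈⟨ sum-cong-≋ {m} (λ i → trans (*-congʳ (trans (ι-+ (digits c i) _) (+-congˡ (trans (ι-* (ℕ.pred p) (digits c′ i)) (*-congʳ ι-pred))))) (distribʳ _ _ _)) ⟩
        sum (λ i → ι (digits c i) * g i + (- 1# * ι (digits c′ i)) * g i) ≈⟨ ∑-distrib-+ {m} (λ i → ι (digits c i) * g i) (λ i → (- 1# * ι (digits c′ i)) * g i) ⟩
        sum (λ i → ι (digits c i) * g i) + sum (λ i → (- 1# * ι (digits c′ i)) * g i) ≈⟨ +-cong (sym (lin≈sum g (digits c))) (trans (sum-cong-≋ {m} (λ i → *-assoc _ _ _)) (trans (sym (*-distribˡ-sum {m} (- 1#) (λ i → ι (digits c′ i) * g i))) (*-congˡ (sym (lin≈sum g (digits c′)))))) ⟩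
        elt c + - 1# * elt c′ ≈⟨ +-congˡ (trans (sym (-‿distribˡ-* _ _)) (-‿cong (*-identityˡ _))) ⟩
        elt c - elt c′ ≈⟨ x≈y⇒x-y≈0 e ⟩
        0# ∎)
        where
        g = proj₁ gen
        d : Fin m → ℕ
        d i = digits c i ℕ.+ ℕ.pred p ℕ.* digits c′ i
        ∣-%⁻ : ∀ {k} → p ∣ k % p → p ∣ k
        ∣-%⁻ {k} = ∣n∣m%n⇒∣m ∣-refl

      c₀ : Fin M
      c₀ = encode (λ _ → 0)

      elt-c₀ : elt c₀ ≈ 0#
      elt-c₀ = trans (elt-encode _) (lin-∣ (proj₁ gen) (λ _ → 0) (λ _ → p ∣0))

      nonzero : ∀ c → c ≢ c₀ → Unit (elt c)
      nonzero c c≢c₀ with all∣⊎some∤ (digits c)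
      ... | inj₂ (i , p∤) = units c i p∤
      ... | inj₁ all∣ = ⊥-elim (c≢c₀ (digits-injective c c₀ λ i →
          ≡.trans (≡.trans (≡.sym (m<n⇒m%n≡m (toℕ<n (finToFun c i)))) (n∣m⇒m%n≡0 (digits c i) p (all∣ i)))
                  (≡.sym (≡.trans (digits-encode (λ _ → 0) i) (n∣m⇒m%n≡0 0 p (p ∣0))))))

      -- A permutation of indices needs inverses up to `≡`, whereas only `≈` of elements is known.
      -- Any index where they differ is a collision, and then the ring is trivial.
      inverse-up-to-collision : ∀ a b → a * b ≈ 1# → (∀ c → idx (b * elt (idx (a * elt c))) ≡ c) ⊎ 1# ≈ 0#
      inverse-up-to-collision a b ab≈1 with all? (λ c → idx (b * elt (idx (a * elt c))) ≟F c)
      ... | yes inv = inj₁ inv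
      ... | no ¬inv = inj₂ (collision⇒1≈0 _ j (proj₂ w) (begin
          elt (idx (b * elt (idx (a * elt j)))) ≈⟨ elt-idx _ ⟩
          b * elt (idx (a * elt j))             ≈⟨ *-congˡ (elt-idx _) ⟩
          b * (a * elt j)                       ≈⟨ *-assoc b a _ ⟨
          (b * a) * elt j                       ≈⟨ *-congʳ (trans (*-comm b a) ab≈1) ⟩
          1# * elt j                            ≈⟨ *-identityˡ _ ⟩
          elt j ∎))
        where
        w = ¬∀⟶∃¬ M _ (λ i → idx (b * elt (idx (a * elt i))) ≟F i) ¬inv
        j = proj₁ w

    -- Multiplication by a permutes the nonzero elements; compare their products.
    unit-^card : ∀ a → Unit a → a ^ M ≈ a
    unit-^card a (b , ab≈1) with inverse-up-to-collision a b ab≈1 | inverse-up-to-collision b a (trans (*-comm b a) ab≈1)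
    ... | inj₂ 1≈0 | _        = trivial 1≈0 _ _
    ... | inj₁ _   | inj₂ 1≈0 = trivial 1≈0 _ _
    ... | inj₁ inv | inj₁ inv′ = begin
        a ^ M        ≈⟨ ∏-almost-constant h c₀ a h-c₀ h-other ⟨
        a * ∏ h      ≈⟨ *-congˡ (unit-cancel (∏-unit f f-unit) ∏hf≈∏f) ⟩
        a * 1#       ≈⟨ *-identityʳ a ⟩
        a ∎
      where
      π : Permutation M M
      π = permutation (λ c → idx (a * elt c)) (λ c → idx (b * elt c)) inv′ inv
      -- `f` puts 1 in place of the element 0, so that its product is a unit; `h` is the factor by
      -- which composing with `π` changes `f`.
      f h : Fin M → Carrier
      f c with c ≟F c₀
      ... | yes _ = 1#
      ... | no  _ = elt c
      h c with c ≟F c₀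
      ... | yes _ = 1#
      ... | no  _ = a
      h-c₀ : h c₀ ≈ 1#
      h-c₀ with c₀ ≟F c₀
      ... | yes _ = refl
      ... | no ≢  = ⊥-elim (≢ ≡.refl)
      h-other : ∀ c → c ≢ c₀ → h c ≈ a
      h-other c ≢ with c ≟F c₀
      ... | yes ≡ = ⊥-elim (≢ ≡)
      ... | no _  = refl
      f-unit : ∀ c → Unit (f c)
      f-unit c with c ≟F c₀
      ... | yes _ = 1# , *-identityˡ 1#
      ... | no  ≢ = nonzero c ≢
      fπ : ∀ c → f (π ⟨$⟩ʳ c) ≈ h c * f c
      fπ c with c ≟F c₀ | idx (a * elt c) ≟F c₀
      ... | yes _   | yes _   = sym (*-identityˡ 1#)
      -- The two mixed cases would let multiplication by a unit turn 0 into a nonzero index or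
      -- conversely; each makes 0 a unit.
      ... | yes ≡.refl | no πc≢  = trivial (unit∧≈0⇒1≈0 (nonzero _ πc≢) (trans (elt-idx _) (trans (*-congˡ elt-c₀) (zeroʳ a)))) _ _
      ... | no c≢   | yes πc≡ = trivial (unit∧≈0⇒1≈0 (unit-* (b , ab≈1) (nonzero c c≢)) (trans (sym (elt-idx _)) (trans (reflexive (≡.cong elt πc≡)) elt-c₀))) _ _
      ... | no _    | no _    = elt-idx (a * elt c)
      ∏hf≈∏f : ∏ h * ∏ f ≈ ∏ f
      ∏hf≈∏f = begin
        ∏ h * ∏ f             ≈⟨ ∏-distrib-* {M} h f ⟨
        ∏ (λ c → h c * f c)   ≈⟨ ∏-cong {M} fπ ⟨
        ∏ (λ c → f (π ⟨$⟩ʳ c)) ≈⟨ ∏-permute f π ⟨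
        ∏ f ∎

-- Which alternative `loc` returns is decidable even where nilpotency itself is not; a finite search
-- can rely on it.
IsInj₁ : ∀ {a b} {X : Set a} {Y : Set b} → X ⊎ Y → Set
IsInj₁ (inj₁ _) = ⊤
IsInj₁ (inj₂ _) = ⊥

isInj₁? : ∀ {a b} {X : Set a} {Y : Set b} (s : X ⊎ Y) → Dec (IsInj₁ s)
isInj₁? (inj₁ _) = yes tt
isInj₁? (inj₂ _) = no λ ()

fromInj₁ : ∀ {a b} {X : Set a} {Y : Set b} {s : X ⊎ Y} → IsInj₁ s → X
fromInj₁ {s = inj₁ x} _ = x

module _ {p : ℕ} (pr : Prime p) where

  -- A nilpotent element with a nonzero digit is divided out; nilpotency lifts back along this
  -- quotient, which is why the conclusion is stated up to nilpotents. When none is left, every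
  -- nonzero digit vector gives a unit, and the remaining number of generators is the residue
  -- degree.
  residue-degree : ∀ {c ℓ} m (A : CommutativeRing c ℓ) →
    let open CommRing A
        open RingLemmas A in
    ι p ≈ 0# →
    GeneratedByAsModule A m → (∀ x → Nil x ⊎ Unit x) →
    1# ≈ 0# ⊎ (∃[ r ] 1 ℕ.≤ r × r ℕ.≤ m × ∀ x → Nil (x ^ (p ℕ.^ r) - x))
  residue-degree zero A p≈0 gen loc = inj₁ (proj₂ (proj₂ gen _))
  residue-degree (suc m) A p≈0 gen loc = go
    where
    open CommRing A
    open RingLemmas A
    open CharP A pr p≈0
    open Enum gen
    open ≈-Reasoning
    Redundant : Fin (p ℕ.^ suc m) → Set
    Redundant c = (∃[ i ] ¬ p ∣ digits c i) × IsInj₁ (loc (elt c))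
    redundant? : ∀ c → Dec (Redundant c)
    redundant? c = any? (λ i → ¬? (p ∣? digits c i)) ×-dec isInj₁? (loc (elt c))
    go : 1# ≈ 0# ⊎ (∃[ r ] 1 ℕ.≤ r × r ℕ.≤ suc m × ∀ x → Nil (x ^ (p ℕ.^ r) - x))
    go with any? redundant?
    ... | no ¬red = inj₂ (suc m , s≤s z≤n , ℕ.≤-refl , λ x → [ nil-case x , unit-case x ]′ (loc x))
      where
      units : ∀ c i → ¬ p ∣ digits c i → Unit (elt c)
      units c i p∤ with loc (elt c) in eq
      ... | inj₁ _ = ⊥-elim (¬red (c , (i , p∤) , ≡.subst IsInj₁ (≡.sym eq) tt))
      ... | inj₂ u = u
      nil-case : ∀ x → Nil x → Nil (x ^ (p ℕ.^ suc m) - x)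
      nil-case x = nil-power-diff (ℕ.m^n>0 p {{prime⇒nonZero pr}} (suc m))
      unit-case : ∀ x → Unit x → Nil (x ^ (p ℕ.^ suc m) - x)
      unit-case x ux = 1 , trans (*-identityʳ _) (x≈y⇒x-y≈0 (unit-^card A pr p≈0 gen units x ux))
    ... | yes (c , (i , p∤) , is) = result (residue-degree m A/I (ι≈⇒Qι≈ {p} p≈0) (drop-generator isIdeal gen (digits c) i p∤ z∈) loc′)
      where
      open Principal gen (elt c)
      open Quotient A isIdeal
      module Q = CommRing A/I
      module QL = RingLemmas A/I
      nz : Nil (elt c)
      nz = fromInj₁ is
      Nil⇒QNil : ∀ {x} → Nil x → QL.Nil x
      Nil⇒QNil {x} (k , e) = k , ≡.subst (_~ 0#) (≡.sym (^≡ x k)) (≈⇒~ e)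
      QNil⇒Nil : ∀ {x} → QL.Nil x → Nil x
      QNil⇒Nil {x} (k , e) = nil-^ k (∈⇒nil nz (~0⇒∈ (≡.subst (_~ 0#) (^≡ x k) e)))
      loc′ : ∀ x → QL.Nil x ⊎ QL.Unit x
      loc′ x with loc x
      ... | inj₁ n = inj₁ (Nil⇒QNil n)
      ... | inj₂ (y , e) = inj₂ (y , ≈⇒~ e)
      result : (1# ~ 0# ⊎ (∃[ r ] 1 ℕ.≤ r × r ℕ.≤ m × ∀ x → QL.Nil (x Q.^ (p ℕ.^ r) - x))) →
               1# ≈ 0# ⊎ (∃[ r ] 1 ℕ.≤ r × r ℕ.≤ suc m × ∀ x → Nil (x ^ (p ℕ.^ r) - x))
      result (inj₁ 1~0) = inj₁ (nil-1 (∈⇒nil nz (~0⇒∈ 1~0)))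
      result (inj₂ (r , 1≤r , r≤m , h)) = inj₂ (r , 1≤r , ℕ.m≤n⇒m≤1+n r≤m ,
        λ x → QNil⇒Nil (≡.subst (λ y → QL.Nil (y - x)) (^≡ x (p ℕ.^ r)) (h x)))

-- Idempotents and additivity of the n-th power

module Stable {c ℓ} (A : CommutativeRing c ℓ) {p : ℕ} (pr : Prime p)
  (p≈0 : CommutativeRing._≈_ A (CommRing.ι A p) (CommutativeRing.0# A))
  {m} (gen : GeneratedByAsModule A m) where
  open CommRing A
  open RingLemmas A
  open CharP A pr p≈0
  open Enum gen
  open ≈-Reasoning

  idempotent-power : ∀ x → ∃[ k ] 1 ℕ.≤ k × x ^ k * x ^ k ≈ x ^ k
  idempotent-power x with pigeonhole (ℕ.n<1+n (p ℕ.^ m)) (λ i → idx (x ^ toℕ i))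
  -- The powers of `x` have period d = j - i from exponent i on. The exponent `suc i · d` is a
  -- positive multiple of d that is at least i, so doubling it changes nothing.
  ... | i , j , i<j , same = suc (toℕ i) ℕ.* d , ℕ.*-mono-≤ {1} {suc (toℕ i)} {1} {d} (s≤s z≤n) 1≤d , (begin
      x ^ (suc (toℕ i) ℕ.* d) * x ^ (suc (toℕ i) ℕ.* d) ≈⟨ ^-homo-* x (suc (toℕ i) ℕ.* d) (suc (toℕ i) ℕ.* d) ⟨
      x ^ (suc (toℕ i) ℕ.* d ℕ.+ suc (toℕ i) ℕ.* d)     ≈⟨ periodic (suc (toℕ i)) (suc (toℕ i) ℕ.* d) i≤ ⟩
      x ^ (suc (toℕ i) ℕ.* d) ∎)
    where
    d = toℕ j ℕ.∸ toℕ i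
    1≤d : 1 ℕ.≤ d
    1≤d = ℕ.m<n⇒0<n∸m i<j
    i≤ : toℕ i ℕ.≤ suc (toℕ i) ℕ.* d
    i≤ = ℕ.≤-trans (ℕ.n≤1+n _) (ℕ.≤-trans (ℕ.≤-reflexive (≡.sym (ℕ.*-identityʳ _))) (ℕ.*-monoʳ-≤ (suc (toℕ i)) 1≤d))
    x^i≈x^j : x ^ toℕ i ≈ x ^ toℕ j
    x^i≈x^j = trans (sym (elt-idx _)) (trans (reflexive (≡.cong elt same)) (elt-idx _))
    step : ∀ k → toℕ i ℕ.≤ k → x ^ (k ℕ.+ d) ≈ x ^ k
    step k i≤k = begin
      x ^ (k ℕ.+ d)                    ≈⟨ ^-congʳ x (≡.trans (≡.cong (ℕ._+ d) (≡.trans (≡.sym (ℕ.m∸n+n≡m i≤k)) ≡.refl)) (≡.trans (ℕ.+-assoc (k ℕ.∸ toℕ i) (toℕ i) d) (≡.cong ((k ℕ.∸ toℕ i) ℕ.+_) (ℕ.m+[n∸m]≡n (ℕ.<⇒≤ i<j))))) ⟩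
      x ^ ((k ℕ.∸ toℕ i) ℕ.+ toℕ j)    ≈⟨ ^-homo-* x (k ℕ.∸ toℕ i) (toℕ j) ⟩
      x ^ (k ℕ.∸ toℕ i) * x ^ toℕ j    ≈⟨ *-congˡ x^i≈x^j ⟨
      x ^ (k ℕ.∸ toℕ i) * x ^ toℕ i    ≈⟨ ^-homo-* x (k ℕ.∸ toℕ i) (toℕ i) ⟨
      x ^ ((k ℕ.∸ toℕ i) ℕ.+ toℕ i)    ≈⟨ ^-congʳ x (ℕ.m∸n+n≡m i≤k) ⟩
      x ^ k ∎
    periodic : ∀ t k → toℕ i ℕ.≤ k → x ^ (k ℕ.+ t ℕ.* d) ≈ x ^ k
    periodic zero    k i≤k = ^-congʳ x (ℕ.+-identityʳ k)
    periodic (suc t) k i≤k = begin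
      x ^ (k ℕ.+ (d ℕ.+ t ℕ.* d)) ≈⟨ ^-congʳ x (ℕ.+-assoc k d _) ⟨
      x ^ ((k ℕ.+ d) ℕ.+ t ℕ.* d) ≈⟨ periodic t (k ℕ.+ d) (ℕ.m≤n⇒m≤n+o d i≤k) ⟩
      x ^ (k ℕ.+ d)               ≈⟨ step k i≤k ⟩
      x ^ k ∎

module _ {p n : ℕ} (pr : Prime p) (p∣n : p ∣ n) (1≤n : 1 ℕ.≤ n) where

  power-additive : ∀ {c ℓ} m (A : CommutativeRing c ℓ) → let open CommRing A in ι p ≈ 0# → m ℕ.≤ p →
    (∀ r → 1 ℕ.≤ r → r ℕ.≤ m → ∃[ i ] (ℤ.+ (p ℕ.^ r ℕ.∸ 1)) ℤD.∣ (ℤ.+ n ℤ.- ℤ.+ (p ℕ.^ i))) →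
    GeneratedByAsModule A m → ∀ x y → (x + y) ^ n ≈ x ^ n + y ^ n
  power-additive zero A p≈0 m≤p korselt gen x y = RingLemmas.trivial A (proj₂ (proj₂ gen _)) _ _
  power-additive {c} {ℓ} (suc m) A p≈0 m≤p korselt gen x y = go
    where
    open CommRing A
    open RingLemmas A
    open CharP A pr p≈0
    open Enum gen
    open Stable A pr p≈0 gen
    open ≈-Reasoning

    coef : Carrier → Fin (suc m) → ℕ
    coef a = proj₁ (proj₂ gen a)

    -- Indices are used because `coef` need not respect `≈`; the search then covers exactly the
    -- representatives `elt c`.
    e : Fin (p ℕ.^ suc m) → Carrier
    e c = elt c ^ proj₁ (idempotent-power (elt c))

    -- A decidable substitute for `a ≉ 0`: where it fails, `a ≈ 0#`; where it holds, dividing out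
    -- `a` removes a generator, whether or not `a` is zero.
    NonzeroCoef : Carrier → Set
    NonzeroCoef a = ∃[ i ] ¬ p ∣ coef a i

    nonzeroCoef? : ∀ a → Dec (NonzeroCoef a)
    nonzeroCoef? a = any? (λ i → ¬? (p ∣? coef a i))

    zeroCoef : ∀ a → ¬ NonzeroCoef a → a ≈ 0#
    zeroCoef a ¬nz = trans (proj₂ (proj₂ gen a)) (lin-∣ (proj₁ gen) (coef a) (λ i → decidable-stable (p ∣? coef a i) λ p∤ → ¬nz (i , p∤)))

    additive-mod : ∀ a → NonzeroCoef a → ∃[ s ] (x + y) ^ n - (x ^ n + y ^ n) ≈ s * a
    additive-mod a (i , p∤) = _ , proj₂ (≡.subst ⟨z⟩ eq IH)
      where
      open Principal gen a
      open Quotient A isIdeal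
      module Q = CommRing A/I
      IH : ⟨z⟩ ((x + y) Q.^ n - (x Q.^ n + y Q.^ n))
      IH = power-additive m A/I (ι≈⇒Qι≈ {p} p≈0) (ℕ.≤-trans (ℕ.n≤1+n m) m≤p) (λ r 1≤r r≤m → korselt r 1≤r (ℕ.m≤n⇒m≤1+n r≤m))
        (drop-generator isIdeal gen (coef a) i p∤ (IsIdeal.resp isIdeal (proj₂ (proj₂ gen a)) z∈)) x y
      eq : (x + y) Q.^ n - (x Q.^ n + y Q.^ n) ≡ (x + y) ^ n - (x ^ n + y ^ n)
      eq = ≡.cong₂ _-_ (^≡ (x + y) n) (≡.cong₂ _+_ (^≡ x n) (^≡ y n))

    splits? : ∀ c → Dec (NonzeroCoef (e c) × NonzeroCoef (1# - e c))
    splits? c = nonzeroCoef? (e c) ×-dec nonzeroCoef? (1# - e c)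

    local-case : (∀ a → Nil a ⊎ Unit a) → (x + y) ^ n ≈ x ^ n + y ^ n
    local-case loc with residue-degree pr (suc m) A p≈0 gen loc
    ... | inj₁ 1≈0 = trivial 1≈0 _ _
    ... | inj₂ (zero , () , _)
    ... | inj₂ (suc r , _ , r≤m , h) = begin
        (x + y) ^ n                                               ≈⟨ ^n≈^pʲ (x + y) ⟩
        (x + y) ^ (p ℕ.^ (suc r ℕ.+ i))                           ≈⟨ frobenius^-+ (suc r ℕ.+ i) x y ⟩
        x ^ (p ℕ.^ (suc r ℕ.+ i)) + y ^ (p ℕ.^ (suc r ℕ.+ i))     ≈⟨ +-cong (^n≈^pʲ x) (^n≈^pʲ y) ⟨
        x ^ n + y ^ n ∎
      where
      i = proj₁ (korselt (suc r) (s≤s z≤n) r≤m)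
      q = p ℕ.^ suc r
      q≡ : suc (q ℕ.∸ 1) ≡ q
      q≡ = ℕ.m+[n∸m]≡n (ℕ.m^n>0 p {{prime⇒nonZero pr}} (suc r))
      -- x ^ q - x is nilpotent, so its p-th power vanishes because p ≥ suc m.
      ^p-fixed : ∀ x → (x ^ p) ^ q ≈ x ^ p
      ^p-fixed x = begin
        (x ^ p) ^ q               ≈⟨ ^-assocʳ x p q ⟩
        x ^ (p ℕ.* q)             ≈⟨ ^-congʳ x (ℕ.*-comm p q) ⟩
        x ^ (q ℕ.* p)             ≈⟨ ^-assocʳ x q p ⟨
        (x ^ q) ^ p               ≈⟨ ^-congˡ p (solve 2 (λ a b → a := (a :- b) :+ b) refl (x ^ q) x) ⟩
        ((x ^ q - x) + x) ^ p     ≈⟨ frobenius-+ (x ^ q - x) x ⟩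
        (x ^ q - x) ^ p + x ^ p   ≈⟨ +-congʳ (nil-≤ {x ^ q - x} {suc m} {p} m≤p (nilpotent-bound pr (suc m) A p≈0 gen (x ^ q - x) (proj₁ (h x)) (proj₂ (h x)))) ⟩
        0# + x ^ p                ≈⟨ +-identityˡ _ ⟩
        x ^ p ∎
      -- As p ∣ n, `x ^ n` is a power of `x ^ p`, which the q-th power map fixes, so `x` may be
      -- replaced by `x ^ q`. Since `x ^ q` is itself a power of `x ^ p`, its exponents can be
      -- reduced modulo q - 1 and the congruence for n applies; the replacement adds `suc r` to the
      -- exponent of Frobenius.
      ^n≈^pʲ : ∀ x → x ^ n ≈ x ^ (p ℕ.^ (suc r ℕ.+ i))
      ^n≈^pʲ x = begin
        x ^ n                     ≈⟨ ^-congʳ x n≡ ⟩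
        x ^ (p ℕ.* k)             ≈⟨ ^-assocʳ x p k ⟨
        (x ^ p) ^ k               ≈⟨ ^-congˡ k (^p-fixed x) ⟨
        ((x ^ p) ^ q) ^ k         ≈⟨ ^-congˡ k (trans (^-assocʳ x p q) (trans (^-congʳ x (ℕ.*-comm p q)) (sym (^-assocʳ x q p)))) ⟩
        ((x ^ q) ^ p) ^ k         ≈⟨ ^-assocʳ (x ^ q) p k ⟩
        (x ^ q) ^ (p ℕ.* k)       ≈⟨ ^-congʳ (x ^ q) n≡ ⟨
        (x ^ q) ^ n               ≈⟨ ^-cong-mod v-fixed n (p ℕ.^ i) 1≤n (ℕ.m^n>0 p {{prime⇒nonZero pr}} i) (proj₂ (korselt (suc r) (s≤s z≤n) r≤m)) ⟩
        (x ^ q) ^ (p ℕ.^ i)       ≈⟨ ^-assocʳ x q (p ℕ.^ i) ⟩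
        x ^ (q ℕ.* p ℕ.^ i)       ≈⟨ ^-congʳ x (ℕ.^-distribˡ-+-* p (suc r) i) ⟨
        x ^ (p ℕ.^ (suc r ℕ.+ i)) ∎
        where
        k = _∣_.quotient p∣n
        n≡ : n ≡ p ℕ.* k
        n≡ = ≡.trans (_∣_.equality p∣n) (ℕ.*-comm k p)
        v-fixed : (x ^ q) ^ suc (q ℕ.∸ 1) ≈ x ^ q
        v-fixed = begin
          (x ^ q) ^ suc (q ℕ.∸ 1)          ≈⟨ ^-congʳ (x ^ q) q≡ ⟩
          (x ^ q) ^ q                      ≈⟨ ^-congˡ q (^-assocʳ x p (p ℕ.^ r)) ⟨
          ((x ^ p) ^ (p ℕ.^ r)) ^ q        ≈⟨ ^-assocʳ (x ^ p) (p ℕ.^ r) q ⟩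
          (x ^ p) ^ (p ℕ.^ r ℕ.* q)        ≈⟨ ^-congʳ (x ^ p) (ℕ.*-comm (p ℕ.^ r) q) ⟩
          (x ^ p) ^ (q ℕ.* p ℕ.^ r)        ≈⟨ ^-assocʳ (x ^ p) q (p ℕ.^ r) ⟨
          ((x ^ p) ^ q) ^ (p ℕ.^ r)        ≈⟨ ^-congˡ (p ℕ.^ r) (^p-fixed x) ⟩
          (x ^ p) ^ (p ℕ.^ r)              ≈⟨ ^-assocʳ x p (p ℕ.^ r) ⟩
          x ^ q ∎

    go : (x + y) ^ n ≈ x ^ n + y ^ n
    go with any? splits?
    -- By induction the defect `u` lies in both (e) and (1 - e). In `u = e u + (1 - e) u`, inserting
    -- the opposite membership into each term gives multiples of `e (1 - e) = 0`.
    ... | yes (c , e≢0 , 1-e≢0) = x-y≈0⇒x≈y _ _ (begin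
        u                         ≈⟨ solve 2 (λ u e → u := e :* u :+ (u :- e :* u)) refl u (e c) ⟩
        e c * u + (u - e c * u)   ≈⟨ +-cong (*-congˡ (proj₂ t)) (+-cong (proj₂ s) (-‿cong (*-congˡ (proj₂ s)))) ⟩
        e c * (proj₁ t * (1# - e c)) + (proj₁ s * e c - e c * (proj₁ s * e c))
                                  ≈⟨ +-congʳ (solve 3 (λ e o t → e :* (t :* (o :- e)) := t :* (o :* e :- e :* e)) refl (e c) 1# (proj₁ t)) ⟩
        proj₁ t * (1# * e c - e c * e c) + (proj₁ s * e c - e c * (proj₁ s * e c))
                                  ≈⟨ +-cong (*-congˡ (+-cong (*-identityˡ _) (-‿cong ee≈e))) (+-congˡ (-‿cong (trans (solve 2 (λ e s → e :* (s :* e) := s :* (e :* e)) refl (e c) (proj₁ s)) (*-congˡ ee≈e)))) ⟩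
        proj₁ t * (e c - e c) + (proj₁ s * e c - proj₁ s * e c)
                                  ≈⟨ solve 3 (λ e s t → t :* (e :- e) :+ (s :* e :- s :* e) := con ℤ.0ℤ) refl (e c) (proj₁ s) (proj₁ t) ⟩
        0# ∎)
      where
      u = (x + y) ^ n - (x ^ n + y ^ n)
      s = additive-mod (e c) e≢0
      t = additive-mod (1# - e c) 1-e≢0
      ee≈e : e c * e c ≈ e c
      ee≈e = proj₂ (proj₂ (idempotent-power (elt c)))
    ... | no ¬splits = local-case loc
      where
      loc : ∀ a → Nil a ⊎ Unit a
      loc a with nonzeroCoef? (e (idx a)) | nonzeroCoef? (1# - e (idx a))
      ... | yes nz | yes nz′ = ⊥-elim (¬splits (idx a , nz , nz′))
      ... | no ¬nz | _ = inj₁ (nil-≈ (elt-idx a) (proj₁ (idempotent-power (elt (idx a))) , zeroCoef _ ¬nz))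
      ... | yes _  | no ¬nz = inj₂ (unit-≈ (elt-idx a) (pow≈1⇒unit (proj₁ (proj₂ (idempotent-power (elt (idx a))))) (sym (x-y≈0⇒x≈y _ _ (zeroCoef _ ¬nz)))))
        where
        unit-≈ : ∀ {a b} → a ≈ b → Unit a → Unit b
        unit-≈ a≈b (a′ , aa′) = a′ , trans (*-congʳ (sym a≈b)) aa′
        pow≈1⇒unit : ∀ {a k} → 1 ℕ.≤ k → a ^ k ≈ 1# → Unit a
        pow≈1⇒unit {a} {suc k} _ e = a ^ k , e

-- From Korselt’s condition to the Carmichael property

∃prime∣ : ∀ n → 2 ℕ.≤ n → ∃[ p ] Prime p × p ∣ n
∃prime∣ n@(suc _) 2≤n with factorise n
... | record { factors = [] ; isFactorisation = n≡1 } = ⊥-elim (ℕ.<⇒≢ 2≤n (≡.sym n≡1))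
... | record { factors = p ∷ ps ; isFactorisation = n≡ ; factorsPrime = pr ∷ _ } = p , pr , ≡.subst (p ∣_) (≡.sym n≡) (m∣m*n (product ps))

composite>1 : ∀ {n} → Composite n → 2 ℕ.≤ n
composite>1 {zero}        c = ⊥-elim (¬composite[0] c)
composite>1 {suc zero}    c = ⊥-elim (¬composite[1] c)
composite>1 {suc (suc _)} _ = s≤s (s≤s z≤n)

composite-cofactor : ∀ {n p} → Composite n → Prime p → (p∣n : p ∣ n) → 2 ℕ.≤ _∣_.quotient p∣n
composite-cofactor comp pr (divides zero ≡.refl)       = ⊥-elim (¬composite[0] comp)
composite-cofactor {n} {p} comp pr (divides (suc zero) e) = ⊥-elim (composite⇒¬prime comp (≡.subst Prime (≡.sym (≡.trans e (ℕ.*-identityˡ p))) pr))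
composite-cofactor comp pr (divides (suc (suc _)) _) = s≤s (s≤s z≤n)

∣-difference : ∀ {d} a b → d ∣ ℤ.∣ ℤ.+ a ℤ.- ℤ.+ b ∣ → d ∣ a → d ∣ b
∣-difference {d} a b d∣ d∣a with ℕ.≤-total a b
... | inj₁ a≤b = ≡.subst (d ∣_) (ℕ.m+[n∸m]≡n a≤b) (∣m∣n⇒∣m+n d∣a (≡.subst (d ∣_) (≡.trans (≡.cong ℤ.∣_∣ (ℤ.[+m]-[+n]≡m⊖n a b)) (ℤ.∣⊖∣-≤ a≤b)) d∣))
... | inj₂ b≤a = ∣m+n∣m⇒∣n (≡.subst (d ∣_) (≡.sym (ℕ.m∸n+n≡m b≤a)) d∣a) (≡.subst (d ∣_) (≡.cong ℤ.∣_∣ (≡.trans (ℤ.[+m]-[+n]≡m⊖n a b) (ℤ.⊖-≥ b≤a))) d∣)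

-- Among the p + 1 powers `q ^ 0`, ..., `q ^ p` two agree modulo p. Their difference is
-- `q ^ i · (q ^ r - 1)`, and p does not divide the first factor.
order-bound : ∀ {p q} → Prime p → ¬ p ∣ q → ∃[ r ] 1 ℕ.≤ r × r ℕ.≤ p × p ∣ q ℕ.^ r ℕ.∸ 1
order-bound {p} {q} pr p∤q with pigeonhole (ℕ.n<1+n p) (λ i → fromℕ< (m%n<n (q ℕ.^ toℕ i) p {{prime⇒nonZero pr}}))
... | i , j , i<j , same = r , ℕ.m<n⇒0<n∸m i<j , ℕ.≤-trans (ℕ.m∸n≤m (toℕ j) (toℕ i)) (ℕ.≤-pred (toℕ<n j)) , p∣q^r-1
  where
  instance
    p≢0 : NonZero p
    p≢0 = prime⇒nonZero pr
    q≢0 : NonZero q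
    q≢0 = ℕ.≢-nonZero λ { ≡.refl → p∤q (p ∣0) }
  r = toℕ j ℕ.∸ toℕ i
  %≡ : q ℕ.^ toℕ i % p ≡ q ℕ.^ toℕ j % p
  %≡ = ≡.trans (≡.sym (toℕ-fromℕ< _)) (≡.trans (≡.cong toℕ same) (toℕ-fromℕ< _))
  q^j≡ : q ℕ.^ toℕ j ≡ q ℕ.^ toℕ i ℕ.+ q ℕ.^ toℕ i ℕ.* (q ℕ.^ r ℕ.∸ 1)
  q^j≡ = ≡.trans (≡.cong (q ℕ.^_) (≡.sym (ℕ.m+[n∸m]≡n (ℕ.<⇒≤ i<j)))) (≡.trans (ℕ.^-distribˡ-+-* q (toℕ i) r)
    (≡.trans (≡.cong (q ℕ.^ toℕ i ℕ.*_) (≡.sym (ℕ.m+[n∸m]≡n (ℕ.m^n>0 q r)))) (ℕ.*-suc (q ℕ.^ toℕ i) (q ℕ.^ r ℕ.∸ 1))))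
  same-residue : ∀ {a b} → a % p ≡ (a ℕ.+ b) % p → p ∣ b
  same-residue {a} {b} e = ∣m+n∣m⇒∣n (divides ((a ℕ.+ b) / p) (ℕ.+-cancelˡ-≡ (a % p) _ _ (≡.trans (≡.sym (ℕ.+-assoc (a % p) _ b))
    (≡.trans (≡.cong (ℕ._+ b) (≡.sym (m≡m%n+[m/n]*n a p))) (≡.trans (m≡m%n+[m/n]*n (a ℕ.+ b) p) (≡.cong (ℕ._+ ((a ℕ.+ b) / p) ℕ.* p) (≡.sym e))))))) (n∣m*n (a / p))
  p∣q^r-1 : p ∣ q ℕ.^ r ℕ.∸ 1
  p∣q^r-1 with euclidsLemma (q ℕ.^ toℕ i) (q ℕ.^ r ℕ.∸ 1) pr (same-residue (≡.trans %≡ (≡.cong (_% p) q^j≡)))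
  ... | inj₁ p∣q^i = ⊥-elim (p∤q (prime∣^ pr q (toℕ i) p∣q^i))
  ... | inj₂ p∣    = p∣

-- For another prime q of n, p divides no q ^ r - 1 with r ≤ m: otherwise n ≡ qⁱ (mod p) for some i.
korselt⇒m≤p : ∀ {m n p} → Composite n → KorseltCondition m n → Prime p → p ∣ n → m ℕ.≤ p
korselt⇒m≤p {m} {n} {p} comp (sqfree , korselt) pr p∣n with m ℕ.≤? p
... | yes m≤p = m≤p
... | no  m≰p = ⊥-elim (p∤q (prime∣^ pr q i (∣-difference n (q ℕ.^ i) (∣-trans p∣q^r-1 (proj₂ exponent)) p∣n)))
  where
  k = _∣_.quotient p∣n
  other = ∃prime∣ k (composite-cofactor comp pr p∣n)
  q = proj₁ other
  qr = proj₁ (proj₂ other)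
  q∣k = proj₂ (proj₂ other)
  n≡ : n ≡ k ℕ.* p
  n≡ = _∣_.equality p∣n
  q∣n : q ∣ n
  q∣n = ≡.subst (q ∣_) (≡.sym n≡) (∣-trans q∣k (m∣m*n p))
  p∤q : ¬ p ∣ q
  p∤q p∣q = sqfree p pr (≡.subst (p ℕ.* p ∣_) (≡.sym n≡) (*-pres-∣ (∣-trans p∣q q∣k) ∣-refl))
  ob = order-bound pr p∤q
  r = proj₁ ob
  1≤r = proj₁ (proj₂ ob)
  r≤p = proj₁ (proj₂ (proj₂ ob))
  p∣q^r-1 = proj₂ (proj₂ (proj₂ ob))
  exponent = korselt q qr q∣n r 1≤r (ℕ.≤-trans r≤p (ℕ.<⇒≤ (ℕ.≰⇒> m≰p)))
  i = proj₁ exponent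

module _ {c ℓ} (A : CommutativeRing c ℓ) where
  open CommRing A
  open ≈-Reasoning

  -- The inclusion of (a) ∩ (b) in (ab): multiply u by the Bézout expression for 1 and, in each
  -- term, use the membership of u in the other ideal.
  coprime-multiples : ∀ {a b u} → Bézout.Identity 1 a b → (∃[ s ] u ≈ ι a * s) → (∃[ t ] u ≈ ι b * t) → ∃[ w ] u ≈ ι (a ℕ.* b) * w
  coprime-multiples {a} {b} {u} (Bézout.+- x y 1+yb≡xa) (s , u≈as) (t , u≈bt) = ι x * t - ι y * s , (begin
    u                                                     ≈⟨ solve 3 (λ u x y → u := (u :+ y :* u) :- y :* u) refl u (ι x) (ι (y ℕ.* b)) ⟩
    (u + ι (y ℕ.* b) * u) - ι (y ℕ.* b) * u               ≈⟨ +-congʳ (trans (+-congʳ (sym (*-identityˡ u))) (sym (distribʳ u 1# _))) ⟩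
    ι (1 ℕ.+ y ℕ.* b) * u - ι (y ℕ.* b) * u               ≈⟨ +-cong (*-cong (trans (reflexive (≡.cong ι 1+yb≡xa)) (ι-* x a)) u≈bt) (-‿cong (*-cong (ι-* y b) u≈as)) ⟩
    (ι x * ι a) * (ι b * t) - (ι y * ι b) * (ι a * s)     ≈⟨ solve 6 (λ x y a b s t → (x :* a) :* (b :* t) :- (y :* b) :* (a :* s) := (a :* b) :* (x :* t :- y :* s)) refl (ι x) (ι y) (ι a) (ι b) s t ⟩
    (ι a * ι b) * (ι x * t - ι y * s)                     ≈⟨ *-congʳ (ι-* a b) ⟨
    ι (a ℕ.* b) * (ι x * t - ι y * s) ∎)
  coprime-multiples {a} {b} {u} (Bézout.-+ x y 1+xa≡yb) (s , u≈as) (t , u≈bt) = ι y * s - ι x * t , (begin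
    u                                                     ≈⟨ solve 2 (λ u x → u := (u :+ x :* u) :- x :* u) refl u (ι (x ℕ.* a)) ⟩
    (u + ι (x ℕ.* a) * u) - ι (x ℕ.* a) * u               ≈⟨ +-congʳ (trans (+-congʳ (sym (*-identityˡ u))) (sym (distribʳ u 1# _))) ⟩
    ι (1 ℕ.+ x ℕ.* a) * u - ι (x ℕ.* a) * u               ≈⟨ +-cong (*-cong (trans (reflexive (≡.cong ι 1+xa≡yb)) (ι-* y b)) u≈as) (-‿cong (*-cong (ι-* x a) u≈bt)) ⟩
    (ι y * ι b) * (ι a * s) - (ι x * ι a) * (ι b * t)     ≈⟨ solve 6 (λ x y a b s t → (y :* b) :* (a :* s) :- (x :* a) :* (b :* t) := (a :* b) :* (y :* s :- x :* t)) refl (ι x) (ι y) (ι a) (ι b) s t ⟩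
    (ι a * ι b) * (ι y * s - ι x * t)                     ≈⟨ *-congʳ (ι-* a b) ⟨
    ι (a ℕ.* b) * (ι y * s - ι x * t) ∎)

  squarefree-multiple : ∀ {n u} → SquareFree n → (∀ p → Prime p → p ∣ n → ∃[ s ] u ≈ ι p * s) →
                        ∀ ps → All Prime ps → product ps ∣ n → ∃[ w ] u ≈ ι (product ps) * w
  squarefree-multiple {n} {u} sqfree div [] [] _ = u , sym (trans (*-congʳ (+-identityʳ 1#)) (*-identityˡ u))
  squarefree-multiple sqfree div (p ∷ ps) (pr ∷ prs) pps∣n =
    coprime-multiples (coprime-Bézout (prime⇒coprime-∤ pr λ p∣ps → sqfree p pr (∣-trans (*-pres-∣ (∣-refl {p}) p∣ps) pps∣n)))
      (div p pr (∣-trans (m∣m*n (product ps)) pps∣n))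
      (squarefree-multiple sqfree div ps prs (∣-trans (n∣m*n p) pps∣n))

  squarefree-vanish : ∀ {n u} → 1 ℕ.≤ n → ι n ≈ 0# → SquareFree n → (∀ p → Prime p → p ∣ n → ∃[ s ] u ≈ ι p * s) → u ≈ 0#
  squarefree-vanish {n@(suc _)} {u} _ n≈0 sqfree div with factorise n
  ... | record { factors = ps ; isFactorisation = n≡ ; factorsPrime = prs } =
    trans (proj₂ w) (trans (*-congʳ (trans (reflexive (≡.cong ι (≡.sym n≡))) n≈0)) (zeroˡ _))
    where w = squarefree-multiple sqfree div ps prs (divides 1 (≡.trans n≡ (≡.sym (ℕ.*-identityˡ _))))

korselt⇒carmichael : ∀ c ℓ m n → Composite n → KorseltCondition m n → IsCarmichaelOfOrder c ℓ m n
korselt⇒carmichael c ℓ m n comp (sqfree , korselt) = comp , λ A n≈0 gen →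
  let open CommRing A in
  (λ x y → x-y≈0⇒x≈y _ _ (squarefree-vanish A 1≤n n≈0 sqfree (multiple A gen x y))) ,
  (λ x y → ^-distrib-* x y n) , RingLemmas.1^ A n
  where
  1≤n = ℕ.<⇒≤ (composite>1 comp)
  multiple : (A : CommutativeRing c ℓ) → let open CommRing A in GeneratedByAsModule A m → ∀ x y →
    ∀ p → Prime p → p ∣ n → ∃[ s ] (x + y) ^ n - (x ^ n + y ^ n) ≈ ι p * s
  multiple A gen x y p pr p∣n = _ , trans (proj₂ ∈) (*-comm _ _)
    where
    open CommRing A
    open RingLemmas.Principal A gen (ι p)
    open Quotient A isIdeal
    module Q = CommRing A/I
    ∈ : ⟨z⟩ ((x + y) ^ n - (x ^ n + y ^ n))
    ∈ = ≡.subst ⟨z⟩ (≡.cong₂ _-_ (^≡ (x + y) n) (≡.cong₂ _+_ (^≡ x n) (^≡ y n)))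
      (power-additive pr p∣n 1≤n m A/I (≡.subst (_~ 0#) (≡.sym (·≡ p 1#)) (∈⇒~0 z∈)) (korselt⇒m≤p comp (sqfree , korselt) pr p∣n)
        (korselt p pr p∣n) (generated gen) x y)

-- Group rings of cyclic groups

infixl 6 _⊕_
infixl 7 _⊗_
-- Syntactic integer polynomials in one variable. The level `c` puts the carrier into the universe
-- over which the étale condition quantifies.
data Expr (c : Level) : Set c where
  𝟘 𝟙 X : Expr c
  _⊕_ _⊗_ : Expr c → Expr c → Expr c
  ⊖_ : Expr c → Expr c

act : ∀ {c} → Expr c → (ℕ → ℤ) → ℕ → ℤ
act 𝟘       f i = ℤ.0ℤ
act 𝟙       f i = f i
act X       f i = f (suc i)
act (s ⊕ t) f i = act s f i ℤ.+ act t f i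
act (s ⊗ t) f i = act s (act t f) i
act (⊖ s)   f i = ℤ.- act s f i

module _ {c : Level} where

  act-cong : ∀ (s : Expr c) {f g} → (∀ i → f i ≡ g i) → ∀ i → act s f i ≡ act s g i
  act-cong 𝟘       f≗g i = ≡.refl
  act-cong 𝟙       f≗g i = f≗g i
  act-cong X       f≗g i = f≗g (suc i)
  act-cong (s ⊕ t) f≗g i = ≡.cong₂ ℤ._+_ (act-cong s f≗g i) (act-cong t f≗g i)
  act-cong (s ⊗ t) f≗g i = act-cong s (act-cong t f≗g) i
  act-cong (⊖ s)   f≗g i = ≡.cong ℤ.-_ (act-cong s f≗g i)

  act-0 : ∀ (s : Expr c) i → act s (λ _ → ℤ.0ℤ) i ≡ ℤ.0ℤ
  act-0 𝟘       i = ≡.refl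
  act-0 𝟙       i = ≡.refl
  act-0 X       i = ≡.refl
  act-0 (s ⊕ t) i = ≡.cong₂ ℤ._+_ (act-0 s i) (act-0 t i)
  act-0 (s ⊗ t) i = ≡.trans (act-cong s (act-0 t) i) (act-0 s i)
  act-0 (⊖ s)   i = ≡.cong ℤ.-_ (act-0 s i)

  act-+ : ∀ (s : Expr c) f g i → act s (λ j → f j ℤ.+ g j) i ≡ act s f i ℤ.+ act s g i
  act-+ 𝟘       f g i = ≡.refl
  act-+ 𝟙       f g i = ≡.refl
  act-+ X       f g i = ≡.refl
  act-+ (s ⊕ t) f g i = ≡.trans (≡.cong₂ ℤ._+_ (act-+ s f g i) (act-+ t f g i)) (+-interchange (act s f i) (act s g i) (act t f i) (act t g i))
    where open Algebra.Properties.CommutativeSemigroup ℤ.+-commutativeSemigroup using () renaming (interchange to +-interchange)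
  act-+ (s ⊗ t) f g i = ≡.trans (act-cong s (act-+ t f g) i) (act-+ s (act t f) (act t g) i)
  act-+ (⊖ s)   f g i = ≡.trans (≡.cong ℤ.-_ (act-+ s f g i)) (ℤ.neg-distrib-+ (act s f i) (act s g i))

  act-neg : ∀ (s : Expr c) f i → act s (λ j → ℤ.- f j) i ≡ ℤ.- act s f i
  act-neg s f i = Algebra.Properties.AbelianGroup.inverseˡ-unique ℤ.+-0-abelianGroup _ _ (≡.trans (≡.sym (act-+ s (λ j → ℤ.- f j) f i)) (≡.trans (act-cong s (λ j → ℤ.+-inverseˡ (f j)) i) (act-0 s i)))

  act-shift : ∀ (s : Expr c) f i → act s (λ j → f (suc j)) i ≡ act s f (suc i)
  act-shift 𝟘       f i = ≡.refl
  act-shift 𝟙       f i = ≡.refl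
  act-shift X       f i = ≡.refl
  act-shift (s ⊕ t) f i = ≡.cong₂ ℤ._+_ (act-shift s f i) (act-shift t f i)
  act-shift (s ⊗ t) f i = ≡.trans (act-cong s (act-shift t f) i) (act-shift s (act t f) i)
  act-shift (⊖ s)   f i = ≡.cong ℤ.-_ (act-shift s f i)

  -- Every expression acts as an integer polynomial in a single operator, the shift; commutation
  -- therefore reduces to additivity and to commutation with the shift.
  act-comm : ∀ (s t : Expr c) f i → act s (act t f) i ≡ act t (act s f) i
  act-comm 𝟘       t f i = ≡.sym (act-0 t i)
  act-comm 𝟙       t f i = ≡.refl
  act-comm X       t f i = ≡.sym (act-shift t f i)
  act-comm (s ⊕ u) t f i = ≡.trans (≡.cong₂ ℤ._+_ (act-comm s t f i) (act-comm u t f i)) (≡.sym (act-+ t (act s f) (act u f) i))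
  act-comm (s ⊗ u) t f i = ≡.trans (act-cong s (act-comm u t f) i) (act-comm s t (act u f) i)
  act-comm (⊖ s)   t f i = ≡.trans (≡.cong ℤ.-_ (act-comm s t f i)) (≡.sym (act-neg t (act s f) i))

  act-∣ : ∀ (s : Expr c) {q f} → (∀ i → q ℤS.∣ f i) → ∀ i → q ℤS.∣ act s f i
  act-∣ 𝟘       q∣f i = ℤS.divides ℤ.0ℤ ≡.refl
  act-∣ 𝟙       q∣f i = q∣f i
  act-∣ X       q∣f i = q∣f (suc i)
  act-∣ (s ⊕ t) q∣f i = ℤS.∣m∣n⇒∣m+n (act-∣ s q∣f i) (act-∣ t q∣f i)
  act-∣ (s ⊗ t) q∣f i = act-∣ s (act-∣ t q∣f) i
  act-∣ (⊖ s)   q∣f i = ℤS.∣m⇒∣-m (act-∣ s q∣f i)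

-- Records rather than functions, so that Agda can read s and t off the type s ≋ t.
record SameAction {c} ℓ (δ : ℕ → ℤ) (s t : Expr c) : Set ℓ where
  constructor lift
  field lower : ∀ i → act s δ i ≡ act t δ i

record ActionDivisible {c} ℓ (q : ℕ) (δ : ℕ → ℤ) (s : Expr c) : Set ℓ where
  constructor lift
  field lower : ∀ i → (ℤ.+ q) ℤS.∣ act s δ i

-- ℤ[X] modulo the annihilator of the sequence δ, with X acting as the shift.
SequenceRing : ∀ c ℓ → (ℕ → ℤ) → CommutativeRing c ℓ
SequenceRing c ℓ δ = record
  { Carrier = Expr c
  ; _≈_ = SameAction ℓ δ
  ; _+_ = _⊕_ ; _*_ = _⊗_ ; -_ = ⊖_ ; 0# = 𝟘 ; 1# = 𝟙
  ; isCommutativeRing = record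
    { isRing = record
      { +-isAbelianGroup = record
        { isGroup = record
          { isMonoid = record
            { isSemigroup = record
              { isMagma = record
                { isEquivalence = record
                  { refl = lift λ i → ≡.refl
                  ; sym = λ (lift e) → lift λ i → ≡.sym (e i)
                  ; trans = λ (lift e) (lift e′) → lift λ i → ≡.trans (e i) (e′ i) }
                ; ∙-cong = λ (lift e) (lift e′) → lift λ i → ≡.cong₂ ℤ._+_ (e i) (e′ i) }
              ; assoc = λ s t u → lift λ i → ℤ.+-assoc (act s δ i) (act t δ i) (act u δ i) }
            ; identity = (λ s → lift λ i → ℤ.+-identityˡ _) , (λ s → lift λ i → ℤ.+-identityʳ _) }
          ; inverse = (λ s → lift λ i → ℤ.+-inverseˡ (act s δ i)) , (λ s → lift λ i → ℤ.+-inverseʳ (act s δ i))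
          ; ⁻¹-cong = λ (lift e) → lift λ i → ≡.cong ℤ.-_ (e i) }
        ; comm = λ s t → lift λ i → ℤ.+-comm (act s δ i) (act t δ i) }
      ; *-cong = λ {s} {t} {u} {v} (lift e) (lift e′) → lift λ i →
          ≡.trans (act-cong s e′ i) (≡.trans (act-comm s v δ i) (≡.trans (act-cong v e i) (act-comm v t δ i)))
      ; *-assoc = λ s t u → lift λ i → ≡.refl
      ; *-identity = (λ s → lift λ i → ≡.refl) , (λ s → lift λ i → ≡.refl)
      ; distrib = (λ s t u → lift λ i → act-+ s (act t δ) (act u δ) i) , (λ s t u → lift λ i → ≡.refl) }
    ; *-comm = λ s t → lift λ i → act-comm s t δ i } }

-- For N ≥ 1 the first N shifts of this sequence are linearly independent and the N-th returns to
-- it, so its annihilator in ℤ[X] is generated by `X ^ N - 1`. The value of `act s (δ N)` at i is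
-- the coefficient of `X ^ (-i)` in the group ring.
δ : ℕ → ℕ → ℤ
δ N i with N ∣? i
... | yes _ = ℤ.1ℤ
... | no  _ = ℤ.0ℤ

δ-∣ : ∀ {N i} → N ∣ i → δ N i ≡ ℤ.1ℤ
δ-∣ {N} {i} N∣i with N ∣? i
... | yes _   = ≡.refl
... | no  N∤i = ⊥-elim (N∤i N∣i)

δ-∤ : ∀ {N i} → ¬ N ∣ i → δ N i ≡ ℤ.0ℤ
δ-∤ {N} {i} N∤i with N ∣? i
... | yes N∣i = ⊥-elim (N∤i N∣i)
... | no  _   = ≡.refl

δ-periodic : ∀ N i → δ N (N ℕ.+ i) ≡ δ N i
δ-periodic N i with N ∣? i
... | yes N∣i = δ-∣ (ℕD.∣m∣n⇒∣m+n ℕD.∣-refl N∣i)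
... | no  N∤i = δ-∤ λ N∣ → N∤i (ℕD.∣m+n∣m⇒∣n N∣ ℕD.∣-refl)

-- The group ring of the cyclic group of order N over ℤ/qℤ.
module Cyclic (c ℓ : Level) (q N : ℕ) .{{_ : NonZero q}} .{{_ : NonZero N}} where

  private
    R : CommutativeRing c ℓ
    R = SequenceRing c ℓ (δ N)
    module R = CommRing R

    I : Expr c → Set ℓ
    I = ActionDivisible ℓ q (δ N)

    I-ideal : IsIdeal R I
    I-ideal = record
      { resp = λ (lift e) (lift h) → lift λ i → ≡.subst ((ℤ.+ q) ℤS.∣_) (e i) (h i)
      ; 0∈ = lift λ i → ℤS.divides ℤ.0ℤ ≡.refl
      ; +∈ = λ (lift h) (lift h′) → lift λ i → ℤS.∣m∣n⇒∣m+n (h i) (h′ i)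
      ; *∈ = λ s (lift h) → lift (act-∣ s h) }

  module Q = Quotient R I-ideal

  A : CommutativeRing c ℓ
  A = Q.A/I

  open CommRing A
  open ≈-Reasoning

  act-X^ : ∀ k f i → act (X R.^ k) f i ≡ f (k ℕ.+ i)
  act-X^ zero    f i = ≡.refl
  act-X^ (suc k) f i = ≡.trans (act-X^ k f (suc i)) (≡.cong f (ℕ.+-suc k i))

  act-ι : ∀ k f i → act (R.ι k) f i ≡ ℤ.+ k ℤ.* f i
  act-ι zero    f i = ≡.sym (ℤ.*-zeroˡ (f i))
  act-ι (suc k) f i = ≡.trans (≡.cong (λ z → f i ℤ.+ z) (act-ι k f i)) (≡.sym (ℤ.suc-* (ℤ.+ k) (f i)))

  q≈0 : ι q ≈ 0#
  q≈0 = ≡.subst (_≈ 0#) (≡.sym (Q.·≡ q 𝟙)) (Q.∈⇒~0 (lift λ i → ℤS.divides (δ N i) (≡.trans (act-ι q (δ N) i) (ℤ.*-comm (ℤ.+ q) (δ N i)))))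

  ι≈0⇒q∣ : ∀ k → ι k ≈ 0# → q ∣ k
  ι≈0⇒q∣ k e = ∣⇒∣ᵤ (≡.subst ((ℤ.+ q) ℤS.∣_) (≡.trans (act-ι k (δ N) 0) (≡.trans (≡.cong (ℤ.+ k ℤ.*_) (δ-∣ (N ℕD.∣0))) (ℤ.*-identityʳ (ℤ.+ k))))
    (ActionDivisible.lower (Q.~0⇒∈ (≡.subst (_≈ 0#) (Q.·≡ k 𝟙) e)) 0))

  X^N≈1 : X ^ N ≈ 1#
  X^N≈1 = ≡.subst (_≈ 1#) (≡.sym (Q.^≡ X N)) (Q.≈⇒~ (lift λ i → ≡.trans (act-X^ N (δ N) i) (δ-periodic N i)))

  private
    act-δ-periodic : ∀ s i → act s (δ N) (N ℕ.+ i) ≡ act s (δ N) i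
    act-δ-periodic s i = ≡.trans (≡.sym (act-X^ N (act s (δ N)) i)) (≡.trans (act-comm (X R.^ N) s (δ N) i) (act-cong s (λ j → ≡.trans (act-X^ N (δ N) j) (δ-periodic N j)) i))

    act-δ-+* : ∀ s t i → act s (δ N) (i ℕ.+ t ℕ.* N) ≡ act s (δ N) i
    act-δ-+* s zero    i = ≡.cong (act s (δ N)) (ℕ.+-identityʳ i)
    act-δ-+* s (suc t) i = ≡.trans (≡.cong (act s (δ N)) (≡.trans (≡.sym (ℕ.+-assoc i N _)) (≡.trans (≡.cong (ℕ._+ t ℕ.* N) (ℕ.+-comm i N)) (ℕ.+-assoc N i _))))
      (≡.trans (act-δ-periodic s (i ℕ.+ t ℕ.* N)) (act-δ-+* s t i))

  -- The sequence `act s (δ N)` is N-periodic, so its first N entries decide divisibility of all.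
  I? : ∀ s → Dec (I s)
  I? s = map′ (λ h → lift λ i → ≡.subst ((ℤ.+ q) ℤS.∣_) (reduce i) (h (fromℕ< (m%n<n i N)))) (λ (lift h) i → h (toℕ i))
    (all? λ (i : Fin N) → (ℤ.+ q) ℤS.∣? act s (δ N) (toℕ i))
    where
    reduce : ∀ i → act s (δ N) (toℕ (fromℕ< (m%n<n i N))) ≡ act s (δ N) i
    reduce i = ≡.trans (≡.cong (act s (δ N)) (toℕ-fromℕ< (m%n<n i N))) (≡.trans (≡.sym (act-δ-+* s (i / N) (i % N))) (≡.cong (act s (δ N)) (≡.sym (m≡m%n+[m/n]*n i N))))

  _≟_ : ∀ s t → Dec (s ≈ t)
  s ≟ t = I? (s - t)

  private
    g : Fin N → Carrier
    g i = X ^ toℕ i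

    Span : Carrier → Set ℓ
    Span a = Σ (Fin N → ℕ) λ d → a ≈ sum (λ i → ι (d i) * g i)

    span-≈ : ∀ {a b} → a ≈ b → Span a → Span b
    span-≈ a≈b (d , e) = d , trans (sym a≈b) e

    span-0 : Span 0#
    span-0 = (λ _ → 0) , sym (trans (sum-cong-≋ {N} (λ i → zeroˡ (g i))) (sum-replicate-zero N))

    span-+ : ∀ {a b} → Span a → Span b → Span (a + b)
    span-+ (d , e) (d′ , e′) = (λ i → d i ℕ.+ d′ i) , trans (+-cong e e′) (sym (trans (sum-cong-≋ {N} (λ i → trans (*-congʳ (ι-+ (d i) (d′ i))) (distribʳ (g i) (ι (d i)) (ι (d′ i)))))
      (∑-distrib-+ {N} (λ i → ι (d i) * g i) (λ i → ι (d′ i) * g i))))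

    span-ι : ∀ k {a} → Span a → Span (ι k * a)
    span-ι zero    sa = span-≈ (sym (zeroˡ _)) span-0
    span-ι (suc k) {a} sa = span-≈ (trans (+-congʳ (sym (*-identityˡ a))) (sym (distribʳ a 1# (ι k)))) (span-+ sa (span-ι k sa))

    span-sum : ∀ {k} (f : Fin k → Carrier) → (∀ i → Span (f i)) → Span (sum f)
    span-sum {zero}  f sf = span-0
    span-sum {suc k} f sf = span-+ (sf fzero) (span-sum (f ∘ fsuc) (sf ∘ fsuc))

    ι-pred-q : ι (ℕ.pred q) + 1# ≈ 0#
    ι-pred-q = trans (+-comm _ _) (trans (reflexive (≡.cong ι (ℕ.suc-pred q))) q≈0)

    span-neg : ∀ {a} → Span a → Span (- a)
    span-neg {a} sa = span-≈ (begin
      ι (ℕ.pred q) * a                       ≈⟨ solve 3 (λ k o a → k :* a := (k :+ o) :* a :- o :* a) refl (ι (ℕ.pred q)) 1# a ⟩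
      (ι (ℕ.pred q) + 1#) * a - 1# * a       ≈⟨ +-cong (trans (*-congʳ ι-pred-q) (zeroˡ a)) (-‿cong (*-identityˡ a)) ⟩
      0# - a                                 ≈⟨ +-identityˡ _ ⟩
      - a ∎) (span-ι (ℕ.pred q) sa)

    basis-vector : ∀ {k} (h : Fin k → Carrier) i → Σ (Fin k → ℕ) λ d → h i ≈ sum (λ j → ι (d j) * h j)
    basis-vector {suc k} h fzero = (λ { fzero → 1 ; (fsuc _) → 0 }) , sym (begin
      ι 1 * h fzero + sum (λ j → 0# * h (fsuc j)) ≈⟨ +-cong (trans (*-congʳ (+-identityʳ 1#)) (*-identityˡ _)) (trans (sum-cong-≋ {k} (λ j → zeroˡ _)) (sum-replicate-zero k)) ⟩
      h fzero + 0#                                ≈⟨ +-identityʳ _ ⟩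
      h fzero ∎)
    basis-vector {suc k} h (fsuc i) with basis-vector (h ∘ fsuc) i
    ... | d , e = (λ { fzero → 0 ; (fsuc j) → d j }) , trans e (sym (trans (+-congʳ (zeroˡ _)) (+-identityˡ _)))

    X^-+* : ∀ t k → X ^ (k ℕ.+ t ℕ.* N) ≈ X ^ k
    X^-+* t k = begin
      X ^ (k ℕ.+ t ℕ.* N)   ≈⟨ ^-homo-* X k (t ℕ.* N) ⟩
      X ^ k * X ^ (t ℕ.* N) ≈⟨ *-congˡ (trans (^-congʳ X (ℕ.*-comm t N)) (sym (^-assocʳ X N t))) ⟩
      X ^ k * (X ^ N) ^ t   ≈⟨ *-congˡ (trans (^-congˡ t X^N≈1) (one^ t)) ⟩
      X ^ k * 1#            ≈⟨ *-identityʳ _ ⟩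
      X ^ k ∎
      where
      one^ : ∀ t → 1# ^ t ≈ 1#
      one^ zero    = refl
      one^ (suc t) = trans (*-identityˡ _) (one^ t)

    span-X^ : ∀ k → Span (X ^ k)
    span-X^ k = span-≈ (begin
      g (fromℕ< (m%n<n k N))            ≈⟨ ^-congʳ X (toℕ-fromℕ< (m%n<n k N)) ⟩
      X ^ (k % N)                       ≈⟨ X^-+* (k / N) (k % N) ⟨
      X ^ (k % N ℕ.+ (k / N) ℕ.* N)     ≈⟨ ^-congʳ X (m≡m%n+[m/n]*n k N) ⟨
      X ^ k ∎) (basis-vector g (fromℕ< (m%n<n k N)))

    span-* : ∀ s {t} → Span t → Span (s * t)
    span-* 𝟘       st = span-≈ (sym (zeroˡ _)) span-0
    span-* 𝟙       st = span-≈ (sym (*-identityˡ _)) st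
    span-* X       (d , e) = span-≈ (sym (trans (*-congˡ e) (trans (*-distribˡ-sum {N} X (λ i → ι (d i) * g i)) (sum-cong-≋ {N} λ i → solve 3 (λ x a b → x :* (a :* b) := a :* (x :* b)) refl X (ι (d i)) (g i)))))
      (span-sum (λ i → ι (d i) * (X * g i)) (λ i → span-ι (d i) (span-X^ (suc (toℕ i)))))
    span-* (s ⊕ u) {t} st = span-≈ (sym (distribʳ t s u)) (span-+ (span-* s st) (span-* u st))
    span-* (s ⊗ u) {t} st = span-≈ (sym (*-assoc s u t)) (span-* s (span-* u st))
    span-* (⊖ s)   {t} st = span-≈ (-‿distribˡ-* s t) (span-neg (span-* s st))

  gen : GeneratedByAsModule A N
  gen = g , λ a → let d , e = span-≈ (*-identityʳ a) (span-* a (span-X^ 0)) in d , trans e (sym (lin≈sum g d))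

  Expr-induction : (P : Carrier → Set ℓ) → P 0# → P 1# → P X → (∀ {s t} → P s → P t → P (s + t)) →
                   (∀ {s t} → P s → P t → P (s * t)) → (∀ {s} → P s → P (- s)) → ∀ s → P s
  Expr-induction P z o x p m n 𝟘       = z
  Expr-induction P z o x p m n 𝟙       = o
  Expr-induction P z o x p m n X       = x
  Expr-induction P z o x p m n (s ⊕ t) = p (Expr-induction P z o x p m n s) (Expr-induction P z o x p m n t)
  Expr-induction P z o x p m n (s ⊗ t) = m (Expr-induction P z o x p m n s) (Expr-induction P z o x p m n t)
  Expr-induction P z o x p m n (⊖ s)   = n (Expr-induction P z o x p m n s)

  act-X^′ : ∀ k f i → act (X ^ k) f i ≡ f (k ℕ.+ i)
  act-X^′ k f i = ≡.trans (≡.cong (λ s → act s f i) (Q.^≡ X k)) (act-X^ k f i)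

  PrimeDivisor : ℕ → Set
  PrimeDivisor k = Prime k × k ∣ N

  primeDivisor? : ∀ k → Dec (PrimeDivisor k)
  primeDivisor? k = prime? k ×-dec (k ∣? N)

  -- Where z (1 + N) is invertible, X ^ (N / l) ≠ 1 for every prime l ∣ N, so X has exact order N.
  z : ℕ → Carrier
  z zero    = 1#
  z (suc k) with primeDivisor? k
  ... | yes (_ , k∣N) = (1# - X ^ ℕD.quotient k∣N) * z k
  ... | no  _         = z k

  rad : ℕ → ℕ
  rad zero    = 1
  rad (suc k) with primeDivisor? k
  ... | yes _ = k ℕ.* rad k
  ... | no  _ = rad k

  prime∤rad : ∀ k {l} → Prime l → k ℕ.≤ l → ¬ l ∣ rad k
  prime∤rad zero    pr _   l∣1 = prime∤1 pr l∣1
  prime∤rad (suc k) pr k<l l∣ with primeDivisor? k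
  ... | no _ = prime∤rad k pr (ℕ.<⇒≤ k<l) l∣
  ... | yes (prk , _) with euclidsLemma k (rad k) pr l∣
  ...   | inj₁ l∣k   = ℕ.<⇒≢ k<l (≡.sym (prime∣prime pr prk l∣k))
  ...   | inj₂ l∣rad = prime∤rad k pr (ℕ.<⇒≤ k<l) l∣rad

  act-factor : ∀ d s i → act ((1# - X ^ d) * s) (δ N) i ≡ act s (δ N) i ℤ.- act s (δ N) (d ℕ.+ i)
  act-factor d s i = ≡.cong (λ v → act s (δ N) i ℤ.- v) (act-X^′ d (act s (δ N)) i)

  -- The exponents of X occurring in z k are sums of terms N / l, so they are annihilated by rad k modulo N.
  act-z-vanish : ∀ k i → ¬ N ∣ i ℕ.* rad k → act (z k) (δ N) i ≡ ℤ.0ℤ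
  act-z-vanish zero    i N∤ = δ-∤ (λ N∣i → N∤ (≡.subst (N ∣_) (≡.sym (ℕ.*-identityʳ i)) N∣i))
  act-z-vanish (suc k) i N∤ with primeDivisor? k
  ... | no _ = act-z-vanish k i N∤
  ... | yes (_ , divides d N≡dk) = ≡.trans (act-factor d (z k) i)
      (≡.cong₂ ℤ._-_ (act-z-vanish k i (λ N∣ → N∤ (≡.subst (N ∣_) (assoc′ i) (ℕD.∣n⇒∣m*n k N∣))))
                     (act-z-vanish k (d ℕ.+ i) (λ N∣ → N∤ (ℕD.∣m+n∣m⇒∣n (≡.subst (N ∣_) expand (ℕD.∣n⇒∣m*n k N∣)) (ℕD.m∣m*n (rad k))))))
    where
    assoc′ : ∀ j → k ℕ.* (j ℕ.* rad k) ≡ j ℕ.* (k ℕ.* rad k)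
    assoc′ j = ≡.trans (≡.sym (ℕ.*-assoc k j (rad k))) (≡.trans (≡.cong (ℕ._* rad k) (ℕ.*-comm k j)) (ℕ.*-assoc j k (rad k)))
    expand : k ℕ.* ((d ℕ.+ i) ℕ.* rad k) ≡ N ℕ.* rad k ℕ.+ i ℕ.* (k ℕ.* rad k)
    expand = ≡.trans (assoc′ (d ℕ.+ i)) (≡.trans (ℕ.*-distribʳ-+ (k ℕ.* rad k) d i)
      (≡.cong (ℕ._+ i ℕ.* (k ℕ.* rad k)) (≡.trans (≡.sym (ℕ.*-assoc d k (rad k))) (≡.cong (ℕ._* rad k) (≡.sym N≡dk)))))

  -- The constant coefficient survives each factor `1 - X ^ d` with d = N / k: what is subtracted
  -- vanishes, for otherwise k would divide `rad k`, a product of primes smaller than k.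
  act-z-0 : ∀ k → act (z k) (δ N) 0 ≡ ℤ.1ℤ
  act-z-0 zero = δ-∣ (N ℕD.∣0)
  act-z-0 (suc k) with primeDivisor? k
  ... | no _ = act-z-0 k
  ... | yes (prk , divides d N≡dk) = ≡.trans (act-factor d (z k) 0)
      (≡.cong₂ ℤ._-_ (act-z-0 k) (act-z-vanish k (d ℕ.+ 0) λ N∣ → prime∤rad k prk ℕ.≤-refl (ℕD.*-cancelˡ-∣ d {{d≢0}} (≡.subst₂ _∣_ N≡dk (≡.cong (ℕ._* rad k) (ℕ.+-identityʳ d)) N∣))))
    where
    d≢0 : NonZero d
    d≢0 = ℕ.≢-nonZero λ { ≡.refl → ℕ.≢-nonZero⁻¹ N N≡dk }

  z≉0 : 2 ℕ.≤ q → ∀ k → ¬ z k ≈ 0#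
  z≉0 2≤q k z≈0 = ℕ.<⇒≢ 2≤q (≡.sym (ℕD.∣1⇒≡1 (∣⇒∣ᵤ (≡.subst ((ℤ.+ q) ℤS.∣_) (act-z-0 k) (ActionDivisible.lower (Q.~0⇒∈ z≈0) 0)))))

  factor-of-z : ∀ k {l} → l ℕ.< k → Prime l → (l∣N : l ∣ N) → ∃[ w ] z k ≈ w * (1# - X ^ ℕD.quotient l∣N)
  factor-of-z (suc k) {l} l<k prl l∣N with primeDivisor? k | l ℕ.≟ k
  ... | no k∤ | yes ≡.refl = ⊥-elim (k∤ (prl , l∣N))
  ... | yes (_ , k∣N) | yes ≡.refl = z k , trans (*-comm _ _) (*-congˡ (+-congˡ (-‿cong (^-congʳ X
          (ℕ.*-cancelʳ-≡ (ℕD.quotient k∣N) (ℕD.quotient l∣N) k {{prime⇒nonZero prl}} (≡.trans (≡.sym (ℕD._∣_.equality k∣N)) (ℕD._∣_.equality l∣N)))))))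
  ... | no _  | no l≢k = factor-of-z k (ℕ.≤∧≢⇒< (ℕ.≤-pred l<k) l≢k) prl l∣N
  ... | yes _ | no l≢k with factor-of-z k (ℕ.≤∧≢⇒< (ℕ.≤-pred l<k) l≢k) prl l∣N
  ...   | w , e = _ , trans (*-congˡ e) (sym (*-assoc _ w _))

-- With N = 1 this is ℤ/q itself, so one construction supplies both the finite fields and the rings
-- ℤ/pᵛ of the squarefreeness argument.
record CyclicGroupRing c ℓ (q N : ℕ) : Set (lsuc (c ⊔ ℓ)) where
  field
    A : CommutativeRing c ℓ
  open CommRing A
  field
    ω             : Carrier
    q≈0           : ι q ≈ 0#
    ι≈0⇒q∣        : ∀ k → ι k ≈ 0# → q ∣ k
    ω^N≈1         : ω ^ N ≈ 1#
    gen           : GeneratedByAsModule A N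
    _≟_           : ∀ s t → Dec (s ≈ t)
    induction     : (P : Carrier → Set ℓ) → P 0# → P 1# → P ω → (∀ {s t} → P s → P t → P (s + t)) →
                    (∀ {s t} → P s → P t → P (s * t)) → (∀ {s} → P s → P (- s)) → ∀ s → P s
    z             : Carrier
    z≉0           : 2 ℕ.≤ q → ¬ z ≈ 0#
    factor-of-z   : ∀ {l} → Prime l → (l∣N : l ∣ N) → ∃[ w ] z ≈ w * (1# - ω ^ ℕD.quotient l∣N)

cyclicGroupRing : ∀ c ℓ q N → 1 ℕ.≤ q → 1 ℕ.≤ N → CyclicGroupRing c ℓ q N
cyclicGroupRing c ℓ q@(suc _) N@(suc _) _ _ = record
  { A = A ; ω = X ; q≈0 = q≈0 ; ι≈0⇒q∣ = ι≈0⇒q∣ ; ω^N≈1 = X^N≈1 ; gen = gen ; _≟_ = _≟_ ; induction = Expr-induction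
  ; z = z (suc N) ; z≉0 = λ 2≤q → z≉0 2≤q (suc N)
  ; factor-of-z = λ prl l∣N → factor-of-z (suc N) (s≤s (ℕD.∣⇒≤ l∣N)) prl l∣N }
  where open Cyclic c ℓ q N

-- Maximal ideals

module _ {c ℓ} (A : CommutativeRing c ℓ) where
  open CommRing A

  record ProperIdeal : Set (c ⊔ lsuc ℓ) where
    field
      I       : Carrier → Set ℓ
      isIdeal : IsIdeal A I
      I?      : ∀ x → Dec (I x)
      1∉      : ¬ I 1#

module Maximal {c ℓ} (A : CommutativeRing c ℓ) {p : ℕ} (pr : Prime p)
  (p≈0 : CommutativeRing._≈_ A (CommRing.ι A p) (CommutativeRing.0# A))
  {m} (gen : GeneratedByAsModule A m) where
  open CommRing A
  open ≈-Reasoning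
  open CharP A pr p≈0
  open Enum gen
  open ProperIdeal

  InvertibleMod : (Carrier → Set ℓ) → Carrier → Set _
  InvertibleMod I a = I a ⊎ (∃[ b ] I (1# - b * a))

  private
    -- The ideal P + (a). Ranging over coefficient vectors of the cofactor keeps the predicate in
    -- level ℓ and reduces membership to a search through the finitely many digit vectors.
    adjoin : ProperIdeal A → Carrier → Carrier → Set ℓ
    adjoin P a x = Σ (Fin m → ℕ) λ d → I P (x - lin (proj₁ gen) d * a)

    adjoin-intro : ∀ P a {x} b → I P (x - b * a) → adjoin P a x
    adjoin-intro P a b i = proj₁ (proj₂ gen b) , IsIdeal.resp (isIdeal P) (+-congˡ (-‿cong (*-congʳ (proj₂ (proj₂ gen b))))) i

    adjoin? : ∀ P a x → Dec (adjoin P a x)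
    adjoin? P a x = map′ (λ (i , h) → digits i , h)
      (λ (d , h) → encode d , IsIdeal.resp (isIdeal P) (+-congˡ (-‿cong (*-congʳ (sym (elt-encode d))))) h)
      (any? λ i → I? P (x - elt i * a))

    adjoin-ideal : ∀ P a → IsIdeal A (adjoin P a)
    adjoin-ideal P a = record
      { resp = λ x≈y (d , h) → d , J.resp (+-congʳ x≈y) h
      ; 0∈ = adjoin-intro P a 0# (J.resp (sym (trans (+-congˡ (-‿cong (zeroˡ a))) (trans (+-identityˡ _) -0≈0))) J.0∈)
      ; +∈ = λ {x} {y} (d , h) (d′ , h′) → adjoin-intro P a (l d + l d′)
          (J.resp (solve 5 (λ x y b b′ a → (x :- b :* a) :+ (y :- b′ :* a) := (x :+ y) :- (b :+ b′) :* a) refl x y (l d) (l d′) a) (J.+∈ h h′))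
      ; *∈ = λ x {y} (d , h) → adjoin-intro P a (x * l d)
          (J.resp (solve 4 (λ x y b a → x :* (y :- b :* a) := x :* y :- (x :* b) :* a) refl x y (l d) a) (J.*∈ x h)) }
      where
      module J = IsIdeal (isIdeal P)
      l : (Fin m → ℕ) → Carrier
      l d = lin (proj₁ gen) d

    -- Each listed element is adjoined if the ideal stays proper; otherwise 1 lies in P + (a) and
    -- `a` is already invertible modulo P. Both outcomes persist in larger ideals, so a single pass
    -- over all of A yields a maximal ideal.
    saturate : ∀ {k} (as : Fin k → Carrier) (P : ProperIdeal A) →
      Σ (ProperIdeal A) λ Q → (∀ {x} → I P x → I Q x) × (∀ i → InvertibleMod (I Q) (as i))
    saturate {zero}  as P = P , (λ h → h) , λ ()
    saturate {suc k} as P with adjoin? P (as fzero) 1#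
    ... | yes (d , h) with saturate (as ∘ fsuc) P
    ...   | Q , P⊆Q , inv = Q , P⊆Q , λ { fzero → inj₂ (lin (proj₁ gen) d , P⊆Q h) ; (fsuc i) → inv i }
    saturate {suc k} as P | no 1∉′ with saturate (as ∘ fsuc) (record { I = adjoin P (as fzero) ; isIdeal = adjoin-ideal P (as fzero) ; I? = adjoin? P (as fzero) ; 1∉ = 1∉′ })
    ...   | Q , P⊆Q , inv = Q , (λ {x} h → P⊆Q (adjoin-intro P (as fzero) 0# (IsIdeal.resp (isIdeal P) (sym (trans (+-congˡ (trans (-‿cong (zeroˡ _)) -0≈0)) (+-identityʳ x))) h))) ,
            λ { fzero → inj₁ (P⊆Q (adjoin-intro P (as fzero) 1# (IsIdeal.resp (isIdeal P) (sym (x≈y⇒x-y≈0 (sym (*-identityˡ _)))) (IsIdeal.0∈ (isIdeal P))))) ; (fsuc i) → inv i }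

  maximal-ideal : (P : ProperIdeal A) → Σ (ProperIdeal A) λ Q → (∀ {x} → I P x → I Q x) × (∀ a → InvertibleMod (I Q) a)
  maximal-ideal P with saturate elt P
  ... | Q , P⊆Q , inv = Q , P⊆Q , λ a → cast a (inv (idx a))
    where
    cast : ∀ a → InvertibleMod (I Q) (elt (idx a)) → InvertibleMod (I Q) a
    cast a (inj₁ h)       = inj₁ (IsIdeal.resp (isIdeal Q) (elt-idx a) h)
    cast a (inj₂ (b , h)) = inj₂ (b , IsIdeal.resp (isIdeal Q) (+-congˡ (-‿cong (*-congˡ (elt-idx a)))) h)

-- Roots and characters in fields

module Field {c ℓ} (K : CommutativeRing c ℓ)
  (1≉0 : ¬ CommutativeRing._≈_ K (CommutativeRing.1# K) (CommutativeRing.0# K))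
  (inverse : ∀ x → CommutativeRing._≈_ K x (CommutativeRing.0# K) ⊎
     (∃[ y ] CommutativeRing._≈_ K (CommutativeRing._*_ K y x) (CommutativeRing.1# K))) where
  open CommRing K
  open ≈-Reasoning

  cancel : ∀ {x y} → ¬ x ≈ 0# → x * y ≈ 0# → y ≈ 0#
  cancel {x} {y} x≉0 xy≈0 with inverse x
  ... | inj₁ x≈0 = ⊥-elim (x≉0 x≈0)
  ... | inj₂ (x′ , x′x≈1) = begin
    y            ≈⟨ *-identityˡ y ⟨
    1# * y       ≈⟨ *-congʳ x′x≈1 ⟨
    (x′ * x) * y ≈⟨ *-assoc x′ x y ⟩
    x′ * (x * y) ≈⟨ *-congˡ xy≈0 ⟩
    x′ * 0#      ≈⟨ zeroʳ x′ ⟩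
    0# ∎

  Distinct : ∀ {k} → (Fin k → Carrier) → Set ℓ
  Distinct u = ∀ i j → u i ≈ u j → i ≡ j

  -- The coefficient list omits the leading coefficient 1.
  monic : List Carrier → Carrier → Carrier
  monic []       x = 1#
  monic (c ∷ cs) x = c + x * monic cs x

  -- Horner's scheme: the coefficients, again without the leading 1, of the quotient of
  -- `monic (d ∷ cs)` by x - a.
  divide : Carrier → List Carrier → Carrier → List Carrier
  divide a (c ∷ cs) d = monic (c ∷ cs) a ∷ divide a cs c
  divide a []       d = []

  monic-divide : ∀ a d cs x → monic (d ∷ cs) x - monic (d ∷ cs) a ≈ (x - a) * monic (divide a cs d) x
  monic-divide a d [] x = solve 4 (λ d x a o → (d :+ x :* o) :- (d :+ a :* o) := (x :- a) :* o) refl d x a 1#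
  monic-divide a d (c ∷ cs) x = begin
    (d + x * m x) - (d + a * m a)                 ≈⟨ solve 5 (λ d x a u v → (d :+ x :* u) :- (d :+ a :* v) := x :* (u :- v) :+ (x :- a) :* v) refl d x a (m x) (m a) ⟩
    x * (m x - m a) + (x - a) * m a               ≈⟨ +-congʳ (*-congˡ (monic-divide a c cs x)) ⟩
    x * ((x - a) * q) + (x - a) * m a             ≈⟨ solve 4 (λ x a q v → x :* ((x :- a) :* q) :+ (x :- a) :* v := (x :- a) :* (v :+ x :* q)) refl x a q (m a) ⟩
    (x - a) * (m a + x * q) ∎
    where
    m = monic (c ∷ cs)
    q = monic (divide a cs c) x

  length-divide : ∀ a cs d → length (divide a cs d) ≡ length cs
  length-divide a []       d = ≡.refl
  length-divide a (c ∷ cs) d = ≡.cong suc (length-divide a cs c)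

  too-many-roots : ∀ n cs → length cs ≡ n → (ρ : Fin (suc n) → Carrier) → Distinct ρ → ¬ (∀ i → monic cs (ρ i) ≈ 0#)
  too-many-roots zero    []       _   ρ dist roots = 1≉0 (roots fzero)
  too-many-roots (suc n) (d ∷ cs) len ρ dist roots =
    too-many-roots n (divide (ρ fzero) cs d) (≡.trans (length-divide (ρ fzero) cs d) (ℕ.suc-injective len)) (ρ ∘ fsuc)
      (λ i j e → (suc-injective ((dist (fsuc i) (fsuc j) e))))
      (λ i → cancel (λ e → 0≢suc ((dist (fsuc i) fzero (x-y≈0⇒x≈y _ _ e))))
        (trans (sym (monic-divide (ρ fzero) d cs (ρ (fsuc i)))) (trans (+-cong (roots (fsuc i)) (-‿cong (roots fzero))) (-‿inverseʳ 0#))))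
    where
    0≢suc : ∀ {i : Fin (suc n)} → ¬ fsuc i ≡ fzero
    0≢suc ()

  monic-zeros : ∀ k x → monic (replicate k 0#) x ≈ x ^ k
  monic-zeros zero    x = refl
  monic-zeros (suc k) x = trans (+-identityˡ _) (*-congˡ (monic-zeros k x))

  fixed-points-≤ : ∀ D → 2 ℕ.≤ D → ∀ {k} (ρ : Fin k → Carrier) → Distinct ρ → (∀ i → ρ i ^ D ≈ ρ i) → k ℕ.≤ D
  fixed-points-≤ (suc (suc D)) (s≤s (s≤s z≤n)) {k} ρ dist fixed with k ℕ.≤? suc (suc D)
  ... | yes k≤D = k≤D
  -- The list encodes the polynomial `x ^ suc (suc D) - x`.
  ... | no  k≰D = ⊥-elim (too-many-roots (suc (suc D)) (0# ∷ - 1# ∷ replicate D 0#) (≡.cong (suc ∘ suc) (length-replicate D))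
      (ρ ∘ emb) (λ i j e → (inject≤-injective (ℕ.≰⇒> k≰D) (ℕ.≰⇒> k≰D) i j ((dist _ _ e)))) λ i → root (ρ (emb i)) (fixed (emb i)))
    where
    emb : Fin (suc (suc (suc D))) → Fin k
    emb i = inject≤ i (ℕ.≰⇒> k≰D)
    root : ∀ x → x ^ suc (suc D) ≈ x → monic (0# ∷ - 1# ∷ replicate D 0#) x ≈ 0#
    root x e = begin
      0# + x * (- 1# + x * monic (replicate D 0#) x) ≈⟨ trans (+-identityˡ _) (*-congˡ (+-congˡ (*-congˡ (monic-zeros D x)))) ⟩
      x * (- 1# + x * x ^ D)                         ≈⟨ solve 3 (λ x o y → x :* (:- o :+ y) := x :* y :- x :* o) refl x 1# (x * x ^ D) ⟩
      x ^ suc (suc D) - x * 1#                       ≈⟨ +-cong e (-‿cong (*-identityʳ x)) ⟩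
      x - x                                          ≈⟨ -‿inverseʳ x ⟩
      0# ∎

  -- Artin's shortening: the relation for a + 1 minus `u fzero` times the relation for a loses its
  -- first term and multiplies the other coefficients by the nonzero `u j - u fzero`.
  independence-of-characters : ∀ {s} (u c : Fin s → Carrier) → Distinct u →
    (∀ a → sum (λ j → c j * u j ^ a) ≈ 0#) → ∀ j → c j ≈ 0#
  independence-of-characters {suc s} u c dist rel = λ { fzero → c₀≈0 ; (fsuc j) → tail≈0 j }
    where
    c′ : Fin s → Carrier
    c′ j = c (fsuc j) * (u (fsuc j) - u fzero)
    rel′ : ∀ a → sum (λ j → c′ j * u (fsuc j) ^ a) ≈ 0#
    rel′ a = begin
      sum (λ j → c′ j * u (fsuc j) ^ a)
        ≈⟨ sum-cong-≋ {s} (λ j → solve 4 (λ c u v w → (c :* (u :- v)) :* w := c :* (u :* w) :+ (:- v) :* (c :* w)) refl (c (fsuc j)) (u (fsuc j)) (u fzero) (u (fsuc j) ^ a)) ⟩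
      sum (λ j → c (fsuc j) * u (fsuc j) ^ suc a + - u fzero * (c (fsuc j) * u (fsuc j) ^ a))
        ≈⟨ ∑-distrib-+ {s} (λ j → c (fsuc j) * u (fsuc j) ^ suc a) (λ j → - u fzero * (c (fsuc j) * u (fsuc j) ^ a)) ⟩
      S₁ + sum (λ j → - u fzero * (c (fsuc j) * u (fsuc j) ^ a))
        ≈⟨ +-congˡ (*-distribˡ-sum {s} (- u fzero) (λ j → c (fsuc j) * u (fsuc j) ^ a)) ⟨
      S₁ + - u fzero * S₀
        ≈⟨ solve 5 (λ c v w s t → s :+ (:- v) :* t := (c :* (v :* w) :+ s) :- v :* (c :* w :+ t)) refl (c fzero) (u fzero) (u fzero ^ a) S₁ S₀ ⟩
      sum (λ j → c j * u j ^ suc a) - u fzero * sum (λ j → c j * u j ^ a)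
        ≈⟨ +-cong (rel (suc a)) (-‿cong (trans (*-congˡ (rel a)) (zeroʳ _))) ⟩
      0# - 0#
        ≈⟨ -‿inverseʳ 0# ⟩
      0# ∎
      where
      S₁ = sum (λ j → c (fsuc j) * u (fsuc j) ^ suc a)
      S₀ = sum (λ j → c (fsuc j) * u (fsuc j) ^ a)
    tail≈0 : ∀ j → c (fsuc j) ≈ 0#
    tail≈0 j = cancel (λ e → absurd ((dist (fsuc j) fzero (x-y≈0⇒x≈y _ _ e))))
      (trans (*-comm _ _) (independence-of-characters (u ∘ fsuc) c′ (λ i j e → (suc-injective ((dist (fsuc i) (fsuc j) e)))) rel′ j))
      where
      absurd : ¬ fsuc j ≡ fzero
      absurd ()
    c₀≈0 : c fzero ≈ 0#
    c₀≈0 = begin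
      c fzero                                             ≈⟨ *-identityʳ _ ⟨
      c fzero * 1#                                        ≈⟨ +-identityʳ _ ⟨
      c fzero * 1# + 0#                                   ≈⟨ +-congˡ (trans (sum-cong-≋ {s} (λ j → trans (*-congʳ (tail≈0 j)) (zeroˡ _))) (sum-replicate-zero s)) ⟨
      sum (λ j → c j * u j ^ 0)                           ≈⟨ rel 0 ⟩
      0# ∎

-- The trace form

∑ℤ-∣ : ∀ {p k} (f : Fin k → ℤ) → (∀ i → p ℤS.∣ f i) → p ℤS.∣ ∑ℤ f
∑ℤ-∣ {k = zero}  f p∣f = ℤS.divides ℤ.0ℤ ≡.refl
∑ℤ-∣ {k = suc k} f p∣f = ℤS.∣m∣n⇒∣m+n (p∣f fzero) (∑ℤ-∣ (f ∘ fsuc) (p∣f ∘ fsuc))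

-- Modulo p the expansion along the first row keeps only its leading term, and Euclid's lemma passes
-- to the minor.
det-diagonal : ∀ {p k} → Prime p → (M : Fin k → Fin k → ℤ) → (∀ i j → i ≢ j → (ℤ.+ p) ℤD.∣ M i j) →
               (∀ i → ¬ (ℤ.+ p) ℤD.∣ M i i) → ¬ (ℤ.+ p) ℤD.∣ det M
det-diagonal {k = zero}  pr M off diag p∣1 = prime∤1 pr p∣1
det-diagonal {p} {suc k} pr M off diag p∣det with euclidsLemma ℤ.∣ M fzero fzero ∣ ℤ.∣ det (minor fzero) ∣ pr p∣leading
  where
  minor : Fin (suc k) → Fin k → Fin k → ℤ
  minor j r c = M (fsuc r) (punchIn j c)
  term : Fin (suc k) → ℤ
  term j = sign (toℕ j) ℤ.* (M fzero j ℤ.* det (minor j))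
  p∣tail : ∀ j → (ℤ.+ p) ℤS.∣ term (fsuc j)
  p∣tail j = ℤS.∣n⇒∣m*n {ℤ.+ p} (sign (toℕ (fsuc j))) {M fzero (fsuc j) ℤ.* det (minor (fsuc j))}
    (ℤS.∣m⇒∣m*n {ℤ.+ p} {M fzero (fsuc j)} (det (minor (fsuc j))) (ℤS.∣ᵤ⇒∣ (off fzero (fsuc j) λ ())))
  p∣head : (ℤ.+ p) ℤS.∣ term fzero
  p∣head = ℤS.∣m+n∣n⇒∣m {ℤ.+ p} {term fzero} {∑ℤ (term ∘ fsuc)} (ℤS.∣ᵤ⇒∣ p∣det) (∑ℤ-∣ (term ∘ fsuc) p∣tail)
  p∣leading : p ∣ ℤ.∣ M fzero fzero ∣ ℕ.* ℤ.∣ det (minor fzero) ∣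
  p∣leading = ≡.subst (p ∣_) (≡.trans (≡.cong ℤ.∣_∣ (ℤ.*-identityˡ (M fzero fzero ℤ.* det (minor fzero)))) (ℤ.abs-* (M fzero fzero) (det (minor fzero)))) (ℤS.∣⇒∣ᵤ p∣head)
... | inj₁ p∣M₀₀ = diag fzero p∣M₀₀
... | inj₂ p∣minor = det-diagonal pr (λ r c → M (fsuc r) (fsuc c)) (λ i j i≢j → off (fsuc i) (fsuc j) (i≢j ∘ suc-injective)) (λ i → diag (fsuc i)) p∣minor

-- The parameter is one less than the degree: the intended field has `p ^ suc r` elements and `ω`
-- generates its multiplicative group.
record FrobeniusField {c ℓ} (K : CommutativeRing c ℓ) (p r : ℕ) : Set (c ⊔ ℓ) where
  open CommRing K
  field
    1≉0     : ¬ 1# ≈ 0#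
    inverse : ∀ x → x ≈ 0# ⊎ (∃[ y ] y * x ≈ 1#)
    _≟_     : ∀ x y → Dec (x ≈ y)
    p≈0     : ι p ≈ 0#
    m       : ℕ
    gen     : GeneratedByAsModule K m
    fixed   : ∀ x → x ^ (p ℕ.^ suc r) ≈ x
    ω       : Carrier
    ω-order : ∀ a b → a ℕ.≤ b → ω ^ a ≈ ω ^ b → (p ℕ.^ suc r ℕ.∸ 1) ∣ b ℕ.∸ a

module TraceForm {c ℓ} (K : CommutativeRing c ℓ) {p r} (pr : Prime p) (p≢2 : p ≢ 2) (𝔽 : FrobeniusField K p r) where
  open CommRing K
  open FrobeniusField 𝔽
  open Field K 1≉0 inverse
  open CharP K pr p≈0
  open Enum gen
  open ≈-Reasoning

  1≤p^ : ∀ k → 1 ℕ.≤ p ℕ.^ k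
  1≤p^ k = ℕ.m^n>0 p {{prime⇒nonZero pr}} k

  ι-faithful : ∀ {k} → ι k ≈ 0# → p ∣ k
  ι-faithful {k} k≈0 with p ∣? k
  ... | yes p∣k = p∣k
  ... | no  p∤k = ⊥-elim (1≉0 (trans (sym (proj₂ (ι-inverse p∤k))) (trans (*-congˡ k≈0) (zeroʳ _))))

  ι-injective : ∀ {a b} → a ℕ.< p → b ℕ.< p → ι a ≈ ι b → a ≡ b
  ι-injective {a} {b} a<p b<p e = difference-∣ a<p b<p (ι-faithful (begin
    ι (a ℕ.+ ℕ.pred p ℕ.* b)  ≈⟨ ι-+ a _ ⟩
    ι a + ι (ℕ.pred p ℕ.* b)  ≈⟨ +-cong e (trans (ι-* (ℕ.pred p) b) (*-congʳ ι-pred)) ⟩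
    ι b + - 1# * ι b          ≈⟨ +-congˡ (trans (sym (-‿distribˡ-* 1# (ι b))) (-‿cong (*-identityˡ _))) ⟩
    ι b - ι b                 ≈⟨ -‿inverseʳ _ ⟩
    0# ∎))

  InPrimeField : Carrier → Set ℓ
  InPrimeField x = x ^ p ≈ x

  ι-inPrimeField : ∀ k → InPrimeField (ι k)
  ι-inPrimeField zero    = RingLemmas.0^ K (prime>0 pr)
  ι-inPrimeField (suc k) = trans (frobenius-+ 1# (ι k)) (+-cong (RingLemmas.1^ K p) (ι-inPrimeField k))

  inverse-inPrimeField : ∀ {x y} → y * x ≈ 1# → InPrimeField x → InPrimeField y
  inverse-inPrimeField {x} {y} yx≈1 fx = x-y≈0⇒x≈y _ _ (cancel x≉0 (begin
    x * (y ^ p - y)         ≈⟨ solve 3 (λ x a b → x :* (a :- b) := a :* x :- b :* x) refl x (y ^ p) y ⟩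
    y ^ p * x - y * x       ≈⟨ +-cong (*-congˡ (sym fx)) (-‿cong yx≈1) ⟩
    y ^ p * x ^ p - 1#      ≈⟨ +-congʳ (trans (sym (^-distrib-* y x p)) (trans (^-congˡ p yx≈1) (RingLemmas.1^ K p))) ⟩
    1# - 1#                 ≈⟨ -‿inverseʳ 1# ⟩
    0# ∎))
    where
    x≉0 : ¬ x ≈ 0#
    x≉0 x≈0 = 1≉0 (trans (sym yx≈1) (trans (*-congˡ x≈0) (zeroʳ y)))

  *-inPrimeField : ∀ {x y} → InPrimeField x → InPrimeField y → InPrimeField (x * y)
  *-inPrimeField {x} {y} fx fy = trans (^-distrib-* x y p) (*-cong fx fy)

  ^p^-inPrimeField : ∀ {x} → InPrimeField x → ∀ j → x ^ (p ℕ.^ j) ≈ x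
  ^p^-inPrimeField fx zero    = *-identityʳ _
  ^p^-inPrimeField {x} fx (suc j) = trans (sym (^p^suc x j)) (trans (^-congˡ p (^p^-inPrimeField fx j)) fx)

  -- The junk value outside the prime field is 0.
  residue : Carrier → ℕ
  residue x with any? (λ (k : Fin p) → ι (toℕ k) ≟ x)
  ... | yes (k , _) = toℕ k
  ... | no  _       = 0

  -- Otherwise `x` together with the p values `ι k` would be p + 1 distinct roots of `x ^ p - x`.
  ι-residue : ∀ {x} → InPrimeField x → ι (residue x) ≈ x
  ι-residue {x} fx with any? (λ (k : Fin p) → ι (toℕ k) ≟ x)
  ... | yes (_ , e) = e
  ... | no  x∉ = ⊥-elim (ℕ.1+n≰n (fixed-points-≤ p (prime>1 pr) ρ dist fixedρ))
    where
    ρ : Fin (suc p) → Carrier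
    ρ fzero    = x
    ρ (fsuc k) = ι (toℕ k)
    dist : Distinct ρ
    dist fzero    fzero    _ = ≡.refl
    dist fzero    (fsuc j) e = ⊥-elim (x∉ (j , sym e))
    dist (fsuc i) fzero    e = ⊥-elim (x∉ (i , e))
    dist (fsuc i) (fsuc j) e = ≡.cong fsuc (toℕ-injective (ι-injective (toℕ<n i) (toℕ<n j) e))
    fixedρ : ∀ i → ρ i ^ p ≈ ρ i
    fixedρ fzero    = fx
    fixedρ (fsuc k) = ι-inPrimeField (toℕ k)

  sum-single : ∀ {k} (f : Fin k → Carrier) j → (∀ i → i ≢ j → f i ≈ 0#) → sum f ≈ f j
  sum-single {suc k} f fzero h = trans (+-congˡ (trans (sum-cong-≋ {k} (λ i → h (fsuc i) λ ())) (sum-replicate-zero k))) (+-identityʳ _)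
  sum-single {suc k} f (fsuc j) h = trans (+-cong (h fzero λ ()) (sum-single (f ∘ fsuc) j (λ i i≢j → h (fsuc i) (i≢j ∘ suc-injective)))) (+-identityˡ _)

  T : Carrier → Carrier
  T x = sum {suc r} (λ j → x ^ (p ℕ.^ toℕ j))

  T-cong : ∀ {x y} → x ≈ y → T x ≈ T y
  T-cong x≈y = sum-cong-≋ {suc r} (λ j → ^-congˡ (p ℕ.^ toℕ j) x≈y)

  T-+ : ∀ x y → T (x + y) ≈ T x + T y
  T-+ x y = trans (sum-cong-≋ {suc r} (λ j → frobenius^-+ (toℕ j) x y)) (∑-distrib-+ {suc r} (λ j → x ^ (p ℕ.^ toℕ j)) (λ j → y ^ (p ℕ.^ toℕ j)))

  T-scale : ∀ {a} x → InPrimeField a → T (a * x) ≈ a * T x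
  T-scale {a} x fa = trans (sum-cong-≋ {suc r} (λ j → trans (^-distrib-* a x (p ℕ.^ toℕ j)) (*-congʳ (^p^-inPrimeField fa (toℕ j)))))
    (sym (*-distribˡ-sum {suc r} a (λ j → x ^ (p ℕ.^ toℕ j))))

  T-0 : T 0# ≈ 0#
  T-0 = trans (sum-cong-≋ {suc r} (λ j → RingLemmas.0^ K (1≤p^ (toℕ j)))) (sum-replicate-zero (suc r))

  T-neg : ∀ x → T (- x) ≈ - T x
  T-neg x = x-y≈0⇒x≈y _ _ (begin
    T (- x) - - T x   ≈⟨ +-congˡ (-‿involutive _) ⟩
    T (- x) + T x     ≈⟨ T-+ (- x) x ⟨
    T (- x + x)       ≈⟨ T-cong (-‿inverseˡ x) ⟩
    T 0#              ≈⟨ T-0 ⟩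
    0# ∎)

  T-sum : ∀ {k} (f : Fin k → Carrier) → T (sum f) ≈ sum (λ i → T (f i))
  T-sum {zero}  f = T-0
  T-sum {suc k} f = trans (T-+ _ _) (+-congˡ (T-sum (f ∘ fsuc)))

  sum-^p : ∀ {k} (f : Fin k → Carrier) → sum f ^ p ≈ sum (λ i → f i ^ p)
  sum-^p {zero}  f = RingLemmas.0^ K (prime>0 pr)
  sum-^p {suc k} f = trans (frobenius-+ _ _) (+-congˡ (sum-^p (f ∘ fsuc)))

  -- Frobenius shifts the summands of `T` by one place, and `fixed` turns the one that leaves at the
  -- end into the first.
  T-inPrimeField : ∀ x → InPrimeField (T x)
  T-inPrimeField x = begin
    T x ^ p                                             ≈⟨ sum-^p {suc r} (λ j → x ^ (p ℕ.^ toℕ j)) ⟩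
    sum {suc r} (λ j → (x ^ (p ℕ.^ toℕ j)) ^ p)         ≈⟨ sum-cong-≋ {suc r} (λ j → ^p^suc x (toℕ j)) ⟩
    sum {suc r} (λ j → x ^ (p ℕ.^ suc (toℕ j)))         ≈⟨ MSum.sum-init-last +-monoid {r} (λ j → x ^ (p ℕ.^ suc (toℕ j))) ⟩
    sum {r} (λ j → x ^ (p ℕ.^ suc (toℕ (inject₁ j)))) + x ^ (p ℕ.^ suc (toℕ (fromℕ r)))
      ≈⟨ +-cong (sum-cong-≋ {r} (λ j → ^-congʳ x (≡.cong (λ k → p ℕ.^ suc k) (toℕ-inject₁ j)))) (trans (^-congʳ x (≡.cong (λ k → p ℕ.^ suc k) (toℕ-fromℕ r))) (trans (fixed x) (sym (*-identityʳ x)))) ⟩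
    sum {r} (λ j → x ^ (p ℕ.^ suc (toℕ j))) + x ^ 1     ≈⟨ +-comm _ _ ⟩
    T x ∎

  u : Fin (suc r) → Carrier
  u j = ω ^ (p ℕ.^ toℕ j)

  private
    u-<⇒≉ : ∀ {i j} → i ℕ.< j → j ℕ.≤ r → ¬ ω ^ (p ℕ.^ i) ≈ ω ^ (p ℕ.^ j)
    u-<⇒≉ {i} {j} i<j j≤r e = <⇒∤ (ℕ.m<n⇒0<n∸m p^i<p^j) bound (ω-order _ _ (ℕ.<⇒≤ p^i<p^j) e)
      where
      p^i<p^j : p ℕ.^ i ℕ.< p ℕ.^ j
      p^i<p^j = ℕ.^-monoʳ-< p (prime>1 pr) i<j
      p^j<p^r : p ℕ.^ j ℕ.< p ℕ.^ suc r
      p^j<p^r = ℕ.^-monoʳ-< p (prime>1 pr) (s≤s j≤r)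
      bound : p ℕ.^ j ℕ.∸ p ℕ.^ i ℕ.< p ℕ.^ suc r ℕ.∸ 1
      bound = ℕ.≤-<-trans (ℕ.∸-monoʳ-≤ (p ℕ.^ j) (1≤p^ i)) (ℕ.∸-monoˡ-< p^j<p^r (1≤p^ j))

  u-distinct : Distinct u
  u-distinct i j e with ℕ.<-cmp (toℕ i) (toℕ j)
  ... | tri< i<j _ _ = ⊥-elim (u-<⇒≉ i<j (ℕ.≤-pred (toℕ<n j)) e)
  ... | tri≈ _ i≡j _ = toℕ-injective i≡j
  ... | tri> _ _ j<i = ⊥-elim (u-<⇒≉ j<i (ℕ.≤-pred (toℕ<n i)) (sym e))

  swap-powers : ∀ x a b → (x ^ a) ^ b ≈ (x ^ b) ^ a
  swap-powers x a b = trans (^-assocʳ x a b) (trans (^-congʳ x (ℕ.*-comm a b)) (sym (^-assocʳ x b a)))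

  -- Since `T (ω ^ a)` is the sum of the `u j ^ a`, vanishing of `T` would be a relation between
  -- distinct characters with all coefficients 1.
  T-nonzero : ∃[ t ] ¬ T t ≈ 0#
  T-nonzero with any? (λ i → ¬? (T (elt i) ≟ 0#))
  ... | yes (i , h) = elt i , h
  ... | no  ¬h = ⊥-elim (1≉0 (independence-of-characters u (λ _ → 1#) u-distinct
      (λ a → trans (sum-cong-≋ {suc r} (λ j → trans (*-identityˡ _) (swap-powers ω (p ℕ.^ toℕ j) a)))
        (trans (T-cong (sym (elt-idx (ω ^ a)))) (decidable-stable (T (elt (idx (ω ^ a))) ≟ 0#) λ nz → ¬h (_ , nz)))) fzero))

  record OrthogonalFamily (k : ℕ) : Set (c ⊔ ℓ) where
    field
      e       : Fin k → Carrier
      orth    : ∀ i j → i ≢ j → T (e i * e j) ≈ 0#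
      nondeg  : ∀ i → ¬ T (e i * e i) ≈ 0#

    d⁻¹-spec : ∀ i → ∃[ y ] y * T (e i * e i) ≈ 1#
    d⁻¹-spec i with inverse (T (e i * e i))
    ... | inj₁ z = ⊥-elim (nondeg i z)
    ... | inj₂ w = w

    d⁻¹ : Fin k → Carrier
    d⁻¹ i = proj₁ (d⁻¹-spec i)

    coordinate : Carrier → Fin k → Carrier
    coordinate x i = d⁻¹ i * T (x * e i)

    coordinate-inPrimeField : ∀ x i → InPrimeField (coordinate x i)
    coordinate-inPrimeField x i = *-inPrimeField (inverse-inPrimeField (proj₂ (d⁻¹-spec i)) (T-inPrimeField (e i * e i))) (T-inPrimeField (x * e i))

    proj : Carrier → Carrier
    proj x = sum (λ i → coordinate x i * e i)

    T-combination : ∀ (a : Fin k → Carrier) → (∀ i → InPrimeField (a i)) → ∀ j →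
                    T (sum (λ i → a i * e i) * e j) ≈ a j * T (e j * e j)
    T-combination a fa j = begin
      T (sum (λ i → a i * e i) * e j)       ≈⟨ T-cong (*-distribʳ-sum {k} (e j) (λ i → a i * e i)) ⟩
      T (sum (λ i → a i * e i * e j))       ≈⟨ T-sum {k} (λ i → a i * e i * e j) ⟩
      sum (λ i → T (a i * e i * e j))       ≈⟨ sum-cong-≋ {k} (λ i → trans (T-cong (*-assoc (a i) (e i) (e j))) (T-scale (e i * e j) (fa i))) ⟩
      sum (λ i → a i * T (e i * e j))       ≈⟨ sum-single {k} (λ i → a i * T (e i * e j)) j (λ i i≢j → trans (*-congˡ (orth i j i≢j)) (zeroʳ _)) ⟩
      a j * T (e j * e j) ∎

    residual-orth : ∀ x j → T ((x - proj x) * e j) ≈ 0#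
    residual-orth x j = begin
      T ((x - proj x) * e j)                    ≈⟨ T-cong (trans (distribʳ _ _ _) (+-congˡ (sym (-‿distribˡ-* _ _)))) ⟩
      T (x * e j - proj x * e j)                ≈⟨ trans (T-+ _ _) (+-congˡ (T-neg _)) ⟩
      T (x * e j) - T (proj x * e j)            ≈⟨ +-congˡ (-‿cong (T-combination (coordinate x) (coordinate-inPrimeField x) j)) ⟩
      T (x * e j) - coordinate x j * T (e j * e j) ≈⟨ +-congˡ (-‿cong (solve 3 (λ a b c → (a :* b) :* c := (a :* c) :* b) refl (d⁻¹ j) (T (x * e j)) (T (e j * e j)))) ⟩
      T (x * e j) - (d⁻¹ j * T (e j * e j)) * T (x * e j) ≈⟨ +-congˡ (-‿cong (trans (*-congʳ (proj₂ (d⁻¹-spec j))) (*-identityˡ _))) ⟩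
      T (x * e j) - T (x * e j)                 ≈⟨ -‿inverseʳ _ ⟩
      0# ∎

    -- The p ^ k combinations with residue coefficients are distinct roots of x ^ (p ^ (1 + r)) - x.
    size-bound : k ℕ.≤ suc r
    size-bound = ℕ.≮⇒≥ λ r<k → ℕ.<⇒≱ (ℕ.^-monoʳ-< p (prime>1 pr) r<k)
        (fixed-points-≤ (p ℕ.^ suc r) 2≤p^ comb comb-distinct (λ i → fixed (comb i)))
      where
      2≤p^ : 2 ℕ.≤ p ℕ.^ suc r
      2≤p^ = ℕ.≤-trans (prime>1 pr) (ℕ.m≤m*n p (p ℕ.^ r) {{ℕ.>-nonZero (1≤p^ r)}})
      a : Fin (p ℕ.^ k) → Fin k → ℕ
      a i j = toℕ (finToFun i j)
      comb : Fin (p ℕ.^ k) → Carrier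
      comb i = sum (λ j → ι (a i j) * e j)
      comb-distinct : Distinct comb
      comb-distinct i i′ h = ≡.trans (≡.sym (funToFin-finToFin {k} {p} i)) (≡.trans (funToFin-cong (λ j → toℕ-injective (ι-injective (toℕ<n (finToFun i j)) (toℕ<n (finToFun i′ j)) (same j)))) (funToFin-finToFin {k} {p} i′))
        where
        same : ∀ j → ι (a i j) ≈ ι (a i′ j)
        same j = x-y≈0⇒x≈y _ _ (cancel (nondeg j) (begin
          T (e j * e j) * (ι (a i j) - ι (a i′ j)) ≈⟨ solve 3 (λ d x y → d :* (x :- y) := x :* d :- y :* d) refl (T (e j * e j)) (ι (a i j)) (ι (a i′ j)) ⟩
          ι (a i j) * T (e j * e j) - ι (a i′ j) * T (e j * e j) ≈⟨ +-cong (T-combination (λ j → ι (a i j)) (λ j → ι-inPrimeField (a i j)) j) (-‿cong (T-combination (λ j → ι (a i′ j)) (λ j → ι-inPrimeField (a i′ j)) j)) ⟨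
          T (comb i * e j) - T (comb i′ * e j)   ≈⟨ x≈y⇒x-y≈0 (T-cong (*-congʳ h)) ⟩
          0# ∎))

  open OrthogonalFamily

  Complete : ∀ {k} → OrthogonalFamily k → Set (c ⊔ ℓ)
  Complete F = ∀ x → x ≈ proj F x

  cons : ∀ {k} (F : OrthogonalFamily k) v → (∀ i → T (v * e F i) ≈ 0#) → ¬ T (v * v) ≈ 0# → OrthogonalFamily (suc k)
  cons F v v⊥ v≉ = record
    { e = λ { fzero → v ; (fsuc i) → e F i }
    ; orth = λ { fzero fzero 0≢0 → ⊥-elim (0≢0 ≡.refl) ; fzero (fsuc j) _ → v⊥ j ; (fsuc i) fzero _ → trans (T-cong (*-comm _ _)) (v⊥ i)
               ; (fsuc i) (fsuc j) i≢j → orth F i j (i≢j ∘ ≡.cong fsuc) }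
    ; nondeg = λ { fzero → v≉ ; (fsuc i) → nondeg F i } }

  -- Polarization: as 2 is invertible, one of v, w, v + w is anisotropic when T (v * w) ≉ 0.
  extend : ∀ {k} (F : OrthogonalFamily k) x → ¬ x ≈ proj F x → OrthogonalFamily (suc k)
  extend {k} F x x≉ = choose (T (v * v) ≟ 0#) (T (w * w) ≟ 0#)
    where
    v w y : Carrier
    v = x - proj F x
    v≉0 : ¬ v ≈ 0#
    v≉0 v≈0 = x≉ (x-y≈0⇒x≈y _ _ v≈0)
    v⁻¹ : ∃[ z ] z * v ≈ 1#
    v⁻¹ with inverse v
    ... | inj₁ v≈0 = ⊥-elim (v≉0 v≈0)
    ... | inj₂ z = z
    t = proj₁ T-nonzero
    -- Chosen so that `v * y ≈ t`. As `v` is orthogonal to `proj F y`, the residual `w` still pairs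
    -- with `v` to the nonzero value `T t`.
    y = proj₁ v⁻¹ * t
    w = y - proj F y
    v⊥ : ∀ i → T (v * e F i) ≈ 0#
    v⊥ = residual-orth F x
    w⊥ : ∀ i → T (w * e F i) ≈ 0#
    w⊥ = residual-orth F y
    v⊥proj : T (v * proj F y) ≈ 0#
    v⊥proj = begin
      T (v * proj F y)                                   ≈⟨ T-cong (*-distribˡ-sum v (λ i → coordinate F y i * e F i)) ⟩
      T (sum (λ i → v * (coordinate F y i * e F i)))     ≈⟨ T-sum (λ i → v * (coordinate F y i * e F i)) ⟩
      sum (λ i → T (v * (coordinate F y i * e F i)))     ≈⟨ sum-cong-≋ {k} (λ i → trans (T-cong (solve 3 (λ v a e → v :* (a :* e) := a :* (v :* e)) refl v (coordinate F y i) (e F i))) (trans (T-scale (v * e F i) (coordinate-inPrimeField F y i)) (trans (*-congˡ (v⊥ i)) (zeroʳ _)))) ⟩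
      sum {k} (λ _ → 0#)                                 ≈⟨ sum-replicate-zero k ⟩
      0# ∎
    T[vw]≈T[t] : T (v * w) ≈ T t
    T[vw]≈T[t] = begin
      T (v * w)                         ≈⟨ T-cong (solve 4 (λ v z t q → v :* (z :* t :- q) := (z :* v) :* t :+ :- (v :* q)) refl v (proj₁ v⁻¹) t (proj F y)) ⟩
      T ((proj₁ v⁻¹ * v) * t + - (v * proj F y)) ≈⟨ trans (T-+ _ _) (+-cong (T-cong (trans (*-congʳ (proj₂ v⁻¹)) (*-identityˡ t))) (T-neg _)) ⟩
      T t - T (v * proj F y)            ≈⟨ +-congˡ (trans (-‿cong v⊥proj) -0≈0) ⟩
      T t + 0#                          ≈⟨ +-identityʳ _ ⟩
      T t ∎
    2≉0 : ¬ ι 2 ≈ 0#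
    2≉0 e = p≢2 (prime∣prime pr prime[2] (ι-faithful e))
    choose : Dec (T (v * v) ≈ 0#) → Dec (T (w * w) ≈ 0#) → OrthogonalFamily _
    choose (no vv≉0) _ = cons F v v⊥ vv≉0
    choose (yes _) (no ww≉0) = cons F w w⊥ ww≉0
    choose (yes vv≈0) (yes ww≈0) = cons F (v + w) (λ i → trans (T-cong (distribʳ _ v w)) (trans (T-+ _ _) (trans (+-cong (v⊥ i) (w⊥ i)) (+-identityˡ 0#))))
      λ h → proj₂ T-nonzero (cancel 2≉0 (begin
        ι 2 * T t                                       ≈⟨ trans (distribʳ _ 1# (ι 1)) (+-cong (*-identityˡ _) (trans (*-congʳ (+-identityʳ 1#)) (*-identityˡ _))) ⟩
        T t + T t                                       ≈⟨ +-cong T[vw]≈T[t] T[vw]≈T[t] ⟨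
        T (v * w) + T (v * w)                           ≈⟨ trans (+-cong (+-identityˡ _) (+-identityʳ _)) refl ⟨
        (0# + T (v * w)) + (T (v * w) + 0#)             ≈⟨ +-cong (+-congʳ vv≈0) (+-congˡ ww≈0) ⟨
        (T (v * v) + T (v * w)) + (T (v * w) + T (w * w)) ≈⟨ trans (T-+ _ _) (+-cong (T-+ _ _) (T-+ _ _)) ⟨
        T ((v * v + v * w) + (v * w + w * w))           ≈⟨ T-cong (solve 2 (λ v w → (v :+ w) :* (v :+ w) := (v :* v :+ v :* w) :+ (v :* w :+ w :* w)) refl v w) ⟨
        T ((v + w) * (v + w))                           ≈⟨ h ⟩
        0# ∎))

  -- The fuel `f` starts two above `r`, and an orthogonal family has at most `suc r` members, so
  -- exhausting it contradicts `size-bound`.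
  grow : ∀ f {k} → k ℕ.+ f ≡ suc (suc r) → OrthogonalFamily k → ∃[ k ] Σ (OrthogonalFamily k) Complete
  grow zero    {k} eq F = ⊥-elim (ℕ.1+n≰n (≡.subst (ℕ._≤ suc r) (≡.trans (≡.sym (ℕ.+-identityʳ k)) eq) (size-bound F)))
  grow (suc f) {k} eq F with any? (λ i → ¬? (elt i ≟ proj F (elt i)))
  ... | yes (i , h) = grow f (≡.trans (≡.sym (ℕ.+-suc k f)) eq) (extend F (elt i) h)
  ... | no  ¬h = k , F , λ x → trans (sym (elt-idx x)) (trans (decidable-stable (elt (idx x) ≟ proj F (elt (idx x))) (λ h → ¬h (_ , h)))
      (sum-cong-≋ {k} (λ i → *-congʳ (*-congˡ (T-cong (*-congʳ (elt-idx x)))))))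

  orthogonal-basis : ∃[ k ] Σ (OrthogonalFamily k) Complete
  orthogonal-basis = grow (suc (suc r)) {0} ≡.refl (record { e = λ () ; orth = λ () ; nondeg = λ () })

  ιℤ-faithful : ∀ i → ιℤ i ≈ 0# → (ℤ.+ p) ℤD.∣ i
  ιℤ-faithful (ℤ.+ k)      h = ι-faithful h
  ιℤ-faithful (ℤ.-[1+ k ]) h = ι-faithful (trans (sym (-‿involutive _)) (trans (-‿cong h) -0≈0))

  ιℤ-∣ : ∀ i → (ℤ.+ p) ℤD.∣ i → ιℤ i ≈ 0#
  ιℤ-∣ (ℤ.+ k)      p∣i = ι-∣ p∣i
  ιℤ-∣ (ℤ.-[1+ k ]) p∣i = trans (-‿cong (ι-∣ p∣i)) -0≈0

  ιℤ-sum : ∀ {k} (f : Fin k → ℤ) → ιℤ (∑ℤ f) ≈ sum (λ i → ιℤ (f i))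
  ιℤ-sum {zero}  f = refl
  ιℤ-sum {suc k} f = trans (ιℤ-+ (f fzero) (∑ℤ (f ∘ fsuc))) (+-congˡ (ιℤ-sum (f ∘ fsuc)))

  unit-mod : ∀ a → ¬ (ℤ.+ p) ℤD.∣ a → IsUnitMod p a
  unit-mod a p∤a with inverse (ιℤ a)
  ... | inj₁ a≈0 = ⊥-elim (p∤a (ιℤ-faithful a a≈0))
  ... | inj₂ (y , ya≈1) = ℤ.+ residue y , ιℤ-faithful (a ℤ.* ℤ.+ residue y ℤ.- ℤ.1ℤ) (begin
    ιℤ (a ℤ.* ℤ.+ residue y ℤ.- ℤ.1ℤ)   ≈⟨ trans (ιℤ-+ (a ℤ.* ℤ.+ residue y) (ℤ.- ℤ.1ℤ)) (+-cong (ιℤ-* a (ℤ.+ residue y)) (-‿cong (+-identityʳ 1#))) ⟩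
    ιℤ a * ι (residue y) - 1#           ≈⟨ +-congʳ (trans (*-congˡ (ι-residue (inverse-inPrimeField ya≈1 (ιℤ-inPrimeField a)))) (trans (*-comm _ _) ya≈1)) ⟩
    1# - 1#                             ≈⟨ -‿inverseʳ 1# ⟩
    0# ∎)
    where
    ιℤ-inPrimeField : ∀ i → InPrimeField (ιℤ i)
    ιℤ-inPrimeField (ℤ.+ k)      = ι-inPrimeField k
    ιℤ-inPrimeField (ℤ.-[1+ k ]) = trans (^-congˡ p neg) (trans (ι-inPrimeField (ℕ.pred p ℕ.* suc k)) (sym neg))
      where
      neg : - ι (suc k) ≈ ι (ℕ.pred p ℕ.* suc k)
      neg = sym (trans (ι-* (ℕ.pred p) (suc k)) (trans (*-congʳ ι-pred) (trans (sym (-‿distribˡ-* 1# _)) (-‿cong (*-identityˡ _)))))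

  module Basis {k} (F : OrthogonalFamily k) (complete : Complete F) where

    -- Linearity gives `φ x` as the sum over i of `d⁻¹ i * T (x * e i) * φ (e i)`; writing out `T`
    -- and exchanging the sums leaves this coefficient at `x ^ (p ^ j)`.
    coefficient : (Carrier → Carrier) → Fin (suc r) → Carrier
    coefficient φ j = sum {k} (λ i → (d⁻¹ F i * φ (e F i)) * e F i ^ (p ℕ.^ toℕ j))

    expansion : (φ : Carrier → Carrier) → (∀ {x y} → x ≈ y → φ x ≈ φ y) → (∀ x y → φ (x + y) ≈ φ x + φ y) →
      (∀ {a} x → InPrimeField a → φ (a * x) ≈ a * φ x) →
      ∀ x → φ x ≈ sum {suc r} (λ j → coefficient φ j * x ^ (p ℕ.^ toℕ j))
    expansion φ φ-cong φ-+ φ-scale x = begin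
      φ x                                                  ≈⟨ φ-cong (complete x) ⟩
      φ (sum (λ i → coordinate F x i * e F i))             ≈⟨ φ-sum {k} (λ i → coordinate F x i * e F i) ⟩
      sum (λ i → φ (coordinate F x i * e F i))             ≈⟨ sum-cong-≋ {k} (λ i → φ-scale (e F i) (coordinate-inPrimeField F x i)) ⟩
      sum (λ i → (d⁻¹ F i * T (x * e F i)) * φ (e F i))    ≈⟨ sum-cong-≋ {k} (λ i → trans (solve 3 (λ d t f → (d :* t) :* f := (d :* f) :* t) refl (d⁻¹ F i) (T (x * e F i)) (φ (e F i)))
                                                                (trans (*-distribˡ-sum {suc r} (d⁻¹ F i * φ (e F i)) (λ j → (x * e F i) ^ (p ℕ.^ toℕ j))) (sum-cong-≋ {suc r} (λ j → *-cong (refl {d⁻¹ F i * φ (e F i)}) (^-distrib-* x (e F i) (p ℕ.^ toℕ j)))))) ⟩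
      sum {k} (λ i → sum {suc r} (λ j → (d⁻¹ F i * φ (e F i)) * (x ^ (p ℕ.^ toℕ j) * e F i ^ (p ℕ.^ toℕ j))))
        ≈⟨ ∑-comm {k} {suc r} (λ i j → (d⁻¹ F i * φ (e F i)) * (x ^ (p ℕ.^ toℕ j) * e F i ^ (p ℕ.^ toℕ j))) ⟩
      sum {suc r} (λ j → sum {k} (λ i → (d⁻¹ F i * φ (e F i)) * (x ^ (p ℕ.^ toℕ j) * e F i ^ (p ℕ.^ toℕ j))))
        ≈⟨ sum-cong-≋ {suc r} (λ j → trans (sum-cong-≋ {k} (λ i → solve 3 (λ a x y → a :* (x :* y) := (a :* y) :* x) refl (d⁻¹ F i * φ (e F i)) (x ^ (p ℕ.^ toℕ j)) (e F i ^ (p ℕ.^ toℕ j))))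
             (sym (*-distribʳ-sum {k} (x ^ (p ℕ.^ toℕ j)) (λ i → (d⁻¹ F i * φ (e F i)) * e F i ^ (p ℕ.^ toℕ j))))) ⟩
      sum {suc r} (λ j → coefficient φ j * x ^ (p ℕ.^ toℕ j)) ∎
      where
      φ-sum : ∀ {k} (f : Fin k → Carrier) → φ (sum f) ≈ sum (λ i → φ (f i))
      φ-sum {zero}  f = trans (φ-cong (sym (zeroˡ 0#))) (trans (φ-scale 0# (ι-inPrimeField 0)) (zeroˡ _))
      φ-sum {suc k} f = trans (φ-+ _ _) (+-congˡ (φ-sum (f ∘ fsuc)))

    ω-expansion : (φ : Carrier → Carrier) → (∀ {x y} → x ≈ y → φ x ≈ φ y) → (∀ x y → φ (x + y) ≈ φ x + φ y) →
      (∀ {a} x → InPrimeField a → φ (a * x) ≈ a * φ x) →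
      ∀ a → φ (ω ^ a) ≈ sum {suc r} (λ j → coefficient φ j * u j ^ a)
    ω-expansion φ φ-cong φ-+ φ-scale a = trans (expansion φ φ-cong φ-+ φ-scale (ω ^ a))
      (sum-cong-≋ {suc r} (λ j → *-cong (refl {coefficient φ j}) (swap-powers ω a (p ℕ.^ toℕ j))))

    -- Comparing the expansion of the identity with x = x ^ (p ^ 0) shows that T is the trace.
    ∑e²/d≈1 : sum {k} (λ i → d⁻¹ F i * (e F i * e F i)) ≈ 1#
    ∑e²/d≈1 = trans (sum-cong-≋ {k} (λ i → trans (sym (*-assoc _ _ _)) (*-congˡ (sym (*-identityʳ (e F i)))))) (x-y≈0⇒x≈y _ _ (independence-of-characters u γ u-distinct rel fzero))
      where
      C = coefficient (λ x → x)
      γ : Fin (suc r) → Carrier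
      γ fzero    = C fzero - 1#
      γ (fsuc j) = C (fsuc j)
      rel : ∀ a → sum (λ j → γ j * u j ^ a) ≈ 0#
      rel a = begin
        (C fzero - 1#) * u fzero ^ a + S   ≈⟨ solve 4 (λ b o v s → (b :- o) :* v :+ s := (b :* v :+ s) :- o :* v) refl (C fzero) 1# (u fzero ^ a) S ⟩
        (C fzero * u fzero ^ a + S) - 1# * u fzero ^ a ≈⟨ +-cong (sym (ω-expansion (λ x → x) (λ h → h) (λ _ _ → refl) (λ _ _ → refl) a)) (-‿cong (trans (*-identityˡ _) (^-congˡ a (*-identityʳ ω)))) ⟩
        ω ^ a - ω ^ a                      ≈⟨ -‿inverseʳ _ ⟩
        0# ∎
        where S = sum {r} (λ j → C (fsuc j) * u (fsuc j) ^ a)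

    -- The powers of `v` form one more character. Were `v` different from every `u j`, the expansion
    -- of `φ` at `ω ^ a` would be a relation in which `v` has coefficient -1.
    frobenius-power : (φ : Carrier → Carrier) → (∀ {x y} → x ≈ y → φ x ≈ φ y) → (∀ x y → φ (x + y) ≈ φ x + φ y) →
      (∀ {a} x → InPrimeField a → φ (a * x) ≈ a * φ x) → ∀ v → (∀ a → φ (ω ^ a) ≈ v ^ a) → ∃[ j ] v ≈ u j
    frobenius-power φ φ-cong φ-+ φ-scale v φω with any? (λ j → v ≟ u j)
    ... | yes w = w
    ... | no v≉ = ⊥-elim (1≉0 (trans (sym (-‿involutive 1#)) (trans (-‿cong (independence-of-characters u′ γ u′-distinct rel fzero)) -0≈0)))
      where
      u′ γ : Fin (suc (suc r)) → Carrier
      u′ fzero    = v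
      u′ (fsuc j) = u j
      γ fzero    = - 1#
      γ (fsuc j) = coefficient φ j
      u′-distinct : Distinct u′
      u′-distinct fzero    fzero    _ = ≡.refl
      u′-distinct fzero    (fsuc j) h = ⊥-elim (v≉ (j , h))
      u′-distinct (fsuc i) fzero    h = ⊥-elim (v≉ (i , sym h))
      u′-distinct (fsuc i) (fsuc j) h = ≡.cong fsuc (u-distinct i j h)
      rel : ∀ a → sum (λ j → γ j * u′ j ^ a) ≈ 0#
      rel a = begin
        - 1# * v ^ a + sum {suc r} (λ j → coefficient φ j * u j ^ a) ≈⟨ +-cong (trans (sym (-‿distribˡ-* 1# _)) (-‿cong (*-identityˡ _))) (trans (sym (ω-expansion φ φ-cong φ-+ φ-scale a)) (φω a)) ⟩
        - v ^ a + v ^ a ≈⟨ -‿inverseˡ _ ⟩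
        0# ∎

    coord : Carrier → Fin k → ℕ
    coord x i = residue (coordinate F x i)

    ι-coord : ∀ x i → ι (coord x i) ≈ coordinate F x i
    ι-coord x i = ι-residue (coordinate-inPrimeField F x i)

    lin-coord : ∀ x → x ≈ lin (e F) (coord x)
    lin-coord x = trans (complete x) (sym (trans (lin≈sum (e F) (coord x)) (sum-cong-≋ {k} (λ i → *-congʳ (ι-coord x i)))))

    lin-independent : ∀ λs → lin (e F) λs ≈ 0# → ∀ i → p ∣ λs i
    lin-independent λs h i = ι-faithful (cancel (nondeg F i) (begin
      T (e F i * e F i) * ι (λs i)                  ≈⟨ *-comm _ _ ⟩
      ι (λs i) * T (e F i * e F i)                  ≈⟨ T-combination F (λ j → ι (λs j)) (λ j → ι-inPrimeField (λs j)) i ⟨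
      T (sum (λ j → ι (λs j) * e F j) * e F i)      ≈⟨ T-cong (*-congʳ (trans (sym (lin≈sum (e F) λs)) h)) ⟩
      T (0# * e F i)                                ≈⟨ trans (T-cong (zeroˡ _)) T-0 ⟩
      0# ∎))

    Tr : Carrier → ℤ
    Tr x = ∑ℤ (λ i → ℤ.+ coord (x * e F i) i)

    -- By linearity the coordinate trace is `T (x * s)` with s the sum of the `d⁻¹ i * e i * e i`,
    -- and `∑e²/d≈1` says that s is 1.
    ιℤ-Tr : ∀ x → ιℤ (Tr x) ≈ T x
    ιℤ-Tr x = begin
      ιℤ (Tr x)                                              ≈⟨ ιℤ-sum (λ i → ℤ.+ coord (x * e F i) i) ⟩
      sum (λ i → ι (coord (x * e F i) i))                    ≈⟨ sum-cong-≋ {k} (λ i → ι-coord (x * e F i) i) ⟩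
      sum (λ i → d⁻¹ F i * T ((x * e F i) * e F i))          ≈⟨ sum-cong-≋ {k} (λ i → trans (sym (T-scale _ (inverse-inPrimeField (proj₂ (d⁻¹-spec F i)) (T-inPrimeField (e F i * e F i)))))
                                                                  (T-cong (solve 3 (λ d x e → d :* ((x :* e) :* e) := x :* (d :* (e :* e))) refl (d⁻¹ F i) x (e F i)))) ⟩
      sum (λ i → T (x * (d⁻¹ F i * (e F i * e F i))))        ≈⟨ T-sum {k} (λ i → x * (d⁻¹ F i * (e F i * e F i))) ⟨
      T (sum (λ i → x * (d⁻¹ F i * (e F i * e F i))))        ≈⟨ T-cong (*-distribˡ-sum {k} x (λ i → d⁻¹ F i * (e F i * e F i))) ⟨
      T (x * sum (λ i → d⁻¹ F i * (e F i * e F i)))          ≈⟨ T-cong (trans (*-congˡ ∑e²/d≈1) (*-identityʳ x)) ⟩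
      T x ∎

    finite-étale : IsFiniteEtaleLocal K p
    finite-étale = p≈0 , k , e F , coord , lin-coord , lin-independent ,
      unit-mod (det (λ i j → Tr (e F i * e F j)))
        (det-diagonal pr (λ i j → Tr (e F i * e F j))
        (λ i j i≢j → ιℤ-faithful (Tr (e F i * e F j)) (trans (ιℤ-Tr (e F i * e F j)) (orth F i j i≢j)))
        (λ i p∣ → nondeg F i (trans (sym (ιℤ-Tr (e F i * e F i))) (ιℤ-∣ (Tr (e F i * e F i)) p∣))))

    generated-by-degree : GeneratedByAsModule K k
    generated-by-degree = e F , λ x → coord x , lin-coord x

-- Finite fields with a primitive element

module Exponent {p : ℕ} (pr : Prime p) (r : ℕ) where

  N : ℕ
  N = p ℕ.^ suc r ℕ.∸ 1

  2≤p^ : 2 ℕ.≤ p ℕ.^ suc r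
  2≤p^ = ℕ.≤-trans (prime>1 pr) (ℕ.m≤m*n p (p ℕ.^ r) {{ℕ.>-nonZero (ℕ.m^n>0 p {{prime⇒nonZero pr}} r)}})

  sucN≡ : suc N ≡ p ℕ.^ suc r
  sucN≡ = ℕ.m+[n∸m]≡n (ℕ.<⇒≤ 2≤p^)

  instance
    N≢0 : NonZero N
    N≢0 = ℕ.>-nonZero (ℕ.∸-monoˡ-≤ 1 2≤p^)

-- The last component converts the ring-theoretic condition into a congruence: knowing that the n-th
-- power is an endomorphism of this one field determines n modulo `p ^ r - 1` up to a power of p.
GaloisField : ∀ c ℓ → ℕ → ℕ → Set (lsuc (c ⊔ ℓ))
GaloisField c ℓ p r = Σ (CommutativeRing c ℓ) λ K →
  IsFiniteEtaleLocal K p × (∃[ k ] k ℕ.≤ r × GeneratedByAsModule K k) ×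
  (∀ n → 1 ℕ.≤ n → PowerIsEndomorphism K n → ∃[ i ] (ℤ.+ (p ℕ.^ r ℕ.∸ 1)) ℤD.∣ (ℤ.+ n ℤ.- ℤ.+ (p ℕ.^ i)))

-- A maximal ideal containing the annihilator of z leaves ω its exact order p ^ (1 + r) - 1.
module FieldQuotient {c ℓ} {p : ℕ} (pr : Prime p) (r : ℕ) (R : CyclicGroupRing c ℓ p (Exponent.N pr r)) where
  open Exponent pr r
  open CyclicGroupRing R
  open CommRing A
  open ≈-Reasoning
  open CharP A pr q≈0 using (frobenius^-+)

  private
    P = p ℕ.^ suc r

  -- The P-th power map is a ring endomorphism and fixes `ω` because P = N + 1. The identity thus
  -- holds before passing to a field, where `z-unit` uses it.
  fixed : ∀ x → x ^ P ≈ x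
  fixed = induction (λ x → x ^ P ≈ x) 0^P (RingLemmas.1^ A P) ω^P
    (λ {s} {t} es et → trans (frobenius^-+ (suc r) s t) (+-cong es et))
    (λ {s} {t} es et → trans (^-distrib-* s t P) (*-cong es et))
    (λ {s} es → neg s es)
    where
    0^P : 0# ^ P ≈ 0#
    0^P = RingLemmas.0^ A (ℕ.<⇒≤ 2≤p^)
    ω^P : ω ^ P ≈ ω
    ω^P = trans (^-congʳ ω (≡.sym sucN≡)) (trans (*-congˡ ω^N≈1) (*-identityʳ ω))
    neg : ∀ s → s ^ P ≈ s → (- s) ^ P ≈ - s
    neg s es = begin
      (- s) ^ P                       ≈⟨ solve 2 (λ a b → a := (a :+ b) :- b) refl ((- s) ^ P) (s ^ P) ⟩
      ((- s) ^ P + s ^ P) - s ^ P     ≈⟨ +-cong (sym (frobenius^-+ (suc r) (- s) s)) (-‿cong es) ⟩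
      (- s + s) ^ P - s               ≈⟨ +-congʳ (trans (^-congˡ P (-‿inverseˡ s)) 0^P) ⟩
      0# - s                          ≈⟨ +-identityˡ _ ⟩
      - s ∎



  private
    annihilator : ProperIdeal A
    annihilator = record
      { I = λ x → x * z ≈ 0#
      ; isIdeal = record
        { resp = λ x≈y h → trans (*-congʳ (sym x≈y)) h
        ; 0∈ = zeroˡ z
        ; +∈ = λ {x} {y} h h′ → trans (distribʳ z x y) (trans (+-cong h h′) (+-identityˡ 0#))
        ; *∈ = λ x {y} h → trans (*-assoc x y z) (trans (*-congˡ h) (zeroʳ x)) }
      ; I? = λ x → (x * z) ≟ 0#
      ; 1∉ = λ h → z≉0 (prime>1 pr) (trans (sym (*-identityˡ z)) h) }

    maximal = Maximal.maximal-ideal A pr q≈0 gen annihilator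

  open ProperIdeal (proj₁ maximal) renaming (I to J)
  open Quotient A isIdeal using (_~_; ≈⇒~; ∈⇒~0; ~0⇒∈) renaming (A/I to K; ^≡ to K^≡; ·≡ to K·≡; generated to K-generated)
  private
    module K = CommRing K
    module KR = K.≈-Reasoning

  1≉0 : ¬ 1# ~ 0#
  1≉0 h = 1∉ (~0⇒∈ h)

  inverse : ∀ x → x ~ 0# ⊎ (∃[ y ] y * x ~ 1#)
  inverse x with proj₂ (proj₂ maximal) x
  ... | inj₁ x∈      = inj₁ (∈⇒~0 x∈)
  ... | inj₂ (y , h) = inj₂ (y , K.sym {1#} {y * x} h)

  K-char : K.ι p ~ 0#
  K-char = ≡.subst (_~ 0#) (≡.sym (K·≡ p 1#)) (≈⇒~ q≈0)

  K-fixed : ∀ x → x K.^ P ~ x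
  K-fixed x = ≡.subst (_~ x) (≡.sym (K^≡ x P)) (≈⇒~ (fixed x))

  ω^N~1 : ω K.^ N ~ 1#
  ω^N~1 = ≡.subst (_~ 1#) (≡.sym (K^≡ ω N)) (≈⇒~ ω^N≈1)

  -- z is invertible in K because z (1 - z ^ N) = 0 puts 1 - z ^ N into the annihilator of z.
  z-unit : ∃[ y ] y * z ~ 1#
  z-unit = y , K.sym {1#} {y * z} (proj₁ (proj₂ maximal) (begin
    (1# - y * z) * z                ≈⟨ solve 3 (λ o y z → (o :- y :* z) :* z := o :* z :- z :* (z :* y)) refl 1# y z ⟩
    1# * z - z * (z * y)           ≈⟨ +-cong (*-identityˡ z) (-‿cong z^P) ⟩
    z - z                           ≈⟨ -‿inverseʳ z ⟩
    0# ∎))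
    where
    y = z ^ ℕ.pred N
    z^P : z * (z * y) ≈ z
    z^P = trans (^-congʳ z (≡.trans (≡.cong suc (ℕ.suc-pred N)) sucN≡)) (fixed z)

  -- The factor `1 - ω ^ (N / l)` of `z` is nonzero in K because `z` is a unit there.
  ω^[N/l]≁1 : ∀ {l} → Prime l → (l∣N : l ∣ N) → ¬ ω K.^ ℕD.quotient l∣N ~ 1#
  ω^[N/l]≁1 {l} prl l∣N h with factor-of-z prl l∣N
  ... | w , z≈ = 1≉0 (KR.begin
    1#                                      KR.≈⟨ proj₂ z-unit ⟨
    proj₁ z-unit * z                       KR.≈⟨ K.*-congˡ (≈⇒~ z≈) ⟩
    proj₁ z-unit * (w * (1# - ω ^ d))       KR.≈⟨ K.*-congˡ (K.*-congˡ (K.x≈y⇒x-y≈0 (K.sym (≡.subst (_~ 1#) (K^≡ ω d) h)))) ⟩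
    proj₁ z-unit * (w * 0#)                 KR.≈⟨ K.trans (K.*-congˡ (K.zeroʳ w)) (K.zeroʳ _) ⟩
    0# KR.∎)
    where
    d = ℕD.quotient l∣N

  ω^*~1 : ∀ d t → ω K.^ d ~ 1# → ω K.^ (t ℕ.* d) ~ 1#
  ω^*~1 d t h = K.trans (K.^-congʳ ω (ℕ.*-comm t d)) (K.trans (K.sym (K.^-assocʳ ω d t)) (K.trans (K.^-congˡ t h) (RingLemmas.1^ K t)))

  ω^gcd~1 : ∀ D → ω K.^ D ~ 1# → ω K.^ gcd D N ~ 1#
  ω^gcd~1 D h with Bézout.identity (GCD.gcd-GCD D N)
  ... | Bézout.+- x y eq = K.trans (K.sym (K.*-identityʳ _)) (K.trans (K.*-congˡ (K.sym (ω^*~1 N y ω^N~1))) (K.trans (K.sym (K.^-homo-* ω (gcd D N) (y ℕ.* N))) (K.trans (K.^-congʳ ω eq) (ω^*~1 D x h))))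
  ... | Bézout.-+ x y eq = K.trans (K.sym (K.*-identityʳ _)) (K.trans (K.*-congˡ (K.sym (ω^*~1 D x h))) (K.trans (K.sym (K.^-homo-* ω (gcd D N) (x ℕ.* D))) (K.trans (K.^-congʳ ω eq) (ω^*~1 N y ω^N~1))))

  -- With g = gcd D N one has `ω ^ g ~ 1#`. If g were a proper divisor of N, a prime l dividing N /
  -- g would give `ω ^ (N / l) ~ 1#`.
  ω-order′ : ∀ D → ω K.^ D ~ 1# → N ∣ D
  ω-order′ D h with gcd[m,n]∣n D N
  ... | divides zero          N≡ = ⊥-elim (ℕ.≢-nonZero⁻¹ N N≡)
  ... | divides (suc zero)    N≡ = ≡.subst (_∣ D) (≡.trans (≡.sym (ℕ.*-identityˡ _)) (≡.sym N≡)) (gcd[m,n]∣m D N)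
  ... | divides t@(suc (suc _)) N≡ with ∃prime∣ t (s≤s (s≤s z≤n))
  ...   | l , prl , divides t′ t≡ = ⊥-elim (ω^[N/l]≁1 prl (divides (t′ ℕ.* gcd D N) N≡′) (ω^*~1 (gcd D N) t′ (ω^gcd~1 D h)))
    where
    N≡′ : N ≡ (t′ ℕ.* gcd D N) ℕ.* l
    N≡′ = ≡.trans N≡ (≡.trans (≡.cong (ℕ._* gcd D N) t≡) (≡.trans (ℕ.*-assoc t′ l _) (≡.trans (≡.cong (t′ ℕ.*_) (ℕ.*-comm l _)) (≡.sym (ℕ.*-assoc t′ _ l)))))

  ω-order : ∀ a b → a ℕ.≤ b → ω K.^ a ~ ω K.^ b → N ∣ b ℕ.∸ a
  ω-order a b a≤b h = ω-order′ (b ℕ.∸ a) (KR.begin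
    ω K.^ (b ℕ.∸ a)                                   KR.≈⟨ K.*-identityʳ _ ⟨
    ω K.^ (b ℕ.∸ a) * 1#                              KR.≈⟨ K.*-congˡ ω^a-unit ⟨
    ω K.^ (b ℕ.∸ a) * (ω K.^ a * ω K.^ a′)            KR.≈⟨ K.*-assoc _ _ _ ⟨
    ω K.^ (b ℕ.∸ a) * ω K.^ a * ω K.^ a′              KR.≈⟨ K.*-congʳ (K.^-homo-* ω (b ℕ.∸ a) a) ⟨
    ω K.^ (b ℕ.∸ a ℕ.+ a) * ω K.^ a′                  KR.≈⟨ K.*-congʳ (K.trans (K.^-congʳ ω (ℕ.m∸n+n≡m a≤b)) (K.sym h)) ⟩
    ω K.^ a * ω K.^ a′                                KR.≈⟨ ω^a-unit ⟩
    1# KR.∎)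
    where
    a′ = ℕ.pred N ℕ.* a
    ω^a-unit : ω K.^ a * ω K.^ a′ ~ 1#
    ω^a-unit = K.trans (K.sym (K.^-homo-* ω a a′)) (K.trans (K.^-congʳ ω (≡.cong (ℕ._* a) (ℕ.suc-pred N))) (K.trans (K.sym (K.^-assocʳ ω N a)) (K.trans (K.^-congˡ a ω^N~1) (RingLemmas.1^ K a))))

  frobenius-field : FrobeniusField K p r
  frobenius-field = record { 1≉0 = 1≉0 ; inverse = inverse ; _≟_ = λ x y → I? (x - y) ; p≈0 = K-char ; gen = K-generated gen
                           ; fixed = K-fixed ; ω = ω ; ω-order = ω-order }

  module _ (p≢2 : p ≢ 2) where
    open TraceForm K pr p≢2 frobenius-field
    private
      k = proj₁ orthogonal-basis
      F = proj₁ (proj₂ orthogonal-basis)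
      complete = proj₂ (proj₂ orthogonal-basis)
      open Basis F complete

    étale : IsFiniteEtaleLocal K p
    étale = finite-étale

    degree : ∃[ k ] k ℕ.≤ suc r × GeneratedByAsModule K k
    degree = k , OrthogonalFamily.size-bound F , generated-by-degree

    power-endomorphism : ∀ n → 1 ℕ.≤ n → PowerIsEndomorphism K n → ∃[ i ] (ℤ.+ N) ℤD.∣ (ℤ.+ n ℤ.- ℤ.+ (p ℕ.^ i))
    power-endomorphism n 1≤n (n-+ , n-* , n-1) = toℕ (proj₁ found) , difference n (p ℕ.^ toℕ (proj₁ found)) (proj₂ found)
      where
      -- Additivity and `1 ^ n = 1` make the n-th power map fix the prime field; multiplicativity
      -- then makes it linear over it, as the expansion requires.
      ι^n : ∀ k → K.ι k K.^ n ~ K.ι k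
      ι^n zero    = RingLemmas.0^ K 1≤n
      ι^n (suc k) = K.trans (n-+ 1# (K.ι k)) (K.+-cong n-1 (ι^n k))
      scale : ∀ {a} x → InPrimeField a → (a * x) K.^ n ~ a * x K.^ n
      scale {a} x fa = K.trans (n-* a x) (K.*-congʳ (K.trans (K.^-congˡ n (K.sym (ι-residue fa))) (K.trans (ι^n (residue a)) (ι-residue fa))))
      found : ∃[ j ] ω K.^ n ~ u j
      found = frobenius-power (K._^ n) (K.^-congˡ n) n-+ scale (ω K.^ n) (λ a → swap-powers ω a n)
      difference : ∀ a b → ω K.^ a ~ ω K.^ b → N ∣ ℤ.∣ ℤ.+ a ℤ.- ℤ.+ b ∣
      difference a b h with ℕ.≤-total a b
      ... | inj₁ a≤b = ≡.subst (N ∣_) (≡.sym (≡.trans (≡.cong ℤ.∣_∣ (ℤ.[+m]-[+n]≡m⊖n a b)) (ℤ.∣⊖∣-≤ a≤b))) (ω-order a b a≤b h)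
      ... | inj₂ b≤a = ≡.subst (N ∣_) (≡.sym (≡.cong ℤ.∣_∣ (≡.trans (ℤ.[+m]-[+n]≡m⊖n a b) (ℤ.⊖-≥ b≤a)))) (ω-order b a b≤a (K.sym h))

    galois-field : GaloisField c ℓ p (suc r)
    galois-field = K , étale , degree , power-endomorphism

finite-field : ∀ c ℓ {p} → Prime p → p ≢ 2 → ∀ r → GaloisField c ℓ p (suc r)
finite-field c ℓ {p} pr p≢2 r = FieldQuotient.galois-field pr r (cyclicGroupRing c ℓ p N (prime>0 pr) (ℕ.∸-monoˡ-≤ 1 2≤p^)) p≢2
  where open Exponent pr r

-- From étale algebras to Korselt’s condition

quotient<  : ∀ {p n} → Prime p → 1 ℕ.≤ n → (p∣n : p ∣ n) → ℕD.quotient p∣n ℕ.< n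
quotient< pr 1≤n p∣n = ℕD.quotient-< p∣n {{prime⇒nonTrivial pr}} {{ℕ.>-nonZero 1≤n}}

split-prime-power : ∀ {p} → Prime p → ∀ n → 1 ℕ.≤ n → ∃[ v ] ∃[ n′ ] n ≡ p ℕ.^ v ℕ.* n′ × ¬ p ∣ n′
split-prime-power {p} pr = <-rec _ λ n rec 1≤n → step n rec 1≤n (p ∣? n)
  where
  step : ∀ n → (∀ {k} → k ℕ.< n → 1 ℕ.≤ k → ∃[ v ] ∃[ n′ ] k ≡ p ℕ.^ v ℕ.* n′ × ¬ p ∣ n′) → 1 ℕ.≤ n → Dec (p ∣ n) →
         ∃[ v ] ∃[ n′ ] n ≡ p ℕ.^ v ℕ.* n′ × ¬ p ∣ n′
  step n rec 1≤n (no p∤n) = 0 , n , ≡.sym (ℕ.*-identityˡ n) , p∤n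
  step n rec 1≤n (yes p∣n) with rec (quotient< pr 1≤n p∣n) (1≤k p∣n)
    where
    1≤k : (p∣n : p ∣ n) → 1 ℕ.≤ ℕD.quotient p∣n
    1≤k (divides zero    e) = ⊥-elim (ℕ.<⇒≢ 1≤n (≡.sym e))
    1≤k (divides (suc _) _) = s≤s z≤n
  ... | v , n′ , e , p∤n′ = suc v , n′ , ≡.trans (ℕD._∣_.equality p∣n) (≡.trans (≡.cong (ℕ._* p) e)
          (≡.trans (ℕ.*-comm _ p) (≡.sym (ℕ.*-assoc p (p ℕ.^ v) n′)))) , p∤n′

LocalDecomposition : ℕ → Set
LocalDecomposition n = ∃[ t ] Σ (Fin t → ℕ) λ q → IsLocalDecomposition n q

factor∣∏ : ∀ {t} (q : Fin t → ℕ) i → q i ∣ ∏ℕ q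
factor∣∏ q fzero    = ℕD.m∣m*n (∏ℕ (q ∘ fsuc))
factor∣∏ q (fsuc i) = ℕD.∣n⇒∣m*n (q fzero) (factor∣∏ (q ∘ fsuc) i)

decomposition-cons : ∀ {q₀ n′ t} {q : Fin t → ℕ} → IsPrimePower q₀ → Coprime q₀ n′ →
                     IsLocalDecomposition n′ q → IsLocalDecomposition (q₀ ℕ.* n′) (q₀ Vector.∷ q)
decomposition-cons {q₀} {n′} {t} {q} pp cop (pps , cops , ∏≡) =
  (λ { fzero → pp ; (fsuc i) → pps i }) ,
  (λ { fzero    fzero    0≢0 → ⊥-elim (0≢0 ≡.refl)
     ; fzero    (fsuc j) _   → λ d d∣q₀ d∣q → cop (d∣q₀ , ∣n′ j d∣q)
     ; (fsuc i) fzero    _   → λ d d∣q d∣q₀ → cop (d∣q₀ , ∣n′ i d∣q)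
     ; (fsuc i) (fsuc j) i≢j → cops i j (i≢j ∘ ≡.cong fsuc) }) ,
  ≡.cong (q₀ ℕ.*_) ∏≡
  where
  ∣n′ : ∀ j {d} → d ∣ q j → d ∣ n′
  ∣n′ j d∣q = ℕD.∣-trans d∣q (≡.subst (q j ∣_) ∏≡ (factor∣∏ q j))

prime^-coprime : ∀ {p k} → Prime p → ¬ p ∣ k → ∀ v → Coprime (p ℕ.^ v) k
prime^-coprime pr p∤k zero    (d∣1 , _) = ℕD.∣1⇒≡1 d∣1
prime^-coprime {p} {k} pr p∤k (suc v) {d} (d∣ , d∣k) = prime^-coprime pr p∤k v (coprime-divisor d-p d∣ , d∣k)
  where
  d-p : Coprime d p
  d-p (e∣d , e∣p) = prime⇒coprime-∤ pr p∤k (e∣p , ℕD.∣-trans e∣d d∣k)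

-- Strong induction: the full power of one prime factor is split off, and the coprime cofactor is
-- smaller.
local-decomposition : ∀ n → 1 ℕ.≤ n → LocalDecomposition n
local-decomposition = <-rec _ step
  where
  step : ∀ n → (∀ {k} → k ℕ.< n → 1 ℕ.≤ k → LocalDecomposition k) → 1 ℕ.≤ n → LocalDecomposition n
  step (suc zero) rec _ = 0 , (λ ()) , (λ ()) , (λ ()) , ≡.refl
  step n@(suc (suc _)) rec 1≤n with ∃prime∣ n (s≤s (s≤s z≤n))
  ... | p , pr , p∣n with split-prime-power pr n 1≤n
  ...   | zero , n′ , e , p∤n′ = ⊥-elim (p∤n′ (≡.subst (p ∣_) (≡.trans e (ℕ.*-identityˡ n′)) p∣n))
  ...   | suc v , zero , e , p∤n′ = ⊥-elim (p∤n′ (p ℕD.∣0))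
  ...   | suc v , n′@(suc _) , e , p∤n′ with rec n′<n (s≤s z≤n)
    where
    n′<n : n′ ℕ.< n
    n′<n = ≡.subst (n′ ℕ.<_) (≡.sym (≡.trans e (ℕ.*-comm (p ℕ.^ suc v) n′))) (ℕ.m<m*n n′ (p ℕ.^ suc v)
      (ℕ.≤-trans (prime>1 pr) (ℕ.m≤m*n p (p ℕ.^ v) {{ℕ.>-nonZero (ℕ.m^n>0 p {{prime⇒nonZero pr}} v)}})))
  ...     | t , q , dec = suc t , p ℕ.^ suc v Vector.∷ q ,
            ≡.subst (λ k → IsLocalDecomposition k (p ℕ.^ suc v Vector.∷ q)) (≡.sym e) (decomposition-cons (p , suc v , pr , s≤s z≤n , ≡.refl) (prime^-coprime pr p∤n′ (suc v)) dec)

module _ {c ℓ : Level} where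

  zeroRing : CommutativeRing c ℓ
  zeroRing = record { isCommutativeRing = record { isRing = Ring.isRing (Terminal.ring {c} {ℓ}) ; *-comm = λ _ _ → _ } }

  -- Rank 0: the empty determinant is 1, which is its own inverse, leaving `q ∣ 0`.
  zero-étale : ∀ q → IsFiniteEtaleLocal zeroRing q
  zero-étale q = _ , 0 , (λ ()) , (λ _ ()) , _ , (λ _ _ ()) , ℤ.1ℤ , q ℕD.∣0

  -- K over the local factor ℤ/q₀, zero over the others.
  étale-from-local : ∀ {n q₀ n′} (K : CommutativeRing c ℓ) → IsPrimePower q₀ → Coprime q₀ n′ → 1 ℕ.≤ n′ → n ≡ q₀ ℕ.* n′ →
                     IsFiniteEtaleLocal K q₀ → IsFiniteEtale n K
  étale-from-local {_} {q₀} {n′} K pp cop 1≤n′ ≡.refl étK with local-decomposition n′ 1≤n′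
  ... | t , q , dec = trans (ι-* q₀ n′) (trans (*-congʳ (proj₁ étK)) (zeroˡ _)) , suc t , q₀ Vector.∷ q , decomposition-cons pp cop dec , S ,
      (λ { fzero → étK ; (fsuc i) → zero-étale (q i) }) ,
      (λ { a fzero → a ; a (fsuc i) → _ }) , (λ u → u fzero) ,
      (λ { a≈b fzero → a≈b ; a≈b (fsuc i) → _ }) , (λ u≈v → u≈v fzero) ,
      (λ { a b fzero → refl ; a b (fsuc i) → _ }) ,
      (λ { a b fzero → refl ; a b (fsuc i) → _ }) ,
      (λ { fzero → refl ; (fsuc i) → _ }) ,
      (λ a → refl) ,
      (λ { u fzero → refl ; u (fsuc i) → _ })
    where
    open CommRing K
    S : Fin (suc t) → CommutativeRing c ℓ
    S fzero    = K
    S (fsuc _) = zeroRing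

  module PadGenerators (A : CommutativeRing c ℓ) where
    open CommRing A

    pad : ∀ {k m} → k ℕ.≤′ m → GeneratedByAsModule A k → GeneratedByAsModule A m
    pad ℕ.≤′-refl       gen = gen
    pad (ℕ.≤′-step k≤m) gen with pad k≤m gen
    ... | g , G = g′ , λ a → d′ a , trans (proj₂ (G a)) (sym (+-identityˡ _))
      where
      g′ : _ → Carrier
      g′ fzero    = 0#
      g′ (fsuc i) = g i
      d′ : ∀ a → _ → ℕ
      d′ a fzero    = 0
      d′ a (fsuc i) = proj₁ (G a) i

  module PrimePowerRing {q} (2≤q : 2 ℕ.≤ q) (R : CyclicGroupRing c ℓ q 1) where
    open CyclicGroupRing R
    open CommRing A
    open ≈-Reasoning

    private
      q≡ : suc (ℕ.pred q) ≡ q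
      q≡ = ℕ.suc-pred q {{ℕ.>-nonZero (ℕ.<⇒≤ 2≤q)}}

      ι-pred-q : 1# + ι (ℕ.pred q) ≈ 0#
      ι-pred-q = trans (reflexive (≡.cong ι q≡)) q≈0

    -- For N = 1 the generator satisfies `ω ≈ 1#`, and -1 is the integer q - 1.
    integral : ∀ a → Σ ℕ λ k → a ≈ ι k
    integral = induction (λ a → Σ ℕ λ k → a ≈ ι k)
      (0 , refl) (1 , sym (+-identityʳ 1#)) (1 , trans (sym (*-identityʳ ω)) (trans ω^N≈1 (sym (+-identityʳ 1#))))
      (λ (j , e) (k , e′) → j ℕ.+ k , trans (+-cong e e′) (sym (ι-+ j k)))
      (λ (j , e) (k , e′) → j ℕ.* k , trans (*-cong e e′) (sym (ι-* j k)))
      (λ {s} (k , e) → ℕ.pred q ℕ.* k , (begin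
        - s                                          ≈⟨ -‿cong e ⟩
        - ι k                                        ≈⟨ solve 3 (λ o p k → :- k := (p :* k :- (o :+ p) :* k) :+ (o :* k :- k)) refl 1# (ι (ℕ.pred q)) (ι k) ⟩
        (ι (ℕ.pred q) * ι k - (1# + ι (ℕ.pred q)) * ι k) + (1# * ι k - ι k)
          ≈⟨ +-cong (+-cong (sym (ι-* (ℕ.pred q) k)) (trans (-‿cong (trans (*-congʳ ι-pred-q) (zeroˡ _))) -0≈0)) (x≈y⇒x-y≈0 (*-identityˡ _)) ⟩
        (ι (ℕ.pred q ℕ.* k) + 0#) + 0#               ≈⟨ trans (+-identityʳ _) (+-identityʳ _) ⟩
        ι (ℕ.pred q ℕ.* k) ∎))

    coord : Carrier → Fin 1 → ℕ
    coord a _ = proj₁ (integral a)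

    lin-coord : ∀ a → a ≈ lin (λ (_ : Fin 1) → 1#) (coord a)
    lin-coord a = trans (proj₂ (integral a)) (sym (+-identityʳ _))

    étale : IsFiniteEtaleLocal A q
    étale = q≈0 , 1 , (λ _ → 1#) , coord , lin-coord ,
      (λ { λs h fzero → ι≈0⇒q∣ (λs fzero) (trans (sym (+-identityʳ _)) h) }) ,
      -- The Gram matrix has the single entry k, some natural number with `ι k ≈ 1#`. Hence k ≡ 1
      -- modulo q, and 1 is an inverse whichever representative `coord` picks.
      ℤ.1ℤ , ≡.subst (λ i → (ℤ.+ q) ℤD.∣ i) (≡.sym det≡) (unit k (proj₂ (integral _)))
      where
      k = proj₁ (integral ((1# * 1#) * 1#))
      Tr : Carrier → ℤ
      Tr x = ∑ℤ (λ i → ℤ.+ coord (x * 1#) i)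
      det≡ : det (λ (i j : Fin 1) → Tr (1# * 1#)) ℤ.* ℤ.1ℤ ℤ.- ℤ.1ℤ ≡ ℤ.+ k ℤ.- ℤ.1ℤ
      det≡ = 1×1 (ℤ.+ k)
        where
        1×1 : ∀ x → (ℤ.1ℤ ℤ.* ((x ℤ.+ ℤ.0ℤ) ℤ.* ℤ.1ℤ) ℤ.+ ℤ.0ℤ) ℤ.* ℤ.1ℤ ℤ.- ℤ.1ℤ ≡ x ℤ.- ℤ.1ℤ
        1×1 x = ≡.cong (ℤ._- ℤ.1ℤ) (≡.trans (ℤ.*-identityʳ (ℤ.1ℤ ℤ.* ((x ℤ.+ ℤ.0ℤ) ℤ.* ℤ.1ℤ) ℤ.+ ℤ.0ℤ)) (≡.trans (ℤ.+-identityʳ (ℤ.1ℤ ℤ.* ((x ℤ.+ ℤ.0ℤ) ℤ.* ℤ.1ℤ)))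
          (≡.trans (ℤ.*-identityˡ ((x ℤ.+ ℤ.0ℤ) ℤ.* ℤ.1ℤ)) (≡.trans (ℤ.*-identityʳ (x ℤ.+ ℤ.0ℤ)) (ℤ.+-identityʳ x)))))
      unit : ∀ k → (1# * 1#) * 1# ≈ ι k → q ∣ ℤ.∣ ℤ.+ k ℤ.- ℤ.1ℤ ∣
      unit zero    e = ι≈0⇒q∣ 1 (trans (+-identityʳ 1#) (trans (sym (trans (*-identityʳ _) (*-identityʳ _))) e))
      unit (suc k) e = ι≈0⇒q∣ k (begin
        ι k                   ≈⟨ solve 2 (λ o k → k := (o :+ k) :- o) refl 1# (ι k) ⟩
        ι (suc k) - 1#        ≈⟨ x≈y⇒x-y≈0 (trans (sym e) (trans (*-identityʳ _) (*-identityʳ _))) ⟩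
        0# ∎)

  module EtaleToKorselt {m n : ℕ} (1≤m : 1 ℕ.≤ m) (comp : Composite n) (cond : EtaleCondition c ℓ m n) where

    1≤n = ℕ.<⇒≤ (composite>1 comp)

    -- In ℤ/pᵛℤ with v ≥ 2, the nilpotent element p would equal its n-th power.
    no-repeated-factor : ∀ {p v n′} → Prime p → 2 ℕ.≤ v → ¬ p ∣ n′ → 1 ℕ.≤ n′ → n ≡ p ℕ.^ v ℕ.* n′ →
                         CyclicGroupRing c ℓ (p ℕ.^ v) 1 → ⊥
    no-repeated-factor {v = suc zero} _ (s≤s ())
    no-repeated-factor {p} {v@(suc (suc w))} {n′} pr _ p∤n′ 1≤n′ n≡ R =
      prime∤1 pr (ℕD.*-cancelˡ-∣ p {{prime⇒nonZero pr}}
        (≡.subst (p ℕ.* p ∣_) (≡.sym (ℕ.*-identityʳ p)) (ℕD.∣-trans (ℕD.*-monoʳ-∣ p (ℕD.m∣m*n (p ℕ.^ w))) (ι≈0⇒q∣ p p≈0))))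
      where
      open CyclicGroupRing R
      open CommRing A
      open RingLemmas A
      2≤q : 2 ℕ.≤ p ℕ.^ v
      2≤q = ℕ.≤-trans (prime>1 pr) (ℕ.m≤m*n p (p ℕ.^ suc w) {{ℕ.>-nonZero (ℕ.m^n>0 p {{prime⇒nonZero pr}} (suc w))}})
      endo : PowerIsEndomorphism A n
      endo = cond A (étale-from-local A (p , v , pr , s≤s z≤n , ≡.refl) (prime^-coprime pr p∤n′ v) 1≤n′ n≡ (PrimePowerRing.étale 2≤q R))
        (PadGenerators.pad A (ℕ.≤⇒≤′ 1≤m) gen)
      ι^n : ∀ k → ι k ^ n ≈ ι k
      ι^n zero    = 0^ 1≤n
      ι^n (suc k) = trans (proj₁ endo 1# (ι k)) (+-cong (proj₂ (proj₂ endo)) (ι^n k))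
      ι-^ : ∀ j → ι p ^ j ≈ ι (p ℕ.^ j)
      ι-^ zero    = sym (+-identityʳ 1#)
      ι-^ (suc j) = trans (*-congˡ (ι-^ j)) (sym (ι-* p (p ℕ.^ j)))
      p≈0 : ι p ≈ 0#
      -- The identity `ι p ≈ ι p ^ n` is read as `ι p ≈ ι p ^ (n - 1) * ι p`; as n ≥ 2, the factor
      -- `ι p ^ (n - 1)` is nilpotent.
      p≈0 = absorb-nil {w = ι p ^ ℕ.pred n} (v , trans (^-assocʳ (ι p) (ℕ.pred n) v) (nil-≤ {ι p} {v} {ℕ.pred n ℕ.* v} (ℕ.m≤n*m v (ℕ.pred n) {{ℕ.>-nonZero (ℕ.pred-mono-≤ (composite>1 comp))}}) (trans (ι-^ v) q≈0)))
        (trans (sym (ι^n p)) (trans (^-congʳ (ι p) (≡.sym (ℕ.suc-pred n {{ℕ.>-nonZero 1≤n}}))) (*-comm _ _)))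

    squarefree : SquareFree n
    squarefree p pr pp∣n with split-prime-power pr n 1≤n
    ... | v , zero , e , p∤n′ = p∤n′ (p ℕD.∣0)
    ... | zero , n′ , e , p∤n′ = p∤n′ (≡.subst (p ∣_) (≡.trans e (ℕ.*-identityˡ n′)) (ℕD.∣-trans (ℕD.m∣m*n p) pp∣n))
    ... | suc zero , n′ , e , p∤n′ = p∤n′ (ℕD.*-cancelˡ-∣ p {{prime⇒nonZero pr}} (≡.subst (p ℕ.* p ∣_) (≡.trans e (≡.cong (ℕ._* n′) (ℕ.*-identityʳ p))) pp∣n))
    ... | v@(suc (suc _)) , suc _ , e , p∤n′ = no-repeated-factor {v = v} pr (s≤s (s≤s z≤n)) p∤n′ (s≤s z≤n) e
      (cyclicGroupRing c ℓ (p ℕ.^ v) 1 (ℕ.m^n>0 p {{prime⇒nonZero pr}} v) ℕ.≤-refl)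

    cofactor : ∀ {p} → Prime p → p ∣ n → ∃[ n′ ] 1 ℕ.≤ n′ × Coprime p n′ × n ≡ p ℕ.* n′
    cofactor {p} pr p∣n = n′ , ℕ.<⇒≤ (composite-cofactor comp pr p∣n) , prime⇒coprime-∤ pr (λ p∣n′ → squarefree p pr (≡.subst (p ℕ.* p ∣_) (≡.sym n≡) (ℕD.*-monoʳ-∣ p p∣n′))) , n≡
      where
      n′ = ℕD.quotient p∣n
      n≡ : n ≡ p ℕ.* n′
      n≡ = ≡.trans (ℕD._∣_.equality p∣n) (ℕ.*-comm n′ p)

    odd-case : ∀ {p} → Prime p → p ≢ 2 → p ∣ n → ∀ r → 1 ℕ.≤ r → r ℕ.≤ m →
               ∃[ i ] (ℤ.+ (p ℕ.^ r ℕ.∸ 1)) ℤD.∣ (ℤ.+ n ℤ.- ℤ.+ (p ℕ.^ i))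
    odd-case {p} pr p≢2 p∣n (suc r) _ r≤m = via (finite-field c ℓ pr p≢2 r) (cofactor pr p∣n)
      where
      via : GaloisField c ℓ p (suc r) → ∃[ n′ ] 1 ℕ.≤ n′ × Coprime p n′ × n ≡ p ℕ.* n′ → ∃[ i ] (ℤ.+ (p ℕ.^ suc r ℕ.∸ 1)) ℤD.∣ (ℤ.+ n ℤ.- ℤ.+ (p ℕ.^ i))
      via (K , étK , (k , k≤r , genK) , exponent) (n′ , 1≤n′ , cop , n≡) = exponent n 1≤n
        (cond K (étale-from-local K (p , 1 , pr , ℕ.≤-refl , ≡.sym (ℕ.*-identityʳ p)) cop 1≤n′ n≡ étK) (PadGenerators.pad K (ℕ.≤⇒≤′ (ℕ.≤-trans k≤r r≤m)) genK))

    -- Otherwise n ≡ qⁱ (mod q - 1) for an odd prime q ∣ n, which makes q even.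
    2∤n : ¬ 2 ∣ n
    2∤n 2∣n = q≢2 (≡.sym (prime∣prime prime[2] prq (prime∣^ prime[2] q i (∣-difference n (q ℕ.^ i) (ℕD.∣-trans 2∣q-1 (proj₂ found)) 2∣n))))
      where
      k = ℕD.quotient 2∣n
      other = ∃prime∣ k (composite-cofactor comp prime[2] 2∣n)
      q = proj₁ other
      prq = proj₁ (proj₂ other)
      q≢2 : q ≢ 2
      q≢2 q≡2 = squarefree 2 prime[2] (≡.subst (4 ∣_) (≡.sym (ℕD._∣_.equality 2∣n)) (ℕD.*-monoˡ-∣ 2 (≡.subst (_∣ k) q≡2 (proj₂ (proj₂ other)))))
      q∣n : q ∣ n
      q∣n = ≡.subst (q ∣_) (≡.sym (ℕD._∣_.equality 2∣n)) (ℕD.∣-trans (proj₂ (proj₂ other)) (ℕD.m∣m*n 2))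
      found = odd-case prq q≢2 q∣n 1 ℕ.≤-refl 1≤m
      i = proj₁ found
      even⊎odd : ∀ k → 2 ∣ k ⊎ 2 ∣ suc k
      even⊎odd zero    = inj₁ (2 ℕD.∣0)
      even⊎odd (suc k) with even⊎odd k
      ... | inj₁ 2∣k  = inj₂ (ℕD.∣m∣n⇒∣m+n {2} {2} {k} ℕD.∣-refl 2∣k)
      ... | inj₂ 2∣sk = inj₁ 2∣sk
      2∣q-1 : 2 ∣ q ℕ.^ 1 ℕ.∸ 1
      2∣q-1 = ≡.subst (λ j → 2 ∣ j ℕ.∸ 1) (≡.sym (ℕ.*-identityʳ q)) (go q prq q≢2)
        where
        go : ∀ q → Prime q → q ≢ 2 → 2 ∣ q ℕ.∸ 1
        go zero    _  _   = 2 ℕD.∣0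
        go (suc q) pr q≢2 with even⊎odd q
        ... | inj₁ 2∣q  = 2∣q
        ... | inj₂ 2∣sq = ⊥-elim (q≢2 (≡.sym (prime∣prime prime[2] pr 2∣sq)))

    korselt : KorseltCondition m n
    korselt = squarefree , λ p pr p∣n → odd-case pr (λ { ≡.refl → 2∤n p∣n }) p∣n

theorem1 : (c ℓ : Level) (m n : ℕ) → 1 ≤ m → Composite n →
    (IsCarmichaelOfOrder c ℓ m n ⇔ EtaleCondition c ℓ m n) ×
    (IsCarmichaelOfOrder c ℓ m n ⇔ KorseltCondition m n)
theorem1 c ℓ m n 1≤m comp =
  mk⇔ carmichael⇒étale (λ cond → korselt⇒carmichael c ℓ m n comp (étale⇒korselt cond)) ,
  mk⇔ (λ car → étale⇒korselt (carmichael⇒étale car)) (korselt⇒carmichael c ℓ m n comp)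
  where
  carmichael⇒étale : IsCarmichaelOfOrder c ℓ m n → EtaleCondition c ℓ m n
  carmichael⇒étale (_ , endo) A ét = endo A (proj₁ ét)
  étale⇒korselt : EtaleCondition c ℓ m n → KorseltCondition m n
  étale⇒korselt cond = EtaleToKorselt.korselt 1≤m comp cond
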